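{- There is a family of graphs $G$ such that $$\mathbf{coNP}^{cc}(\mathrm{CIS}_G)\ \ge\ \Omega(\log^{1.22} n),$$ where $n$ is the number of vertices of $G$.
   Context: For a graph $G$ on $n$ vertices, the Clique vs. Independent Set problem $\mathrm{CIS}_G$ is the two-party function in which Alice receives a clique $x\subseteq V(G)$, Bob receives an independent set $y\subseteq V(G)$, and $\mathrm{CIS}_G(x,y)=|x\cap y|\in\{0,1\}$. For a two-party function $F:X\times Y\to\{0,1\}$, the co-nondeterministic communication complexity $\mathbf{coNP}^{cc}(F)$ is $\log_2$ of the minimum number of (possibly overlapping) rectangles $A\times B$ ($A\subseteq X$, $B\subseteq Y$) whose union is $F^{ -1}(0)$. "Family of graphs" means an infinite sequence of graphs with $n\to\infty$; $\log^{1.22}n=(\log n)^{1.22}$ and $\Omega$ hides an absolute positive constant. -}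

module Defs where

open import Data.Fin using (Fin; zero; fromℕ<)
open import Data.Fin.Properties using (_≟_; suc-injective; 0≢1+n)
open import Data.Fin.Subset using (Subset; _∈_; _∩_; ∣_∣; inside; outside)
open import Data.Fin.Subset.Properties using (Empty-unique; ∣⊥∣≡0; x∈p∩q⁻)
open import Data.Integer using (+_)
open import Data.Irrelevant using ([_])
open import Data.Nat using (ℕ; suc; _≤_; _<_; _^_; NonZero; s≤s; z≤n)
open import Data.Nat.Properties using (≤-reflexive)
open import Data.Product using (∃; _×_; _,_)
open import Data.Rational as ℚ using (ℚ)
open import Data.Refinement using (Refinement-syntax; _,_)
open import Data.Vec using ([]; _∷_; here; there)
open import Level using (0ℓ)
open import Relation.Binary using (Rel; Decidable; Symmetric)
open import Relation.Binary.PropositionalEquality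
  using (_≡_; _≢_; trans; cong)
open import Relation.Nullary using (¬_; yes; no; contradiction)
open import Relation.Unary using (Pred; _≐_; ⋃; _⟨×⟩_)

open import Algebra.Definitions.RawSemiring ℚ.+-*-rawSemiring
  using () renaming (_^_ to _^ℚ_)

record Graph : Set₁ where
  field
    order  : ℕ
    Adj    : Rel (Fin order) 0ℓ
    adj?   : Decidable Adj
    symm   : Symmetric Adj
    irrefl : ∀ {v} → ¬ Adj v v

open Graph public using (order)

module _ (G : Graph) where
  open Graph G using (Adj)

  IsClique : Pred (Subset (order G)) 0ℓ
  IsClique x = ∀ {u v} → u ∈ x → v ∈ x → u ≢ v → Adj u v

  IsIndependent : Pred (Subset (order G)) 0ℓ
  IsIndependent y = ∀ {u v} → u ∈ y → v ∈ y → ¬ Adj u v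

  -- Refinement types, so that two inputs with the same vertex set are equal.
  Clique : Set
  Clique = [ x ∈ Subset (order G) ∣ IsClique x ]

  IndependentSet : Set
  IndependentSet = [ y ∈ Subset (order G) ∣ IsIndependent y ]

∣p∣<2 : ∀ {n} (p : Subset n) → (∀ {u v} → u ∈ p → v ∈ p → u ≡ v) → ∣ p ∣ < 2
∣p∣<2 []            _      = s≤s z≤n
∣p∣<2 (outside ∷ p) unique =
  ∣p∣<2 p λ u∈p v∈p → suc-injective (unique (there u∈p) (there v∈p))
∣p∣<2 {suc n} (inside ∷ p) unique = s≤s (s≤s (≤-reflexive ∣p∣≡0))
  where
  p≡⊥ = Empty-unique {p = p} λ (_ , v∈p) → 0≢1+n (unique here (there v∈p))
  ∣p∣≡0 = trans (cong ∣_∣ p≡⊥) (∣⊥∣≡0 n)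

∣clique∩independent∣<2 : ∀ G {x y} → IsClique G x → IsIndependent G y →
                         ∣ x ∩ y ∣ < 2
∣clique∩independent∣<2 G {x} {y} clique indep = ∣p∣<2 (x ∩ y) unique
  where
  unique : ∀ {u v} → u ∈ x ∩ y → v ∈ x ∩ y → u ≡ v
  unique {u} {v} u∈ v∈ with u ≟ v | x∈p∩q⁻ x y u∈ | x∈p∩q⁻ x y v∈
  ... | yes u≡v | _           | _           = u≡v
  ... | no  u≢v | u∈x , u∈y | v∈x , v∈y =
    contradiction (clique u∈x v∈x u≢v) (indep u∈y v∈y)

CIS : (G : Graph) → Clique G → IndependentSet G → Fin 2
CIS G (x , [ clique ]) (y , [ indep ]) =
  fromℕ< {∣ x ∩ y ∣} (∣clique∩independent∣<2 G clique indep)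

module _ {X Y : Set} (F : X → Y → Fin 2) where

  F⁻¹[0] : Pred (X × Y) 0ℓ
  F⁻¹[0] (x , y) = F x y ≡ zero

  Coverable : ℕ → Set₁
  Coverable k = ∃ λ (A : Fin k → Pred X 0ℓ) → ∃ λ (B : Fin k → Pred Y 0ℓ) →
    ⋃ (Fin k) (λ i → A i ⟨×⟩ B i) ≐ F⁻¹[0]

  -- k is 2 to the power coNPᶜᶜ(F).
  IsCoverNumber : ℕ → Set₁
  IsCoverNumber k = Coverable k × (∀ {m} → Coverable m → k ≤ m)

-- The real inequality  c · (log₂ n)^(p/q) ≤ log₂ k  for n, k ≥ 1, c ≥ 0 and
-- p, q ≥ 1.  By continuity it holds iff  c^q · l^p ≤ u^q  for all nonnegative
-- rationals l = a/b ≤ log₂ n (that is, 2^a ≤ n^b) and u = d/e ≥ log₂ k (that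
-- is, k^e ≤ 2^d).
_·log₂_^[_/_]≤log₂_ : ℚ → ℕ → ℕ → ℕ → ℕ → Set
c ·log₂ n ^[ p / q ]≤log₂ k =
  ∀ a b d e .{{_ : NonZero b}} .{{_ : NonZero e}} →
  2 ^ a ≤ n ^ b → k ^ e ≤ 2 ^ d →
  (c ^ℚ q) ℚ.* ((+ a ℚ./ b) ^ℚ p) ℚ.≤ (+ d ℚ./ e) ^ℚ q

{-# OPTIONS --safe #-}

-- If the cells where a Boolean function takes the value 1 are partitioned by an
-- unambiguous DNF, then composing it with a two-party gadget and taking the rectangles
-- of the lifted terms as vertices gives a clique vs. independent set problem that
-- contains the composed function.  So it suffices to find an unambiguous DNF of width w
-- that is false at 0 but becomes consistent with any fewer than K revealed zeros, with
-- K much larger than w.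
--
-- Such a DNF with K about w^(4/3) comes from a tournament and a code.  Arrange the
-- variables in s blocks, each an L × s grid; a name p carries a word, that is, a point
-- in each of the L rows.  The term of p sees one block and requires zeros along the word
-- of p in all blocks.  Orient the pairs of names so that any h of them all beat a
-- common name, and let the pattern of the block hit the words of all names that do not
-- beat p: then any two terms conflict.  If the words agree pairwise in few places, then zeros
-- revealed in a block rule out its terms only if they nearly contain h + 1 words, hence
-- number about h L / 2, while the width is 2 L s with s of order h.
--
-- Lifting with inner products on O(log N) bits: a rectangle containing a 2^-K fraction of
-- the inputs with gadget output 0 is restricted on fewer than K coordinates so that both
-- sides become spread on the remaining ones.  Then the sum of u(x) v(y) ∏ (1 ± (-1)^⟨xᵢ,yᵢ⟩)
-- over the rectangle is positive, since Cauchy-Schwarz and orthogonality bound every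
-- nonconstant term of its expansion; so every output occurs on these coordinates.
module Submission where

-- The exponent 4/3 comes from the tournament. A name that can be arranged to lose to any h given
-- names carries about h log h bits, and the greedy code for all names keeps agreements below a D of
-- that order. Zeros in a block are charged to h + 1 words, whose mutual agreements waste up to h D
-- points of each, so L is taken of order h D, that is, h² log h. Words of length L over s letters
-- agree in L / s places on average, hence s of order L / D, that is, h; a larger s would raise
-- width and K by the same factor and lower the exponent. So the width is of order h³ log h and K of
-- order h⁴ log h.
--
-- The logarithm of the number of vertices is about the width times the gadget size, which is
-- logarithmic in the number of variables. Logarithms are not tracked: each is bounded by a small
-- power of h, which turns 4/3 into 16/13, still above 1.22.
--
-- The rectangles of a cover are arbitrary predicates, while the counting needs Boolean membership.
-- The goals derived from a cover are decidable, so they may be proved under a double negation,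
-- where finitely many instances of excluded middle are available.

-- Finite sums and products of integers.

module Sums where
  open import Data.Fin using (Fin; zero; suc)
  open import Data.Integer hiding (suc; pred)
  open import Data.Integer.Properties
  open import Data.Integer.Tactic.RingSolver using (solve-∀)
  open import Data.List using (List; []; _∷_; _++_; map; concatMap; length; allFin)
  open import Data.List.Membership.Propositional using (_∈_)
  open import Data.List.Membership.Propositional.Properties using (∈-map⁺; ∈-concat⁺′)
  open import Data.List.Properties using (length-tabulate)
  open import Data.List.Relation.Unary.Any using (here; there)
  open import Data.Nat as ℕ using (ℕ; zero; suc)
  open import Data.Product using (∃; _×_; _,_)
  open import Data.Vec using (Vec; []; _∷_; lookup)
  open import Relation.Binary.PropositionalEquality
  open import Relation.Nullary using (yes; no; contradiction)

  private variable
    A B C : Set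

  *-monoˡ : ∀ {c i j} → 0ℤ ≤ c → i ≤ j → c * i ≤ c * j
  *-monoˡ {c} 0≤c = *-monoˡ-≤-nonNeg c {{nonNegative 0≤c}}

  *-monoʳ : ∀ {c i j} → 0ℤ ≤ c → i ≤ j → i * c ≤ j * c
  *-monoʳ {c} 0≤c = *-monoʳ-≤-nonNeg c {{nonNegative 0≤c}}

  *-mono : ∀ {i j k l} → 0ℤ ≤ i → 0ℤ ≤ l → i ≤ j → k ≤ l → i * k ≤ j * l
  *-mono 0≤i 0≤l i≤j k≤l = ≤-trans (*-monoˡ 0≤i k≤l) (*-monoʳ 0≤l i≤j)

  *-cancelˡ : ∀ {c i j} → 0ℤ < c → c * i ≤ c * j → i ≤ j
  *-cancelˡ {c} {i} {j} 0<c = *-cancelˡ-≤-pos i j c {{positive 0<c}}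

  *-nonNeg : ∀ {i j} → 0ℤ ≤ i → 0ℤ ≤ j → 0ℤ ≤ i * j
  *-nonNeg {i} {j} 0≤i 0≤j = subst (_≤ i * j) (*-zeroʳ i) (*-monoˡ 0≤i 0≤j)

  *-pos : ∀ {i j} → 0ℤ < i → 0ℤ < j → 0ℤ < i * j
  *-pos {i} {j} 0<i 0<j =
    subst (_< i * j) (*-zeroʳ i) (*-monoˡ-<-pos i {{positive 0<i}} 0<j)

  square-nonNeg : ∀ i → 0ℤ ≤ i * i
  square-nonNeg (+ n) = *-nonNeg {+ n} {+ n} (+≤+ ℕ.z≤n) (+≤+ ℕ.z≤n)
  square-nonNeg -[1+ n ] = +≤+ ℕ.z≤n

  Σ : List A → (A → ℤ) → ℤ
  Σ []       f = 0ℤ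
  Σ (x ∷ xs) f = f x + Σ xs f

  infix 5 Σ
  syntax Σ xs (λ x → t) = Σ[ x ← xs ] t

  Σ-cong : ∀ (xs : List A) {f g} → (∀ x → f x ≡ g x) → Σ xs f ≡ Σ xs g
  Σ-cong []       eq = refl
  Σ-cong (x ∷ xs) eq = cong₂ _+_ (eq x) (Σ-cong xs eq)

  Σ-mono : ∀ (xs : List A) {f g} → (∀ x → f x ≤ g x) → Σ xs f ≤ Σ xs g
  Σ-mono []       le = ≤-refl
  Σ-mono (x ∷ xs) le = +-mono-≤ (le x) (Σ-mono xs le)

  Σ-zero : ∀ (xs : List A) → Σ[ x ← xs ] 0ℤ ≡ 0ℤ
  Σ-zero []       = refl
  Σ-zero (x ∷ xs) = trans (+-identityˡ _) (Σ-zero xs)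

  Σ-nonNeg : ∀ (xs : List A) {f} → (∀ x → 0ℤ ≤ f x) → 0ℤ ≤ Σ xs f
  Σ-nonNeg xs le = subst (_≤ Σ xs _) (Σ-zero xs) (Σ-mono xs le)

  Σ-const : ∀ (xs : List A) c → Σ[ x ← xs ] c ≡ + length xs * c
  Σ-const []       c = refl
  Σ-const (x ∷ xs) c = trans (cong (λ t → c + t) (Σ-const xs c)) (lem (+ length xs) c)
    where
    lem : ∀ n c → c + n * c ≡ (1ℤ + n) * c
    lem = solve-∀

  Σ-allFin-const : ∀ n c → Σ[ i ← allFin n ] c ≡ + n * c
  Σ-allFin-const n c =
    trans (Σ-const (allFin n) c) (cong (λ m → + m * c) (length-tabulate {n = n} (λ i → i)))

  Σ-+ : ∀ (xs : List A) f g → Σ[ x ← xs ] (f x + g x) ≡ Σ xs f + Σ xs g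
  Σ-+ []       f g = refl
  Σ-+ (x ∷ xs) f g rewrite Σ-+ xs f g = lem (f x) (g x) (Σ xs f) (Σ xs g)
    where
    lem : ∀ a b c d → a + b + (c + d) ≡ a + c + (b + d)
    lem = solve-∀

  Σ-*ˡ : ∀ (xs : List A) c f → Σ[ x ← xs ] (c * f x) ≡ c * Σ xs f
  Σ-*ˡ []       c f = sym (*-zeroʳ c)
  Σ-*ˡ (x ∷ xs) c f rewrite Σ-*ˡ xs c f = sym (*-distribˡ-+ c (f x) (Σ xs f))

  Σ-*ʳ : ∀ (xs : List A) c f → Σ[ x ← xs ] (f x * c) ≡ Σ xs f * c
  Σ-*ʳ xs c f =
    trans (Σ-cong xs λ x → *-comm (f x) c) (trans (Σ-*ˡ xs c f) (*-comm c _))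

  Σ-++ : ∀ (xs ys : List A) f → Σ (xs ++ ys) f ≡ Σ xs f + Σ ys f
  Σ-++ []       ys f = sym (+-identityˡ _)
  Σ-++ (x ∷ xs) ys f rewrite Σ-++ xs ys f = sym (+-assoc (f x) (Σ xs f) (Σ ys f))

  Σ-map : ∀ (g : A → B) (xs : List A) f → Σ (map g xs) f ≡ Σ[ x ← xs ] f (g x)
  Σ-map g []       f = refl
  Σ-map g (x ∷ xs) f = cong (λ s → f (g x) + s) (Σ-map g xs f)

  Σ-concatMap : ∀ (g : A → List B) (xs : List A) f →
                Σ (concatMap g xs) f ≡ Σ[ x ← xs ] Σ (g x) f
  Σ-concatMap g []       f = refl
  Σ-concatMap g (x ∷ xs) f =
    trans (Σ-++ (g x) _ f) (cong (λ s → Σ (g x) f + s) (Σ-concatMap g xs f))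

  Σ-swap : ∀ (xs : List A) (ys : List B) (f : A → B → ℤ) →
           Σ[ x ← xs ] Σ[ y ← ys ] f x y ≡ Σ[ y ← ys ] Σ[ x ← xs ] f x y
  Σ-swap []       ys f = sym (Σ-zero ys)
  Σ-swap (x ∷ xs) ys f rewrite Σ-swap xs ys f =
    sym (Σ-+ ys (f x) (λ y → Σ[ x ← xs ] f x y))

  Σ-*Σ : ∀ (xs : List A) (ys : List B) f g →
         Σ xs f * Σ ys g ≡ Σ[ x ← xs ] Σ[ y ← ys ] f x * g y
  Σ-*Σ xs ys f g = trans (sym (Σ-*ʳ xs (Σ ys g) f)) (Σ-cong xs λ x → sym (Σ-*ˡ ys (f x) g))

  ∈⇒≤Σ : ∀ {xs : List A} {f x} → (∀ x → 0ℤ ≤ f x) → x ∈ xs → f x ≤ Σ xs f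
  ∈⇒≤Σ {xs = _ ∷ xs} {f} {x} 0≤f (here refl) =
    subst (_≤ f x + Σ xs f) (+-identityʳ (f x)) (+-monoʳ-≤ (f x) (Σ-nonNeg xs 0≤f))
  ∈⇒≤Σ {xs = y ∷ xs} {f} {x} 0≤f (there x∈) =
    subst (_≤ f y + Σ xs f) (+-identityˡ (f x)) (+-mono-≤ (0≤f y) (∈⇒≤Σ 0≤f x∈))

  0<Σ⇒∃ : ∀ (xs : List A) {f} → 0ℤ < Σ xs f → ∃ λ x → 0ℤ < f x
  0<Σ⇒∃ []       0<Σ = contradiction refl (<⇒≢ 0<Σ)
  0<Σ⇒∃ (x ∷ xs) {f} 0<Σ with 0ℤ <? f x
  ... | yes 0<fx = x , 0<fx
  ... | no  0≮fx = 0<Σ⇒∃ xs (<-≤-trans 0<Σ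
    (subst (f x + Σ xs f ≤_) (+-identityˡ _) (+-monoˡ-≤ (Σ xs f) (≮⇒≥ 0≮fx))))

  ∃-max : ∀ (xs : List A) (f : A → ℤ) x₀ →
          ∃ λ m → f x₀ ≤ f m × (∀ {x} → x ∈ xs → f x ≤ f m)
  ∃-max []       f x₀ = x₀ , ≤-refl , λ ()
  ∃-max (x ∷ xs) f x₀ with ∃-max xs f x₀
  ... | m , x₀≤ , max with f x ≤? f m
  ... | yes x≤ = m , x₀≤ , λ { (here refl) → x≤ ; (there x∈) → max x∈ }
  ... | no  x≰ = x , ≤-trans x₀≤ m≤ ,
                 λ { (here refl) → ≤-refl ; (there x∈) → ≤-trans (max x∈) m≤ }
    where m≤ = <⇒≤ (≰⇒> x≰)

  ∃-≤average : ∀ (xs : List A) f c → Σ xs f ≤ Σ[ x ← xs ] c → ∀ {x₀} → x₀ ∈ xs →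
               ∃ λ x → f x ≤ c
  ∃-≤average (x ∷ xs) f c le _ with f x ≤? c
  ... | yes fx≤c = x , fx≤c
  ∃-≤average (x ∷ []) f c le _ | no fx≰c =
    contradiction (subst₂ _≤_ (+-identityʳ (f x)) (+-identityʳ c) le) fx≰c
  ∃-≤average (x ∷ xs@(_ ∷ _)) f c le _ | no fx≰c =
    ∃-≤average xs f c (≮⇒≥ λ c<f → <⇒≱ (+-mono-< (≰⇒> fx≰c) c<f) le) (here refl)

  -- Induction on the list: adding a point of value a needs only 2 a S₁ ≤ S₂ + a² S₀, which says
  -- that the sum of u (f - a)² is nonnegative.
  cauchy-schwarz : ∀ (xs : List A) (u f : A → ℤ) → (∀ x → 0ℤ ≤ u x) →
    (Σ[ x ← xs ] u x * f x) * (Σ[ x ← xs ] u x * f x) ≤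
    Σ xs u * (Σ[ x ← xs ] u x * (f x * f x))
  cauchy-schwarz []       u f 0≤u = ≤-refl
  cauchy-schwarz {A = A} (x ∷ xs) u f 0≤u = begin
    (w * a + S₁) * (w * a + S₁)                      ≡⟨ expand w a S₁ ⟩
    (w * (a * a) * w + S₁ * S₁) + w * (a * S₁ + a * S₁) ≤⟨ +-mono-≤ (+-monoʳ-≤ (w * (a * a) * w) (cauchy-schwarz xs u f 0≤u)) (*-monoˡ (0≤u x) cross) ⟩
    (w * (a * a) * w + S₀ * S₂) + w * (S₂ + a * a * S₀)  ≡⟨ collect w a S₀ S₂ ⟩
    (w + S₀) * (w * (a * a) + S₂) ∎
    where
    open ≤-Reasoning
    w = u x
    a = f x
    S₀ = Σ xs u
    S₁ = Σ[ x ← xs ] u x * f x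
    S₂ = Σ[ x ← xs ] u x * (f x * f x)
    expand : ∀ w a s → (w * a + s) * (w * a + s) ≡
             (w * (a * a) * w + s * s) + w * (a * s + a * s)
    expand = solve-∀
    collect : ∀ w a s t → (w * (a * a) * w + s * t) + w * (t + a * a * s) ≡
              (w + s) * (w * (a * a) + t)
    collect = solve-∀
    quad : ∀ ys → Σ[ y ← ys ] u y * ((f y - a) * (f y - a)) ≡
           (Σ[ y ← ys ] u y * (f y * f y)) + a * a * Σ ys u -
           (a * (Σ[ y ← ys ] u y * f y) + a * (Σ[ y ← ys ] u y * f y))
    quad []       = zeros a
      where
      zeros : ∀ a → 0ℤ ≡ 0ℤ + a * a * 0ℤ - (a * 0ℤ + a * 0ℤ)
      zeros = solve-∀
    quad (y ∷ ys) rewrite quad ys = step (u y) (f y) a (Σ[ y ← ys ] u y * (f y * f y)) (Σ ys u) _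
      where
      step : ∀ v b a p q r → v * ((b - a) * (b - a)) + (p + a * a * q - (a * r + a * r)) ≡
             v * (b * b) + p + a * a * (v + q) - (a * (v * b + r) + a * (v * b + r))
      step = solve-∀
    cross : a * S₁ + a * S₁ ≤ S₂ + a * a * S₀
    cross = 0≤i-j⇒j≤i (subst (0ℤ ≤_) (quad xs)
      (Σ-nonNeg xs λ y → *-nonNeg (0≤u y) (square-nonNeg (f y - a))))

  ∏ : ∀ {n} → (Fin n → ℤ) → ℤ
  ∏ {zero}  f = 1ℤ
  ∏ {suc n} f = f zero * ∏ (λ i → f (suc i))

  ∏-cong : ∀ {n} {f g : Fin n → ℤ} → (∀ i → f i ≡ g i) → ∏ f ≡ ∏ g
  ∏-cong {zero}  eq = refl
  ∏-cong {suc n} eq = cong₂ _*_ (eq zero) (∏-cong (λ i → eq (suc i)))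

  ∏-* : ∀ {n} (f g : Fin n → ℤ) → ∏ (λ i → f i * g i) ≡ ∏ f * ∏ g
  ∏-* {zero}  f g = refl
  ∏-* {suc n} f g rewrite ∏-* (λ i → f (suc i)) (λ i → g (suc i)) =
    lem (f zero) (g zero) _ _
    where
    lem : ∀ a b c d → a * b * (c * d) ≡ a * c * (b * d)
    lem = solve-∀

  ∏-nonNeg : ∀ {n} {f : Fin n → ℤ} → (∀ i → 0ℤ ≤ f i) → 0ℤ ≤ ∏ f
  ∏-nonNeg {zero}  0≤f = +≤+ ℕ.z≤n
  ∏-nonNeg {suc n} 0≤f = *-nonNeg (0≤f zero) (∏-nonNeg λ i → 0≤f (suc i))

  ∏-pos : ∀ {n} {f : Fin n → ℤ} → (∀ i → 0ℤ < f i) → 0ℤ < ∏ f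
  ∏-pos {zero}  0<f = +<+ (ℕ.s≤s ℕ.z≤n)
  ∏-pos {suc n} 0<f = *-pos (0<f zero) (∏-pos λ i → 0<f (suc i))

  ∏-mono : ∀ {n} {f g : Fin n → ℤ} → (∀ i → 0ℤ ≤ f i) → (∀ i → f i ≤ g i) → ∏ f ≤ ∏ g
  ∏-mono {zero}  0≤f f≤g = ≤-refl
  ∏-mono {suc n} 0≤f f≤g = *-mono (0≤f zero)
    (∏-nonNeg λ i → ≤-trans (0≤f (suc i)) (f≤g (suc i)))
    (f≤g zero) (∏-mono (λ i → 0≤f (suc i)) (λ i → f≤g (suc i)))

  ∏-zero : ∀ {n} {f : Fin n → ℤ} i → f i ≡ 0ℤ → ∏ f ≡ 0ℤ
  ∏-zero {f = f} zero    eq rewrite eq = refl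
  ∏-zero {f = f} (suc i) eq =
    trans (cong (f zero *_) (∏-zero i eq)) (*-zeroʳ (f zero))

  ∏-const : ∀ {n} c → ∏ {n} (λ _ → c) ≡ c ^ n
  ∏-const {zero}  c = refl
  ∏-const {suc n} c = cong (c *_) (∏-const {n} c)

  vecs : List A → ∀ n → List (Vec A n)
  vecs as zero    = [] ∷ []
  vecs as (suc n) = concatMap (λ a → map (a ∷_) (vecs as n)) as

  ∈-vecs : ∀ {as : List A} → (∀ a → a ∈ as) → ∀ {n} (x : Vec A n) → x ∈ vecs as n
  ∈-vecs all []      = here refl
  ∈-vecs {as = as} all {suc n} (a ∷ x) =
    ∈-concat⁺′ (∈-map⁺ (a ∷_) (∈-vecs all x)) (∈-map⁺ (λ a → map (a ∷_) (vecs as n)) (all a))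

  Σ-vecs : ∀ (as : List A) n f →
           Σ (vecs as (suc n)) f ≡ Σ[ a ← as ] Σ[ x ← vecs as n ] f (a ∷ x)
  Σ-vecs as n f = trans (Σ-concatMap _ as f) (Σ-cong as λ a → Σ-map (a ∷_) (vecs as n) f)

  -- Distributivity over all coordinates at once. It expresses independence of coordinates, and over
  -- the alphabet `bools` it expands a product of binomials into a sum over masks.
  Σ-∏ : ∀ (as : List A) {n} (k : Fin n → A → ℤ) →
        Σ[ x ← vecs as n ] ∏ (λ i → k i (lookup x i)) ≡ ∏ (λ i → Σ as (k i))
  Σ-∏ as {zero}  k = refl
  Σ-∏ as {suc n} k = begin
    Σ (vecs as (suc n)) _
      ≡⟨ Σ-vecs as n _ ⟩
    Σ[ a ← as ] Σ[ x ← vecs as n ] k zero a * ∏ (λ i → k (suc i) (lookup x i))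
      ≡⟨ Σ-cong as (λ a → Σ-*ˡ (vecs as n) (k zero a) _) ⟩
    Σ[ a ← as ] k zero a * (Σ[ x ← vecs as n ] ∏ (λ i → k (suc i) (lookup x i)))
      ≡⟨ Σ-*ʳ as _ (k zero) ⟩
    Σ as (k zero) * (Σ[ x ← vecs as n ] ∏ (λ i → k (suc i) (lookup x i)))
      ≡⟨ cong (Σ as (k zero) *_) (Σ-∏ as (λ i → k (suc i))) ⟩
    Σ as (k zero) * ∏ (λ i → Σ as (k (suc i))) ∎
    where open ≡-Reasoning

-- Masks of coordinates and indicators of agreement on a mask.

module Weights where
  open import Data.Bool using (Bool; true; false; if_then_else_)
  open import Data.Integer hiding (suc; pred)
  open import Data.Integer.Properties
  open import Data.Integer.Tactic.RingSolver using (solve-∀)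
  open import Data.List using (List; []; _∷_)
  open import Data.List.Membership.Propositional using (_∈_)
  open import Data.List.Relation.Unary.Any using (here; there)
  open import Data.Nat as ℕ using (ℕ)
  open import Data.Vec using (Vec; lookup)
  open import Relation.Binary using (DecidableEquality)
  open import Relation.Binary.PropositionalEquality
  open import Relation.Nullary using (yes; no; does; contradiction)
  open Sums

  bools : List Bool
  bools = true ∷ false ∷ []

  ∈-bools : ∀ b → b ∈ bools
  ∈-bools true  = here refl
  ∈-bools false = there (here refl)

  0≤1 : 0ℤ ≤ 1ℤ
  0≤1 = +≤+ ℕ.z≤n

  0<1 : 0ℤ < 1ℤ
  0<1 = +<+ (ℕ.s≤s ℕ.z≤n)

  0<2 : 0ℤ < + 2
  0<2 = +<+ (ℕ.s≤s ℕ.z≤n)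

  ⟦_⟧ : Bool → ℤ
  ⟦ b ⟧ = if b then 1ℤ else 0ℤ

  ⟦⟧-nonNeg : ∀ b → 0ℤ ≤ ⟦ b ⟧
  ⟦⟧-nonNeg true  = 0≤1
  ⟦⟧-nonNeg false = ≤-refl

  ⟦⟧≤1 : ∀ b → ⟦ b ⟧ ≤ 1ℤ
  ⟦⟧≤1 true  = ≤-refl
  ⟦⟧≤1 false = 0≤1

  -- Powers of `c` with the size of the mask and of its complement as exponents, kept as products
  -- over coordinates so that they combine factor by factor with other such products.
  pow copow : ∀ {n} → Vec Bool n → ℤ → ℤ
  pow   m c = ∏ λ i → if lookup m i then c else 1ℤ
  copow m c = ∏ λ i → if lookup m i then 1ℤ else c

  pow*copow : ∀ {n} (m : Vec Bool n) c → pow m c * copow m c ≡ ∏ {n} (λ _ → c)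
  pow*copow {n} m c = trans
    (sym (∏-* {n} (λ i → if lookup m i then c else 1ℤ) (λ i → if lookup m i then 1ℤ else c)))
    (∏-cong λ i → lem (lookup m i))
    where
    lem : ∀ b → (if b then c else 1ℤ) * (if b then 1ℤ else c) ≡ c
    lem true  = *-identityʳ c
    lem false = *-identityˡ c

  if-pos : ∀ b {c d} → 0ℤ < c → 0ℤ < d → 0ℤ < (if b then c else d)
  if-pos true  p q = p
  if-pos false p q = q

  pow-pos : ∀ {n} (m : Vec Bool n) {c} → 0ℤ < c → 0ℤ < pow m c
  pow-pos m 0<c = ∏-pos λ i → if-pos (lookup m i) 0<c 0<1

  copow-pos : ∀ {n} (m : Vec Bool n) {c} → 0ℤ < c → 0ℤ < copow m c
  copow-pos m 0<c = ∏-pos λ i → if-pos (lookup m i) 0<1 0<c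

  square-≤⇒-≤ : ∀ {i j} → 0ℤ ≤ j → i * i ≤ j * j → - j ≤ i
  square-≤⇒-≤ {i} {j} 0≤j i²≤j² with - j ≤? i
  ... | yes p = p
  ... | no ¬p = contradiction i²≤j² (<⇒≱ (begin-strict
    j * j     ≤⟨ *-monoˡ 0≤j (<⇒≤ j<-i) ⟩
    j * - i   <⟨ *-monoʳ-<-pos (- i) {{positive (≤-<-trans 0≤j j<-i)}} j<-i ⟩
    - i * - i ≡⟨ lem i ⟩
    i * i     ∎))
    where
    open ≤-Reasoning
    lem : ∀ i → - i * - i ≡ i * i
    lem = solve-∀
    j<-i : j < - i
    j<-i = subst (_< - i) (neg-involutive j) (neg-mono-< (≰⇒> ¬p))

  module Kronecker {A : Set} (_≟_ : DecidableEquality A) where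

    δ : A → A → ℤ
    δ a b = ⟦ does (a ≟ b) ⟧

    δ-sym : ∀ a b → δ a b ≡ δ b a
    δ-sym a b with a ≟ b | b ≟ a
    ... | yes _ | yes _ = refl
    ... | no  _ | no  _ = refl
    ... | yes p | no ¬q = contradiction (sym p) ¬q
    ... | no ¬p | yes q = contradiction (sym q) ¬p

    δ-subst : ∀ a b (f : A → ℤ) → δ a b * f a ≡ δ a b * f b
    δ-subst a b f with a ≟ b
    ... | yes refl = refl
    ... | no  _    = refl

    δ⇒≡ : ∀ {a b} → δ a b ≢ 0ℤ → a ≡ b
    δ⇒≡ {a} {b} δ≢0 with a ≟ b
    ... | yes a≡b = a≡b
    ... | no  _   = contradiction refl δ≢0

    δᵐ : ∀ {n} → Vec Bool n → Vec A n → Vec A n → ℤ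
    δᵐ m x y = ∏ λ i → if lookup m i then δ (lookup x i) (lookup y i) else 1ℤ

    δᵐ-nonNeg : ∀ {n} (m : Vec Bool n) x y → 0ℤ ≤ δᵐ m x y
    δᵐ-nonNeg m x y = ∏-nonNeg λ i → lem (lookup m i) i
      where
      lem : ∀ b i → 0ℤ ≤ (if b then δ (lookup x i) (lookup y i) else 1ℤ)
      lem true  i = ⟦⟧-nonNeg _
      lem false i = 0≤1

    δᵐ-sym : ∀ {n} (m : Vec Bool n) x y → δᵐ m x y ≡ δᵐ m y x
    δᵐ-sym m x y = ∏-cong λ i → cong (if lookup m i then_else 1ℤ) (δ-sym (lookup x i) (lookup y i))

    δᵐ⇒≡ : ∀ {n} (m : Vec Bool n) x y → δᵐ m x y ≢ 0ℤ →
           ∀ i → lookup m i ≡ true → lookup x i ≡ lookup y i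
    δᵐ⇒≡ m x y δ≢0 i mᵢ = δ⇒≡ λ δ≡0 → δ≢0 (∏-zero i (lem (lookup m i) mᵢ δ≡0))
      where
      lem : ∀ b {c} → b ≡ true → c ≡ 0ℤ → (if b then c else 1ℤ) ≡ 0ℤ
      lem true refl refl = refl

    module _ (as : List A) (Σδ : ∀ b → Σ[ a ← as ] δ a b ≡ 1ℤ) where

      Σδʳ : ∀ a → Σ[ b ← as ] δ a b ≡ 1ℤ
      Σδʳ a = trans (Σ-cong as λ b → δ-sym a b) (Σδ a)

      μ : ℤ
      μ = Σ[ a ← as ] 1ℤ

      Σδᵐ : ∀ {n} (m : Vec Bool n) x → Σ[ y ← vecs as n ] δᵐ m x y ≡ copow m μ
      Σδᵐ m x = trans (Σ-∏ as λ i b → if lookup m i then δ (lookup x i) b else 1ℤ)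
                      (∏-cong λ i → lem (lookup m i) (lookup x i))
        where
        lem : ∀ c a → (Σ[ b ← as ] (if c then δ a b else 1ℤ)) ≡ (if c then 1ℤ else μ)
        lem true  a = Σδʳ a
        lem false a = refl

      Σvecs : ∀ n → Σ[ x ← vecs as n ] 1ℤ ≡ ∏ {n} (λ _ → μ)
      Σvecs n = trans (Σ-cong (vecs as n) (λ x → sym (trans (∏-const {n} 1ℤ) (^-zeroˡ n))))
                      (Σ-∏ as {n} (λ _ _ → 1ℤ))

      -- Summing the hypothesis over all η costs the number μ^|m| of values on m.
      marginal : ∀ {n} (m : Vec Bool n) (F : Vec A n → Vec A n → ℤ) Z c → 0ℤ < μ →
        (∀ ξ η → (Σ[ x ← vecs as n ] Σ[ y ← vecs as n ] F x y * (δᵐ m x ξ * δᵐ m y η)) * Z ≤ c) →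
        ∀ ξ → (Σ[ x ← vecs as n ] (Σ[ y ← vecs as n ] F x y) * δᵐ m x ξ) * Z ≤ pow m μ * c
      marginal {n} m F Z c 0<μ le ξ = *-cancelˡ (copow-pos m 0<μ) (begin
        copow m μ * ((Σ[ x ← V ] (Σ[ y ← V ] F x y) * δᵐ m x ξ) * Z)
          ≡⟨ sym (*-assoc (copow m μ) _ Z) ⟩
        copow m μ * (Σ[ x ← V ] (Σ[ y ← V ] F x y) * δᵐ m x ξ) * Z
          ≡⟨ cong (_* Z) split ⟩
        (Σ[ η ← V ] Σ[ x ← V ] Σ[ y ← V ] F x y * (δᵐ m x ξ * δᵐ m y η)) * Z
          ≡⟨ sym (Σ-*ʳ V Z _) ⟩
        Σ[ η ← V ] (Σ[ x ← V ] Σ[ y ← V ] F x y * (δᵐ m x ξ * δᵐ m y η)) * Z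
          ≤⟨ Σ-mono V (le ξ) ⟩
        Σ[ η ← V ] c
          ≡⟨ Σ-cong V (λ _ → sym (*-identityʳ c)) ⟩
        Σ[ η ← V ] c * 1ℤ
          ≡⟨ Σ-*ˡ V c (λ _ → 1ℤ) ⟩
        c * (Σ[ η ← V ] 1ℤ)
          ≡⟨ cong (c *_) (trans (Σvecs n) (sym (pow*copow m μ))) ⟩
        c * (pow m μ * copow m μ)
          ≡⟨ rearrange c (pow m μ) (copow m μ) ⟩
        copow m μ * (pow m μ * c) ∎)
        where
        open ≤-Reasoning
        V = vecs as n
        rearrange : ∀ a b c → a * (b * c) ≡ c * (b * a)
        rearrange = solve-∀
        split : copow m μ * (Σ[ x ← V ] (Σ[ y ← V ] F x y) * δᵐ m x ξ) ≡
                Σ[ η ← V ] Σ[ x ← V ] Σ[ y ← V ] F x y * (δᵐ m x ξ * δᵐ m y η)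
        split = sym (trans (Σ-swap V V _) (trans (Σ-cong V λ x →
          trans (Σ-swap V V _) (trans (Σ-cong V λ y → begin-equality
            Σ[ η ← V ] F x y * (δᵐ m x ξ * δᵐ m y η)
              ≡⟨ Σ-cong V (λ η → sym (*-assoc (F x y) _ _)) ⟩
            Σ[ η ← V ] F x y * δᵐ m x ξ * δᵐ m y η
              ≡⟨ Σ-*ˡ V (F x y * δᵐ m x ξ) _ ⟩
            F x y * δᵐ m x ξ * (Σ[ η ← V ] δᵐ m y η)
              ≡⟨ cong (F x y * δᵐ m x ξ *_) (Σδᵐ m y) ⟩
            F x y * δᵐ m x ξ * copow m μ
              ≡⟨ *-comm (F x y * δᵐ m x ξ) (copow m μ) ⟩
            copow m μ * (F x y * δᵐ m x ξ) ∎)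
          (trans (Σ-*ˡ V (copow m μ) _)
                 (cong (copow m μ *_) (Σ-*ʳ V (δᵐ m x ξ) (F x))))))
          (Σ-*ˡ V (copow m μ) _)))

-- Bilinear forms with orthogonal kernels on spread weights.

module Bilinear where
  open import Data.Bool using (Bool; true; false; if_then_else_)
  open import Data.Fin using (Fin)
  open import Data.Integer hiding (suc; pred)
  open import Data.Integer.Properties
  open import Data.Integer.Tactic.RingSolver using (solve-∀)
  open import Data.List using (List)
  open import Data.Vec using (Vec; lookup)
  open import Relation.Binary using (DecidableEquality)
  open import Relation.Binary.PropositionalEquality
  open Sums
  open Weights

  module _ {A : Set} (_≟_ : DecidableEquality A) (as : List A)
           (Σδ : ∀ b → Σ[ a ← as ] Kronecker.δ _≟_ a b ≡ 1ℤ) where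
    open Kronecker _≟_

    private
      μ₀ : ℤ
      μ₀ = μ as Σδ

    module _ {n} (m : Vec Bool n) (k : Fin n → A → A → ℤ) (0<μ : 0ℤ < μ₀)
      (k-orth : ∀ i b b′ → Σ[ a ← as ] k i a b * k i a b′ ≡
                           μ₀ * (if lookup m i then δ b b′ else 1ℤ))
      (k-const : ∀ i a a′ b → lookup m i ≡ false → k i a b ≡ k i a′ b)
      (u v : Vec A n → ℤ) (0≤u : ∀ x → 0ℤ ≤ u x) (0≤v : ∀ y → 0ℤ ≤ v y)
      (e : ℤ) (Σu : Σ (vecs as n) u ≡ e) (Σv : Σ (vecs as n) v ≡ e)
      (Z c : ℤ) (0≤Z : 0ℤ ≤ Z) (0≤c : 0ℤ ≤ c)
      (u-spread : ∀ ξ → (Σ[ x ← vecs as n ] u x * δᵐ m x ξ) * Z ≤ c)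
      (v-spread : ∀ η → (Σ[ y ← vecs as n ] v y * δᵐ m y η) * Z ≤ c) where

      private
        V : List (Vec A n)
        V = vecs as n

        0≤e : 0ℤ ≤ e
        0≤e = subst (0ℤ ≤_) Σu (Σ-nonNeg V 0≤u)

        κ : Vec A n → Vec A n → ℤ
        κ x y = ∏ λ i → k i (lookup x i) (lookup y i)

        f : Vec A n → ℤ
        f x = Σ[ y ← V ] v y * κ x y

        κ-orth : ∀ y y′ → Σ[ x ← V ] κ x y * κ x y′ ≡ ∏ {n} (λ _ → μ₀) * δᵐ m y y′
        κ-orth y y′ = trans
          (Σ-cong V λ x → sym (∏-* (λ i → k i (lookup x i) (lookup y i))
                                   (λ i → k i (lookup x i) (lookup y′ i))))
          (trans (Σ-∏ as λ i a → k i a (lookup y i) * k i a (lookup y′ i))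
          (trans (∏-cong λ i → k-orth i (lookup y i) (lookup y′ i))
                 (∏-* (λ _ → μ₀) λ i → if lookup m i then δ (lookup y i) (lookup y′ i) else 1ℤ)))

        κ-local : ∀ x ξ y → δᵐ m x ξ * κ x y ≡ δᵐ m x ξ * κ ξ y
        κ-local x ξ y = trans (sym (∏-* D (K x))) (trans
          (∏-cong λ i → lem i (lookup m i) refl (lookup x i) (lookup ξ i) (lookup y i)) (∏-* D (K ξ)))
          where
          D : Fin n → ℤ
          D i = if lookup m i then δ (lookup x i) (lookup ξ i) else 1ℤ
          K : Vec A n → Fin n → ℤ
          K x i = k i (lookup x i) (lookup y i)
          lem : ∀ i b → lookup m i ≡ b → ∀ a a′ b′ →
                (if b then δ a a′ else 1ℤ) * k i a b′ ≡ (if b then δ a a′ else 1ℤ) * k i a′ b′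
          lem i true  eq a a′ b′ = δ-subst a a′ (λ a → k i a b′)
          lem i false eq a a′ b′ = cong (1ℤ *_) (k-const i a a′ b′ eq)

        -- Off the mask the kernel does not see the row, so `f` is a function of the coordinates in
        -- `m` alone.
        f-local : ∀ x ξ → δᵐ m x ξ * f x ≡ δᵐ m x ξ * f ξ
        f-local x ξ = trans (sym (Σ-*ˡ V (δᵐ m x ξ) (λ y → v y * κ x y))) (trans (Σ-cong V λ y →
          trans (swap (δᵐ m x ξ) (v y) (κ x y)) (trans (cong (v y *_) (κ-local x ξ y))
                (sym (swap (δᵐ m x ξ) (v y) (κ ξ y)))))
          (Σ-*ˡ V (δᵐ m x ξ) (λ y → v y * κ ξ y)))
          where
          swap : ∀ a b c → a * (b * c) ≡ b * (a * c)
          swap = solve-∀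

        f²-local : ∀ x ξ → δᵐ m x ξ * (f x * f x) ≡ δᵐ m x ξ * (f ξ * f ξ)
        f²-local x ξ = begin
          D * (f x * f x) ≡⟨ sym (*-assoc D (f x) (f x)) ⟩
          D * f x * f x   ≡⟨ cong (_* f x) (f-local x ξ) ⟩
          D * f ξ * f x   ≡⟨ swap D (f ξ) (f x) ⟩
          D * f x * f ξ   ≡⟨ cong (_* f ξ) (f-local x ξ) ⟩
          D * f ξ * f ξ   ≡⟨ *-assoc D (f ξ) (f ξ) ⟩
          D * (f ξ * f ξ) ∎
          where
          open ≡-Reasoning
          D = δᵐ m x ξ
          swap : ∀ a b c → a * b * c ≡ a * c * b
          swap = solve-∀

        M F X : ℤ
        M = ∏ {n} (λ _ → μ₀)
        F = Σ[ ξ ← V ] f ξ * f ξ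
        X = Σ[ x ← V ] u x * (f x * f x)

        -- Parseval: once the square is expanded, orthogonality leaves only the pairs of columns
        -- that agree on `m`.
        F≡ : F ≡ M * (Σ[ y ← V ] v y * (Σ[ y′ ← V ] v y′ * δᵐ m y′ y))
        F≡ = begin
          Σ[ ξ ← V ] f ξ * f ξ
            ≡⟨ Σ-cong V (λ ξ → Σ-*Σ V V _ _) ⟩
          Σ[ ξ ← V ] Σ[ y ← V ] Σ[ y′ ← V ] v y * κ ξ y * (v y′ * κ ξ y′)
            ≡⟨ Σ-swap V V _ ⟩
          Σ[ y ← V ] Σ[ ξ ← V ] Σ[ y′ ← V ] v y * κ ξ y * (v y′ * κ ξ y′)
            ≡⟨ Σ-cong V (λ y → Σ-swap V V _) ⟩
          Σ[ y ← V ] Σ[ y′ ← V ] Σ[ ξ ← V ] v y * κ ξ y * (v y′ * κ ξ y′)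
            ≡⟨ Σ-cong V (λ y → Σ-cong V λ y′ → trans
                 (Σ-cong V λ ξ → inner (v y) (v y′) (κ ξ y) (κ ξ y′))
                 (trans (Σ-*ˡ V (v y * v y′) (λ ξ → κ ξ y * κ ξ y′))
                 (trans (cong (v y * v y′ *_) (κ-orth y y′))
                 (trans (outer (v y) (v y′) M (δᵐ m y y′))
                        (cong (λ d → M * (v y * (v y′ * d))) (δᵐ-sym m y y′)))))) ⟩
          Σ[ y ← V ] Σ[ y′ ← V ] M * (v y * (v y′ * δᵐ m y′ y))
            ≡⟨ Σ-cong V (λ y → trans (Σ-*ˡ V M _) (cong (M *_) (Σ-*ˡ V (v y) _))) ⟩
          Σ[ y ← V ] M * (v y * (Σ[ y′ ← V ] v y′ * δᵐ m y′ y))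
            ≡⟨ Σ-*ˡ V M _ ⟩
          M * (Σ[ y ← V ] v y * (Σ[ y′ ← V ] v y′ * δᵐ m y′ y)) ∎
          where
          open ≡-Reasoning
          inner : ∀ a b c d → a * c * (b * d) ≡ a * b * (c * d)
          inner = solve-∀
          outer : ∀ a b c d → a * b * (c * d) ≡ c * (a * (b * d))
          outer = solve-∀

        -- The columns that agree with a given y on `m` have weight at most c / Z.
        F-bound : F * Z ≤ M * (e * c)
        F-bound = begin
          F * Z
            ≡⟨ cong (_* Z) F≡ ⟩
          M * (Σ[ y ← V ] v y * (Σ[ y′ ← V ] v y′ * δᵐ m y′ y)) * Z
            ≡⟨ *-assoc M _ Z ⟩
          M * ((Σ[ y ← V ] v y * (Σ[ y′ ← V ] v y′ * δᵐ m y′ y)) * Z)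
            ≡⟨ cong (M *_) (sym (Σ-*ʳ V Z _)) ⟩
          M * (Σ[ y ← V ] v y * (Σ[ y′ ← V ] v y′ * δᵐ m y′ y) * Z)
            ≤⟨ *-monoˡ (∏-nonNeg {n} λ _ → <⇒≤ 0<μ) (Σ-mono V λ y → subst (_≤ v y * c)
                 (sym (*-assoc (v y) (Σ[ y′ ← V ] v y′ * δᵐ m y′ y) Z)) (*-monoˡ (0≤v y) (v-spread y))) ⟩
          M * (Σ[ y ← V ] v y * c)
            ≡⟨ cong (M *_) (trans (Σ-*ʳ V c v) (cong (_* c) Σv)) ⟩
          M * (e * c) ∎
          where open ≤-Reasoning

        -- The value f² is constant on each class of rows that agree on `m`. Every class has weight
        -- at most c / Z under `u` and contains `copow m μ₀` rows, so the weighted sum of f² is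
        -- controlled by the uniform one.
        X-bound : copow m μ₀ * X * Z ≤ c * F
        X-bound = begin
          copow m μ₀ * X * Z
            ≡⟨ cong (_* Z) (sym (Σ-*ˡ V (copow m μ₀) _)) ⟩
          (Σ[ x ← V ] copow m μ₀ * (u x * (f x * f x))) * Z
            ≡⟨ cong (_* Z) (Σ-cong V λ x → trans (cong (_* (u x * (f x * f x))) (sym (Σδᵐ as Σδ m x)))
                 (trans (sym (Σ-*ʳ V _ _)) (Σ-cong V λ ξ → move x ξ))) ⟩
          (Σ[ x ← V ] Σ[ ξ ← V ] f ξ * f ξ * (u x * δᵐ m x ξ)) * Z
            ≡⟨ cong (_* Z) (Σ-swap V V _) ⟩
          (Σ[ ξ ← V ] Σ[ x ← V ] f ξ * f ξ * (u x * δᵐ m x ξ)) * Z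
            ≡⟨ cong (_* Z) (Σ-cong V λ ξ → Σ-*ˡ V (f ξ * f ξ) _) ⟩
          (Σ[ ξ ← V ] f ξ * f ξ * (Σ[ x ← V ] u x * δᵐ m x ξ)) * Z
            ≡⟨ sym (Σ-*ʳ V Z _) ⟩
          Σ[ ξ ← V ] f ξ * f ξ * (Σ[ x ← V ] u x * δᵐ m x ξ) * Z
            ≤⟨ Σ-mono V (λ ξ → subst (_≤ f ξ * f ξ * c) (sym (*-assoc (f ξ * f ξ) _ Z))
                 (*-monoˡ (square-nonNeg (f ξ)) (u-spread ξ))) ⟩
          Σ[ ξ ← V ] f ξ * f ξ * c
            ≡⟨ Σ-*ʳ V c _ ⟩
          F * c
            ≡⟨ *-comm F c ⟩
          c * F ∎
          where
          open ≤-Reasoning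
          swap : ∀ a b c → a * (b * c) ≡ b * (a * c)
          swap = solve-∀
          swap′ : ∀ a b c → b * (a * c) ≡ c * (b * a)
          swap′ = solve-∀
          move : ∀ x ξ → δᵐ m x ξ * (u x * (f x * f x)) ≡ f ξ * f ξ * (u x * δᵐ m x ξ)
          move x ξ = trans (swap (δᵐ m x ξ) (u x) _)
            (trans (cong (u x *_) (f²-local x ξ)) (swap′ (δᵐ m x ξ) (u x) _))

      -- Cauchy-Schwarz in x gives t² ≤ e X. Replacing `u` by the uniform weight costs a factor c /
      -- Z, and orthogonality in y then contributes e and another c / Z. Of the M = μ^n from
      -- orthogonality, division by the class size `copow m μ₀` leaves `pow m μ₀`.
      spread⇒small : let t = Σ[ x ← vecs as n ] u x * (Σ[ y ← vecs as n ] v y *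
                               ∏ λ i → k i (lookup x i) (lookup y i)) in
                     t * t * (Z * Z) ≤ pow m μ₀ * (e * c * (e * c))
      spread⇒small = *-cancelˡ (copow-pos m 0<μ) (begin
        copow m μ₀ * (t * t * (Z * Z))
          ≤⟨ *-monoˡ (<⇒≤ (copow-pos m 0<μ)) (*-monoʳ (*-nonNeg 0≤Z 0≤Z) (cauchy-schwarz V u f 0≤u)) ⟩
        copow m μ₀ * (Σ V u * X * (Z * Z))
          ≡⟨ cong (λ s → copow m μ₀ * (s * X * (Z * Z))) Σu ⟩
        copow m μ₀ * (e * X * (Z * Z))
          ≡⟨ lem₁ (copow m μ₀) e X Z ⟩
        e * Z * (copow m μ₀ * X * Z)
          ≤⟨ *-monoˡ (*-nonNeg 0≤e 0≤Z) X-bound ⟩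
        e * Z * (c * F)
          ≡⟨ lem₂ e Z c F ⟩
        e * c * (F * Z)
          ≤⟨ *-monoˡ (*-nonNeg 0≤e 0≤c) F-bound ⟩
        e * c * (M * (e * c))
          ≡⟨ cong (λ M → e * c * (M * (e * c))) (sym (pow*copow m μ₀)) ⟩
        e * c * (pow m μ₀ * copow m μ₀ * (e * c))
          ≡⟨ lem₃ (e * c) (pow m μ₀) (copow m μ₀) ⟩
        copow m μ₀ * (pow m μ₀ * (e * c * (e * c))) ∎)
        where
        open ≤-Reasoning
        t = Σ[ x ← V ] u x * f x
        lem₁ : ∀ a b c d → a * (b * c * (d * d)) ≡ b * d * (a * c * d)
        lem₁ = solve-∀
        lem₂ : ∀ a b c d → a * b * (c * d) ≡ a * c * (d * b)
        lem₂ = solve-∀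
        lem₃ : ∀ a b c → a * (b * c * a) ≡ c * (b * (a * a))
        lem₃ = solve-∀

-- Rectangles that avoid a hard function contain few inputs with all gadget outputs false.

module Lifting where
  open import Data.Bool using (Bool; true; false; if_then_else_; _∨_; _∧_)
  import Data.Bool.Properties as Bool
  open import Data.Empty using (⊥)
  open import Data.Fin using (Fin)
  open import Data.Fin.Properties using (any?)
  open import Data.Integer hiding (suc; pred)
  open import Data.Integer.Properties
  open import Data.Integer.Tactic.RingSolver using (solve-∀)
  open import Data.List using (List; cartesianProduct)
  open import Data.List.Membership.Propositional using (_∈_)
  open import Data.List.Membership.Propositional.Properties using (∈-cartesianProduct⁺)
  open import Data.Product using (∃; _×_; _,_; proj₁; proj₂)
  open import Data.Vec using (Vec; lookup; zipWith; tabulate; replicate)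
  open import Data.Vec.Properties using (lookup-zipWith; lookup∘tabulate; lookup-replicate; tabulate∘lookup; tabulate-cong)
  open import Relation.Binary using (DecidableEquality)
  open import Relation.Binary.PropositionalEquality
  open import Relation.Nullary using (¬_; yes; no; contradiction)
  open Sums
  open Weights
  open Bilinear

  sgn unset : Bool → ℤ
  sgn   b = if b then -1ℤ else 1ℤ
  unset b = if b then 0ℤ else 1ℤ

  unset-nonNeg : ∀ b → 0ℤ ≤ unset b
  unset-nonNeg true  = ≤-refl
  unset-nonNeg false = 0≤1

  unset⇒false : ∀ b → unset b ≢ 0ℤ → b ≡ false
  unset⇒false true  h = contradiction refl h
  unset⇒false false h = refl

  sgn-agree : ∀ z b → 1ℤ + sgn z * sgn b ≢ 0ℤ → b ≡ z
  sgn-agree true  true  _ = refl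
  sgn-agree false false _ = refl
  sgn-agree true  false h = contradiction refl h
  sgn-agree false true  h = contradiction refl h

  sgn² : ∀ z → sgn z * sgn z ≡ 1ℤ
  sgn² true  = refl
  sgn² false = refl

  0<⇒≢ : ∀ {i} → 0ℤ < i → i ≢ 0ℤ
  0<⇒≢ 0<i refl = <-irrefl refl 0<i

  *-≢0ˡ : ∀ i j → i * j ≢ 0ℤ → i ≢ 0ℤ
  *-≢0ˡ i j ij≢0 refl = ij≢0 refl

  *-≢0ʳ : ∀ i j → i * j ≢ 0ℤ → j ≢ 0ℤ
  *-≢0ʳ i j ij≢0 refl = ij≢0 (*-zeroʳ i)

  vec-ext : ∀ {A : Set} {n} {x y : Vec A n} → (∀ i → lookup x i ≡ lookup y i) → x ≡ y
  vec-ext {x = x} {y} eq =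
    trans (sym (tabulate∘lookup x)) (trans (tabulate-cong eq) (tabulate∘lookup y))

  module _ {A : Set} (_≟_ : DecidableEquality A) (as : List A) (∈as : ∀ a → a ∈ as) (a₀ : A)
    (Σδ : ∀ b → Σ[ a ← as ] Kronecker.δ _≟_ a b ≡ 1ℤ) (g : A → A → Bool)
    (orthogonal : ∀ b b′ → Σ[ a ← as ] sgn (g a b) * sgn (g a b′) ≡
                           Kronecker.μ _≟_ as Σδ * Kronecker.δ _≟_ b b′) where
    open Kronecker _≟_

    private
      μ₀ : ℤ
      μ₀ = Kronecker.μ _≟_ as Σδ

    ζ : ℤ
    ζ = Σ[ a ← as ] Σ[ b ← as ] unset (g a b)

    avoid : ∀ {n} → Vec A n → Vec A n → ℤ
    avoid x y = ∏ λ i → unset (g (lookup x i) (lookup y i))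

    -- Rectangles are measured only by the inputs on which every gadget outputs `false`: for a
    -- function that is false at 0, a cover of the zeros has to contain all of these.
    mass : ∀ {n} → (Vec A n → Bool) → (Vec A n → Bool) → ℤ
    mass {n} P Q = Σ[ x ← vecs as n ] Σ[ y ← vecs as n ] ⟦ P x ⟧ * ⟦ Q y ⟧ * avoid x y

    avoid-nonNeg : ∀ {n} (x y : Vec A n) → 0ℤ ≤ avoid x y
    avoid-nonNeg x y = ∏-nonNeg λ i → unset-nonNeg (g (lookup x i) (lookup y i))

    Σavoid : ∀ n → Σ[ x ← vecs as n ] Σ[ y ← vecs as n ] avoid x y ≡ ∏ {n} (λ _ → ζ)
    Σavoid n = trans (Σ-cong (vecs as n) λ x → Σ-∏ as λ i b → unset (g (lookup x i) b))
                     (Σ-∏ as {n} λ _ a → Σ[ b ← as ] unset (g a b))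

    module _ {n} (r : ℤ) (0<μ : 0ℤ < μ₀) (0<ζ : 0ℤ < ζ) (0<r : 0ℤ < r)
      (large : μ₀ * (+ 2 * μ₀ * (+ 2 * μ₀)) * (r * r) ≤ ζ * ζ)
      (bernoulli : ∏ {n} (λ _ → 1ℤ + r) < ∏ {n} (λ _ → r) + ∏ {n} (λ _ → r))
      (P Q : Vec A n → Bool) (f : Vec Bool n → Set)
      (disjoint : ∀ {x y} → P x ≡ true → Q y ≡ true → ¬ f (zipWith g x y))
      (κ : ℤ) (0<κ : 0ℤ < κ)
      (hard : ∀ d → pow d (+ 2) < κ →
              ∃ λ z → f z × (∀ i → lookup d i ≡ true → lookup z i ≡ false)) where

      private
        V : List (Vec A n)
        V = vecs as n

        w : Vec A n → Vec A n → ℤ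
        w x y = ⟦ P x ⟧ * ⟦ Q y ⟧ * avoid x y

        PQ-nonNeg : ∀ x y → 0ℤ ≤ ⟦ P x ⟧ * ⟦ Q y ⟧
        PQ-nonNeg x y = *-nonNeg (⟦⟧-nonNeg (P x)) (⟦⟧-nonNeg (Q y))

        w-nonNeg : ∀ x y → 0ℤ ≤ w x y
        w-nonNeg x y = *-nonNeg (PQ-nonNeg x y) (avoid-nonNeg x y)

        w≤avoid : ∀ x y → w x y ≤ avoid x y
        w≤avoid x y = subst (w x y ≤_) (*-identityˡ _) (*-monoʳ (avoid-nonNeg x y)
          (*-mono {⟦ P x ⟧} (⟦⟧-nonNeg (P x)) 0≤1 (⟦⟧≤1 (P x)) (⟦⟧≤1 (Q y))))

        restricted : Vec Bool n → Vec A n → Vec A n → Vec A n → Vec A n → ℤ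
        restricted d α β x y = w x y * (δᵐ d x α * δᵐ d y β)

        restricted-nonNeg : ∀ d α β x y → 0ℤ ≤ restricted d α β x y
        restricted-nonNeg d α β x y =
          *-nonNeg (w-nonNeg x y) (*-nonNeg (δᵐ-nonNeg d x α) (δᵐ-nonNeg d y β))

        weight : Vec Bool n → Vec A n → Vec A n → ℤ
        weight d α β = Σ[ x ← V ] Σ[ y ← V ] restricted d α β x y

        -- A fixed coordinate admits at most one pair of letters in place of the ζ pairs with output
        -- `false`; the factor `pow d ζ` makes up for this.
        weight≤ : ∀ d α β → weight d α β * pow d ζ ≤ ∏ {n} (λ _ → ζ)
        weight≤ d α β = begin
          weight d α β * pow d ζ
            ≤⟨ *-monoʳ (<⇒≤ (pow-pos d 0<ζ)) (Σ-mono V λ x → Σ-mono V λ y →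
                 *-monoʳ (*-nonNeg (δᵐ-nonNeg d x α) (δᵐ-nonNeg d y β)) (w≤avoid x y)) ⟩
          (Σ[ x ← V ] Σ[ y ← V ] avoid x y * (δᵐ d x α * δᵐ d y β)) * pow d ζ
            ≡⟨ cong (_* pow d ζ) (trans (Σ-cong V λ x → trans (Σ-cong V λ y → merge x y)
                 (Σ-∏ as λ i b → φ i (lookup x i) b)) (Σ-∏ as λ i a → Σ[ b ← as ] φ i a b)) ⟩
          ∏ (λ i → Σ[ a ← as ] Σ[ b ← as ] φ i a b) * pow d ζ
            ≡⟨ sym (∏-* (λ i → Σ[ a ← as ] Σ[ b ← as ] φ i a b) (λ i → if lookup d i then ζ else 1ℤ)) ⟩
          ∏ (λ i → (Σ[ a ← as ] Σ[ b ← as ] φ i a b) * (if lookup d i then ζ else 1ℤ))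
            ≤⟨ ∏-mono {n} (λ i → *-nonNeg (φ-nonNeg i) (<⇒≤ (if-pos (lookup d i) 0<ζ 0<1)))
                      (λ i → bound (lookup d i) (lookup α i) (lookup β i)) ⟩
          ∏ {n} (λ _ → ζ) ∎
          where
          open ≤-Reasoning
          Φ : Bool → A → A → A → A → ℤ
          Φ c a b α β = unset (g a b) * ((if c then δ a α else 1ℤ) * (if c then δ b β else 1ℤ))
          φ : Fin n → A → A → ℤ
          φ i a b = Φ (lookup d i) a b (lookup α i) (lookup β i)
          merge : ∀ x y → avoid x y * (δᵐ d x α * δᵐ d y β) ≡ ∏ λ i → φ i (lookup x i) (lookup y i)
          merge x y = sym (trans (∏-* (λ i → unset (g (lookup x i) (lookup y i))) D)
            (cong (avoid x y *_) (∏-* (λ i → if lookup d i then δ (lookup x i) (lookup α i) else 1ℤ)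
                                      (λ i → if lookup d i then δ (lookup y i) (lookup β i) else 1ℤ))))
            where
            D : Fin n → ℤ
            D i = (if lookup d i then δ (lookup x i) (lookup α i) else 1ℤ) *
                  (if lookup d i then δ (lookup y i) (lookup β i) else 1ℤ)
          if-nonNeg : ∀ c a b → 0ℤ ≤ (if c then δ a b else 1ℤ)
          if-nonNeg true  a b = ⟦⟧-nonNeg _
          if-nonNeg false a b = 0≤1
          φ-nonNeg : ∀ i → 0ℤ ≤ Σ[ a ← as ] Σ[ b ← as ] φ i a b
          φ-nonNeg i = Σ-nonNeg as λ a → Σ-nonNeg as λ b → *-nonNeg (unset-nonNeg (g a b))
            (*-nonNeg (if-nonNeg (lookup d i) a (lookup α i)) (if-nonNeg (lookup d i) b (lookup β i)))
          unset≤1 : ∀ c → unset c ≤ 1ℤ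
          unset≤1 true  = 0≤1
          unset≤1 false = ≤-refl
          bound : ∀ c α β → (Σ[ a ← as ] Σ[ b ← as ] Φ c a b α β) * (if c then ζ else 1ℤ) ≤ ζ
          bound false α β = ≤-reflexive (trans (*-identityʳ _)
            (Σ-cong as λ a → Σ-cong as λ b → *-identityʳ _))
          bound true α β = subst ((Σ[ a ← as ] Σ[ b ← as ] Φ true a b α β) * ζ ≤_) (*-identityˡ ζ) (*-monoʳ (<⇒≤ 0<ζ) (begin
            Σ[ a ← as ] Σ[ b ← as ] Φ true a b α β
              ≤⟨ Σ-mono as (λ a → Σ-mono as λ b → subst (Φ true a b α β ≤_) (*-identityˡ (δ a α * δ b β))
                   (*-monoʳ {δ a α * δ b β} (*-nonNeg {δ a α} (⟦⟧-nonNeg _) (⟦⟧-nonNeg _)) (unset≤1 (g a b)))) ⟩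
            Σ[ a ← as ] Σ[ b ← as ] δ a α * δ b β
              ≡⟨ sym (Σ-*Σ as as _ _) ⟩
            (Σ[ a ← as ] δ a α) * (Σ[ b ← as ] δ b β)
              ≡⟨ cong₂ _*_ (Σδ α) (Σδ β) ⟩
            1ℤ ∎))

        Restriction : Set
        Restriction = Vec Bool n × Vec A n × Vec A n

        -- Twice per fixed coordinate is the price of a restriction: at a maximum no
        -- further restriction raises the density by more, so both sides are spread.
        potential : Restriction → ℤ
        potential (d , α , β) = weight d α β * (pow d ζ * copow d (+ 2))

        restrictions : List Restriction
        restrictions = cartesianProduct (vecs bools n) (cartesianProduct V V)

        ∈-restrictions : ∀ ρ → ρ ∈ restrictions
        ∈-restrictions (d , α , β) = ∈-cartesianProduct⁺ (∈-vecs ∈-bools d)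
          (∈-cartesianProduct⁺ (∈-vecs ∈as α) (∈-vecs ∈as β))

        x₀ : Vec A n
        x₀ = replicate n a₀

        none : Vec Bool n
        none = replicate n false

        if-none : ∀ i {c d : ℤ} → (if lookup none i then c else d) ≡ d
        if-none i {c} {d} = cong (if_then c else d) (lookup-replicate i false)

        pow-none : ∀ c → pow none c ≡ 1ℤ
        pow-none c = trans (∏-cong {n} λ i → if-none i) (trans (∏-const {n} 1ℤ) (^-zeroˡ n))

        copow-none : ∀ c → copow none c ≡ ∏ {n} (λ _ → c)
        copow-none c = ∏-cong {n} λ i → if-none i

        δᵐ-none : ∀ x y → δᵐ none x y ≡ 1ℤ
        δᵐ-none x y = trans (∏-cong {n} λ i → if-none i) (trans (∏-const {n} 1ℤ) (^-zeroˡ n))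

        potential-none : potential (none , x₀ , x₀) ≡ mass P Q * ∏ {n} (λ _ → + 2)
        potential-none = cong₂ _*_
          (Σ-cong V λ x → Σ-cong V λ y → trans
            (cong₂ (λ a b → w x y * (a * b)) (δᵐ-none x x₀) (δᵐ-none y x₀)) (*-identityʳ (w x y)))
          (trans (cong₂ _*_ (pow-none ζ) (copow-none (+ 2))) (*-identityˡ _))

        maximal : ∃ λ ρ → potential (none , x₀ , x₀) ≤ potential ρ ×
                          (∀ ρ′ → potential ρ′ ≤ potential ρ)
        maximal with ∃-max restrictions potential (none , x₀ , x₀)
        ... | ρ , ≤ρ , max = ρ , ≤ρ , λ ρ′ → max (∈-restrictions ρ′)

      module _ (d : Vec Bool n) (α β : Vec A n)
        (maximum : ∀ ρ → potential ρ ≤ potential (d , α , β))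
        (d-small : pow d (+ 2) < κ) (0<e : 0ℤ < weight d α β) where
        private
          e : ℤ
          e = weight d α β

          Free : Vec Bool n → Set
          Free m = ∀ i → lookup m i ≡ true → lookup d i ≡ false

          F : Vec A n → Vec A n → ℤ
          F = restricted d α β

          -- Fixing ξ and η on `m` in addition to `d` multiplies the normalising factor of the
          -- potential by ζ^|m| / 2^|m|. By maximality the weight has to shrink at least by the
          -- inverse factor.
          refine : ∀ m → Free m → ∀ ξ η →
            (Σ[ x ← V ] Σ[ y ← V ] F x y * (δᵐ m x ξ * δᵐ m y η)) * pow m ζ ≤ pow m (+ 2) * e
          refine m free ξ η = *-cancelˡ 0<Y (begin
            Y * (e′ * pow m ζ)
              ≡⟨ lem₁ Y e′ (pow m ζ) ⟩
            e′ * (Y * pow m ζ)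
              ≡⟨ cong₂ _*_ (Σ-cong V λ x → Σ-cong V λ y → sym (joint x y)) (sym exchange) ⟩
            weight d′ α′ β′ * (Y′ * pow m (+ 2))
              ≡⟨ sym (*-assoc (weight d′ α′ β′) Y′ (pow m (+ 2))) ⟩
            potential (d′ , α′ , β′) * pow m (+ 2)
              ≤⟨ *-monoʳ (<⇒≤ (pow-pos m 0<2)) (maximum (d′ , α′ , β′)) ⟩
            e * Y * pow m (+ 2)
              ≡⟨ lem₂ e Y (pow m (+ 2)) ⟩
            Y * (pow m (+ 2) * e) ∎)
            where
            open ≤-Reasoning
            lem₁ : ∀ a b c → a * (b * c) ≡ b * (a * c)
            lem₁ = solve-∀
            lem₂ : ∀ a b c → a * b * c ≡ b * (c * a)
            lem₂ = solve-∀
            e′ Y Y′ : ℤ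
            e′ = Σ[ x ← V ] Σ[ y ← V ] F x y * (δᵐ m x ξ * δᵐ m y η)
            d′ : Vec Bool n
            d′ = zipWith _∨_ m d
            override : Vec A n → Vec A n → Vec A n
            override ξ α = tabulate λ i → if lookup m i then lookup ξ i else lookup α i
            α′ β′ : Vec A n
            α′ = override ξ α
            β′ = override η β
            Y  = pow d ζ * copow d (+ 2)
            Y′ = pow d′ ζ * copow d′ (+ 2)
            0<Y : 0ℤ < Y
            0<Y = *-pos (pow-pos d 0<ζ) (copow-pos d 0<2)
            exchange : Y′ * pow m (+ 2) ≡ Y * pow m ζ
            exchange = trans (cong (_* pow m (+ 2)) (sym (∏-* (p d′) (q d′)))) (trans
              (sym (∏-* (λ i → p d′ i * q d′ i) (λ i → if lookup m i then + 2 else 1ℤ))) (trans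
              (∏-cong λ i → pointwise i) (trans
              (∏-* (λ i → p d i * q d i) (p m)) (cong (_* pow m ζ) (∏-* (p d) (q d))))))
              where
              p q : Vec Bool n → Fin n → ℤ
              p d i = if lookup d i then ζ else 1ℤ
              q d i = if lookup d i then 1ℤ else + 2
              cases : ∀ b c → (b ≡ true → c ≡ false) →
                (if b ∨ c then ζ else 1ℤ) * (if b ∨ c then 1ℤ else + 2) * (if b then + 2 else 1ℤ) ≡
                (if c then ζ else 1ℤ) * (if c then 1ℤ else + 2) * (if b then ζ else 1ℤ)
              cases false c     h = refl
              cases true  false h = trans (cong (_* + 2) (*-identityʳ ζ)) (*-comm ζ (+ 2))
              cases true  true  h with () ← h refl
              pointwise : ∀ i → p d′ i * q d′ i * (if lookup m i then + 2 else 1ℤ) ≡ p d i * q d i * p m i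
              pointwise i rewrite lookup-zipWith _∨_ i m d = cases (lookup m i) (lookup d i) (free i)
            δ-join : ∀ x ξ α → δᵐ d′ x (override ξ α) ≡ δᵐ d x α * δᵐ m x ξ
            δ-join x ξ α = trans (∏-cong λ i → pointwise i)
              (∏-* (λ i → if lookup d i then δ (lookup x i) (lookup α i) else 1ℤ)
                   (λ i → if lookup m i then δ (lookup x i) (lookup ξ i) else 1ℤ))
              where
              cases : ∀ b c a ξ α → (b ≡ true → c ≡ false) →
                (if b ∨ c then δ a (if b then ξ else α) else 1ℤ) ≡
                (if c then δ a α else 1ℤ) * (if b then δ a ξ else 1ℤ)
              cases false c     a ξ α h = sym (*-identityʳ _)
              cases true  false a ξ α h = sym (*-identityˡ _)
              cases true  true  a ξ α h with () ← h refl
              pointwise : ∀ i → (if lookup d′ i then δ (lookup x i) (lookup (override ξ α) i) else 1ℤ) ≡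
                (if lookup d i then δ (lookup x i) (lookup α i) else 1ℤ) *
                (if lookup m i then δ (lookup x i) (lookup ξ i) else 1ℤ)
              pointwise i rewrite lookup-zipWith _∨_ i m d
                | lookup∘tabulate (λ i → if lookup m i then lookup ξ i else lookup α i) i =
                cases (lookup m i) (lookup d i) (lookup x i) (lookup ξ i) (lookup α i) (free i)
            joint : ∀ x y → restricted d′ α′ β′ x y ≡ F x y * (δᵐ m x ξ * δᵐ m y η)
            joint x y = trans (cong₂ (λ a b → w x y * (a * b)) (δ-join x ξ α) (δ-join y η β))
              (lem (w x y) (δᵐ d x α) (δᵐ m x ξ) (δᵐ d y β) (δᵐ m y η))
              where
              lem : ∀ w a b c d → w * (a * b * (c * d)) ≡ w * (a * c) * (b * d)
              lem = solve-∀

          -- The marginals decouple the two sides. A row of positive `u` lies in P and a column of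
          -- positive `v` lies in Q, so any such pair is in the rectangle, even where `F x y`
          -- vanishes.
          u v : Vec A n → ℤ
          u x = Σ[ y ← V ] F x y
          v y = Σ[ x ← V ] F x y

          u-nonNeg : ∀ x → 0ℤ ≤ u x
          u-nonNeg x = Σ-nonNeg V λ y → restricted-nonNeg d α β x y

          v-nonNeg : ∀ y → 0ℤ ≤ v y
          v-nonNeg y = Σ-nonNeg V λ x → restricted-nonNeg d α β x y

          Σv : Σ V v ≡ e
          Σv = Σ-swap V V (λ y x → F x y)

          C : Vec Bool n → ℤ
          C m = pow m μ₀ * (pow m (+ 2) * e)

          u-spread : ∀ m → Free m → ∀ ξ → (Σ[ x ← V ] u x * δᵐ m x ξ) * pow m ζ ≤ C m
          u-spread m free = marginal as Σδ m F (pow m ζ) (pow m (+ 2) * e) 0<μ (refine m free)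

          v-spread : ∀ m → Free m → ∀ η → (Σ[ y ← V ] v y * δᵐ m y η) * pow m ζ ≤ C m
          v-spread m free = marginal as Σδ m (λ y x → F x y) (pow m ζ) (pow m (+ 2) * e) 0<μ
            λ η ξ → subst (λ s → s * pow m ζ ≤ pow m (+ 2) * e)
              (trans (Σ-swap V V (λ x y → F x y * (δᵐ m x ξ * δᵐ m y η)))
                     (Σ-cong V λ y → Σ-cong V λ x → cong (F x y *_) (*-comm (δᵐ m x ξ) (δᵐ m y η))))
              (refine m free ξ η)

          z : Vec Bool n
          z = proj₁ (hard d d-small)

          -- Off `d`, 1 + c is twice the indicator that the gadget outputs the target bit of `z`; on
          -- `d`, where the output is already settled, it is 1.
          c : Fin n → A → A → ℤ
          c i a b = if lookup d i then 0ℤ else sgn (lookup z i) * sgn (g a b)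

          kernel : Vec Bool n → Fin n → A → A → ℤ
          kernel m i a b = if lookup m i then c i a b else 1ℤ

          term : Vec Bool n → ℤ
          term m = Σ[ x ← V ] u x * (Σ[ y ← V ] v y * ∏ λ i → kernel m i (lookup x i) (lookup y i))

          kernel-orth : ∀ m → Free m → ∀ i b b′ → Σ[ a ← as ] kernel m i a b * kernel m i a b′ ≡
                                                  μ₀ * (if lookup m i then δ b b′ else 1ℤ)
          kernel-orth m free i b b′ with lookup m i | free i
          ... | false | _ = trans (Σ-cong as λ _ → refl) (sym (*-identityʳ μ₀))
          ... | true  | free rewrite free refl = trans
            (Σ-cong as λ a → lem (sgn (lookup z i)) (sgn (g a b)) (sgn (g a b′)) (sgn² (lookup z i)))
            (orthogonal b b′)
            where
            lem : ∀ s a b → s * s ≡ 1ℤ → s * a * (s * b) ≡ a * b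
            lem s a b s² = trans (regroup s a b) (trans (cong (_* (a * b)) s²) (*-identityˡ _))
              where
              regroup : ∀ s a b → s * a * (s * b) ≡ s * s * (a * b)
              regroup = solve-∀

          kernel-const : ∀ m i a a′ b → lookup m i ≡ false → kernel m i a b ≡ kernel m i a′ b
          kernel-const m i a a′ b eq rewrite eq = refl

          -- With Z = ζ^|m| and c = (2 μ)^|m| e, `spread⇒small` gives term² ≤ (4 μ³ / ζ²)^|m| e⁴,
          -- and `large` says that the base is at most 1 / r².
          term-bound : ∀ m → Free m → - (e * e) ≤ term m * pow m r
          term-bound m free = square-≤⇒-≤ (*-nonNeg (<⇒≤ 0<e) (<⇒≤ 0<e)) (*-cancelˡ 0<W (begin
            W * (t * R * (t * R))
              ≡⟨ lem₁ W t R ⟩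
            t * t * (W * (R * R))
              ≤⟨ *-monoˡ (square-nonNeg t) W-bound ⟩
            t * t * (pow m ζ * pow m ζ)
              ≤⟨ spread⇒small _≟_ as Σδ m (kernel m) 0<μ (kernel-orth m free) (kernel-const m) u v
                   u-nonNeg v-nonNeg e refl Σv (pow m ζ) (C m) (<⇒≤ (pow-pos m 0<ζ))
                   (*-nonNeg (<⇒≤ 0<M) (*-nonNeg (<⇒≤ 0<T) (<⇒≤ 0<e))) (u-spread m free) (v-spread m free) ⟩
            M * (e * (M * (T * e)) * (e * (M * (T * e))))
              ≡⟨ lem₂ M e T ⟩
            W * (e * e * (e * e)) ∎))
            where
            open ≤-Reasoning
            t = term m
            R = pow m r
            M = pow m μ₀
            T = pow m (+ 2)
            W = M * (T * M * (T * M))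
            0<M : 0ℤ < M
            0<M = pow-pos m 0<μ
            0<T : 0ℤ < T
            0<T = pow-pos m 0<2
            0<W : 0ℤ < W
            0<W = *-pos 0<M (*-pos (*-pos 0<T 0<M) (*-pos 0<T 0<M))
            lem₁ : ∀ w t r → w * (t * r * (t * r)) ≡ t * t * (w * (r * r))
            lem₁ = solve-∀
            lem₂ : ∀ m e t → m * (e * (m * (t * e)) * (e * (m * (t * e)))) ≡
                   m * (t * m * (t * m)) * (e * e * (e * e))
            lem₂ = solve-∀
            pow-* : ∀ a b → pow m a * pow m b ≡ pow m (a * b)
            pow-* a b = trans (sym (∏-* (λ i → if lookup m i then a else 1ℤ) (λ i → if lookup m i then b else 1ℤ)))
              (∏-cong λ i → cases (lookup m i))
              where
              cases : ∀ c → (if c then a else 1ℤ) * (if c then b else 1ℤ) ≡ (if c then a * b else 1ℤ)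
              cases true  = refl
              cases false = refl
            W-bound : W * (R * R) ≤ pow m ζ * pow m ζ
            W-bound = subst₂ _≤_ (sym W≡) (sym (pow-* ζ ζ)) (∏-mono
              (λ i → <⇒≤ (if-pos (lookup m i) (*-pos (*-pos 0<μ (*-pos 0<2μ 0<2μ)) (*-pos 0<r 0<r)) 0<1))
              (λ i → cases (lookup m i)))
              where
              0<2μ : 0ℤ < + 2 * μ₀
              0<2μ = *-pos 0<2 0<μ
              cases : ∀ c → (if c then μ₀ * (+ 2 * μ₀ * (+ 2 * μ₀)) * (r * r) else 1ℤ) ≤ (if c then ζ * ζ else 1ℤ)
              cases true  = large
              cases false = ≤-refl
              W≡ : W * (R * R) ≡ pow m (μ₀ * (+ 2 * μ₀ * (+ 2 * μ₀)) * (r * r))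
              W≡ = trans (cong₂ _*_ (trans (cong (M *_) (trans (cong₂ _*_ (pow-* (+ 2) μ₀) (pow-* (+ 2) μ₀))
                (pow-* (+ 2 * μ₀) (+ 2 * μ₀)))) (pow-* μ₀ _)) (pow-* r r)) (pow-* _ (r * r))

          term-zero : ∀ m i → lookup m i ≡ true → lookup d i ≡ true → term m ≡ 0ℤ
          term-zero m i mᵢ dᵢ = trans (Σ-cong V λ x → trans (cong (u x *_)
            (trans (Σ-cong V λ y → trans (cong (v y *_) (∏-zero i vanish)) (*-zeroʳ (v y))) (Σ-zero V)))
            (*-zeroʳ (u x))) (Σ-zero V)
            where
            vanish : ∀ {a b} → kernel m i a b ≡ 0ℤ
            vanish rewrite mᵢ | dᵢ = refl

          -- A mask that meets `d` contributes 0, because c vanishes on `d`; all other masks are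
          -- free.
          term-bound′ : ∀ m → 0ℤ ≤ term m * pow m r + e * e
          term-bound′ m with any? (λ i → (lookup m i ∧ lookup d i) Bool.≟ true)
          ... | yes (i , both) = subst (λ t → 0ℤ ≤ t * pow m r + e * e)
            (sym (term-zero m i (left (lookup m i) both) (right (lookup m i) both)))
            (subst (0ℤ ≤_) (sym (+-identityˡ (e * e))) (square-nonNeg e))
            where
            left : ∀ a {b} → a ∧ b ≡ true → a ≡ true
            left true _ = refl
            right : ∀ a {b} → a ∧ b ≡ true → b ≡ true
            right true eq = eq
          ... | no none-both = subst (_≤ term m * pow m r + e * e) (+-inverseˡ (e * e))
            (+-monoˡ-≤ (e * e) (term-bound m λ i mᵢ → free (lookup d i) λ dᵢ → none-both (i , cong₂ _∧_ mᵢ dᵢ)))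
            where
            free : ∀ b → ¬ b ≡ true → b ≡ false
            free true  h = contradiction refl h
            free false h = refl

          S : ℤ
          S = Σ[ x ← V ] Σ[ y ← V ] u x * v y * ∏ λ i → 1ℤ + c i (lookup x i) (lookup y i)

          S≡Σterm : S ≡ Σ (vecs bools n) term
          S≡Σterm = begin
            S
              ≡⟨ Σ-cong V (λ x → Σ-cong V λ y → trans (cong (u x * v y *_) (expand x y))
                   (sym (Σ-*ˡ (vecs bools n) (u x * v y) _))) ⟩
            Σ[ x ← V ] Σ[ y ← V ] Σ[ m ← vecs bools n ] u x * v y * K m x y
              ≡⟨ Σ-cong V (λ x → Σ-swap V (vecs bools n) _) ⟩
            Σ[ x ← V ] Σ[ m ← vecs bools n ] Σ[ y ← V ] u x * v y * K m x y
              ≡⟨ Σ-swap V (vecs bools n) _ ⟩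
            Σ[ m ← vecs bools n ] Σ[ x ← V ] Σ[ y ← V ] u x * v y * K m x y
              ≡⟨ Σ-cong (vecs bools n) (λ m → Σ-cong V λ x → trans
                   (Σ-cong V λ y → *-assoc (u x) (v y) (K m x y)) (Σ-*ˡ V (u x) _)) ⟩
            Σ (vecs bools n) term ∎
            where
            open ≡-Reasoning
            K : Vec Bool n → Vec A n → Vec A n → ℤ
            K m x y = ∏ λ i → kernel m i (lookup x i) (lookup y i)
            expand : ∀ x y → ∏ (λ i → 1ℤ + c i (lookup x i) (lookup y i)) ≡ Σ[ m ← vecs bools n ] K m x y
            expand x y = sym (trans (Σ-∏ bools λ i b → if b then c i (lookup x i) (lookup y i) else 1ℤ)
              (∏-cong λ i → lem (c i (lookup x i) (lookup y i))))
              where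
              lem : ∀ c → c + (1ℤ + 0ℤ) ≡ 1ℤ + c
              lem = solve-∀

          term-none : term none ≡ e * e
          term-none = begin
            term none
              ≡⟨ Σ-cong V (λ x → cong (u x *_) (trans (Σ-cong V λ y →
                   trans (cong (v y *_) (trans (∏-cong {n} λ i → if-none i) (trans (∏-const {n} 1ℤ) (^-zeroˡ n))))
                         (*-identityʳ (v y))) Σv)) ⟩
            Σ[ x ← V ] u x * e
              ≡⟨ Σ-*ʳ V e u ⟩
            e * e ∎
            where open ≡-Reasoning

          -- The nonnegative numbers (term m · r^|m| + e²) r^(n - |m|) add up, over all masks, to S
          -- r^n + e² (1 + r)^n. The empty mask alone contributes 2 e² r^n, so S ≤ 0 would
          -- contradict (1 + r)^n < 2 r^n.
          0<S : 0ℤ < S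
          0<S = ≰⇒> λ S≤0 → <⇒≱ bernoulli (*-cancelˡ (*-pos 0<e 0<e) (begin
            e * e * (ρ + ρ)
              ≡⟨ trans (lem₁ (e * e) ρ) (cong₂ (λ a b → (a + e * e) * b)
                   (sym (trans (cong₂ _*_ term-none (pow-none r)) (*-identityʳ (e * e)))) (sym (copow-none r))) ⟩
            (term none * pow none r + e * e) * copow none r
              ≤⟨ ∈⇒≤Σ (λ m → *-nonNeg (term-bound′ m) (<⇒≤ (copow-pos m 0<r))) (∈-vecs ∈-bools none) ⟩
            Σ[ m ← vecs bools n ] (term m * pow m r + e * e) * copow m r
              ≡⟨ Σ-cong (vecs bools n) (λ m → trans (lem₂ (term m) (pow m r) (e * e) (copow m r))
                   (cong (λ s → term m * s + e * e * copow m r) (pow*copow m r))) ⟩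
            Σ[ m ← vecs bools n ] (term m * ρ + e * e * copow m r)
              ≡⟨ trans (Σ-+ (vecs bools n) _ _) (cong₂ _+_ (Σ-*ʳ (vecs bools n) ρ term) (Σ-*ˡ (vecs bools n) (e * e) _)) ⟩
            Σ (vecs bools n) term * ρ + e * e * (Σ[ m ← vecs bools n ] copow m r)
              ≡⟨ cong₂ (λ a b → a * ρ + e * e * b) (sym S≡Σterm)
                   (trans (Σ-∏ bools {n} λ _ b → if b then 1ℤ else r) (∏-cong {n} λ _ → cong (λ s → 1ℤ + s) (+-identityʳ r))) ⟩
            S * ρ + e * e * ∏ {n} (λ _ → 1ℤ + r)
              ≤⟨ +-monoˡ-≤ _ (*-monoʳ (<⇒≤ 0<ρ) S≤0) ⟩
            0ℤ * ρ + e * e * ∏ {n} (λ _ → 1ℤ + r)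
              ≡⟨ +-identityˡ _ ⟩
            e * e * ∏ {n} (λ _ → 1ℤ + r) ∎))
            where
            open ≤-Reasoning
            ρ = ∏ {n} (λ _ → r)
            0<ρ : 0ℤ < ρ
            0<ρ = ∏-pos {n} λ _ → 0<r
            lem₁ : ∀ a b → a * (b + b) ≡ (a + a) * b
            lem₁ = solve-∀
            lem₂ : ∀ t p e q → (t * p + e) * q ≡ t * (p * q) + e * q
            lem₂ = solve-∀

          on-d : ∀ x y → restricted d α β x y ≢ 0ℤ →
                 (∀ i → lookup d i ≡ true → lookup x i ≡ lookup α i × lookup y i ≡ lookup β i)
          on-d x y F≢0 i dᵢ =
            δᵐ⇒≡ d x α (*-≢0ˡ (δᵐ d x α) (δᵐ d y β) (*-≢0ʳ (w x y) _ F≢0)) i dᵢ ,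
            δᵐ⇒≡ d y β (*-≢0ʳ (δᵐ d x α) (δᵐ d y β) (*-≢0ʳ (w x y) _ F≢0)) i dᵢ

          restricted⇒false : ∀ x y → restricted d α β x y ≢ 0ℤ → ∀ i →
                             g (lookup x i) (lookup y i) ≡ false
          restricted⇒false x y F≢0 i = unset⇒false _ λ eq →
            *-≢0ʳ (⟦ P x ⟧ * ⟦ Q y ⟧) (avoid x y) (*-≢0ˡ (w x y) (δᵐ d x α * δᵐ d y β) F≢0) (∏-zero i eq)

          αβ-unset : ∀ i → lookup d i ≡ true → g (lookup α i) (lookup β i) ≡ false
          αβ-unset i dᵢ =
            let x , 0<u = 0<Σ⇒∃ V {u} 0<e
                y , 0<F = 0<Σ⇒∃ V {F x} 0<u
                x≡ , y≡ = on-d x y (0<⇒≢ 0<F) i dᵢ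
            in trans (sym (cong₂ g x≡ y≡)) (restricted⇒false x y (0<⇒≢ 0<F) i)

          ⟦⟧⇒true : ∀ b → ⟦ b ⟧ ≢ 0ℤ → b ≡ true
          ⟦⟧⇒true true  h = refl
          ⟦⟧⇒true false h = contradiction refl h

          PQ≢0 : ∀ x y → restricted d α β x y ≢ 0ℤ → ⟦ P x ⟧ * ⟦ Q y ⟧ ≢ 0ℤ
          PQ≢0 x y F≢0 =
            *-≢0ˡ (⟦ P x ⟧ * ⟦ Q y ⟧) (avoid x y) (*-≢0ˡ (w x y) (δᵐ d x α * δᵐ d y β) F≢0)

          u⇒P : ∀ x → u x ≢ 0ℤ →
                P x ≡ true × (∀ i → lookup d i ≡ true → lookup x i ≡ lookup α i)
          u⇒P x u≢0 =
            let y , 0<F = 0<Σ⇒∃ V {F x} (≤∧≢⇒< (u-nonNeg x) (λ eq → u≢0 (sym eq)))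
            in ⟦⟧⇒true (P x) (*-≢0ˡ ⟦ P x ⟧ ⟦ Q y ⟧ (PQ≢0 x y (0<⇒≢ 0<F))) ,
               λ i dᵢ → proj₁ (on-d x y (0<⇒≢ 0<F) i dᵢ)

          v⇒Q : ∀ y → v y ≢ 0ℤ →
                Q y ≡ true × (∀ i → lookup d i ≡ true → lookup y i ≡ lookup β i)
          v⇒Q y v≢0 =
            let x , 0<F = 0<Σ⇒∃ V {λ x → F x y} (≤∧≢⇒< (v-nonNeg y) (λ eq → v≢0 (sym eq)))
            in ⟦⟧⇒true (Q y) (*-≢0ʳ ⟦ P x ⟧ ⟦ Q y ⟧ (PQ≢0 x y (0<⇒≢ 0<F))) ,
               λ i dᵢ → proj₂ (on-d x y (0<⇒≢ 0<F) i dᵢ)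

          factors : Vec A n → Vec A n → ℤ
          factors x y = ∏ λ i → 1ℤ + c i (lookup x i) (lookup y i)

          -- Off `d` a nonzero factor forces the output to be that of `z`. On `d` the letters are
          -- those of α and β, whose output is `false`, and so is `z`. Hence the rectangle produces
          -- `z`, where f holds.
          realise : ∀ x y → 0ℤ < u x * v y * factors x y → ⊥
          realise x y 0<uv∏ = disjoint (proj₁ Px) (proj₁ Qy)
            (subst f (sym (vec-ext output)) (proj₁ (proj₂ (hard d d-small))))
            where
            uv≢0 : u x * v y ≢ 0ℤ
            uv≢0 = *-≢0ˡ (u x * v y) (factors x y) (0<⇒≢ 0<uv∏)
            Px : P x ≡ true × (∀ i → lookup d i ≡ true → lookup x i ≡ lookup α i)
            Px = u⇒P x (*-≢0ˡ (u x) (v y) uv≢0)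
            Qy : Q y ≡ true × (∀ i → lookup d i ≡ true → lookup y i ≡ lookup β i)
            Qy = v⇒Q y (*-≢0ʳ (u x) (v y) uv≢0)
            factor : ∀ i → 1ℤ + c i (lookup x i) (lookup y i) ≢ 0ℤ
            factor i eq = *-≢0ʳ (u x * v y) (factors x y) (0<⇒≢ 0<uv∏) (∏-zero i eq)
            cases : ∀ i b → lookup d i ≡ b → g (lookup x i) (lookup y i) ≡ lookup z i
            cases i true  dᵢ = trans (cong₂ g (proj₂ Px i dᵢ) (proj₂ Qy i dᵢ))
              (trans (αβ-unset i dᵢ) (sym (proj₂ (proj₂ (hard d d-small)) i dᵢ)))
            cases i false dᵢ = sgn-agree (lookup z i) _ (subst
              (λ b → 1ℤ + (if b then 0ℤ else sgn (lookup z i) * sgn (g (lookup x i) (lookup y i))) ≢ 0ℤ)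
              dᵢ (factor i))
            output : ∀ i → lookup (zipWith g x y) i ≡ lookup z i
            output i = trans (lookup-zipWith g i x y) (cases i (lookup d i) refl)

        maximum-absurd : ⊥
        maximum-absurd =
           let x , 0<Sx   = 0<Σ⇒∃ V 0<S
               y , 0<uv∏ = 0<Σ⇒∃ V {λ y → u x * v y * factors x y} 0<Sx
           in realise x y 0<uv∏

      -- The empty restriction of a heavier rectangle has potential above (2 ζ)^n / κ, and so has
      -- the maximal one. This keeps its weight positive and its set of fixed coordinates small, as
      -- `maximum-absurd` requires.
      rectangle-light : κ * mass P Q ≤ ∏ {n} (λ _ → ζ)
      rectangle-light = ≮⇒≥ heavy-absurd
        where
        heavy-absurd : ¬ ∏ {n} (λ _ → ζ) < κ * mass P Q
        heavy-absurd heavy with maximal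
        ... | (d , α , β) , none≤ , maximum = maximum-absurd d α β maximum d-small 0<e
          where
          e : ℤ
          e = weight d α β

          0<∏ζ : 0ℤ < ∏ {n} (λ _ → ζ)
          0<∏ζ = ∏-pos {n} λ _ → 0<ζ

          0<∏2 : 0ℤ < ∏ {n} (λ _ → + 2)
          0<∏2 = ∏-pos {n} λ _ → 0<2

          heavy′ : ∏ {n} (λ _ → ζ) * ∏ {n} (λ _ → + 2) < κ * (e * (pow d ζ * copow d (+ 2)))
          heavy′ = begin-strict
            ∏ {n} (λ _ → ζ) * ∏ {n} (λ _ → + 2)
              <⟨ *-monoʳ-<-pos (∏ {n} (λ _ → + 2)) {{positive 0<∏2}} heavy ⟩
            κ * mass P Q * ∏ {n} (λ _ → + 2)
              ≡⟨ *-assoc κ (mass P Q) _ ⟩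
            κ * (mass P Q * ∏ {n} (λ _ → + 2))
              ≡⟨ cong (κ *_) (sym potential-none) ⟩
            κ * potential (none , x₀ , x₀)
              ≤⟨ *-monoˡ (<⇒≤ 0<κ) none≤ ⟩
            κ * (e * (pow d ζ * copow d (+ 2))) ∎
            where open ≤-Reasoning

          -- Since weight · ζ^|d| ≤ ζ^n, the potential is at most ζ^n 2^(n - |d|); comparison with
          -- (2 ζ)^n / κ leaves 2^|d| < κ.
          d-small : pow d (+ 2) < κ
          d-small = ≰⇒> λ κ≤ → <⇒≱ heavy′ (begin
            κ * (e * (pow d ζ * copow d (+ 2)))
              ≡⟨ lem κ e (pow d ζ) (copow d (+ 2)) ⟩
            κ * copow d (+ 2) * (e * pow d ζ)
              ≤⟨ *-mono (*-nonNeg (<⇒≤ 0<κ) (<⇒≤ (copow-pos d 0<2))) (<⇒≤ 0<∏ζ)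
                   (*-monoʳ (<⇒≤ (copow-pos d 0<2)) κ≤) (weight≤ d α β) ⟩
            pow d (+ 2) * copow d (+ 2) * ∏ {n} (λ _ → ζ)
              ≡⟨ cong (_* ∏ {n} (λ _ → ζ)) (pow*copow d (+ 2)) ⟩
            ∏ {n} (λ _ → + 2) * ∏ {n} (λ _ → ζ)
              ≡⟨ *-comm (∏ {n} (λ _ → + 2)) _ ⟩
            ∏ {n} (λ _ → ζ) * ∏ {n} (λ _ → + 2) ∎)
            where
            open ≤-Reasoning
            lem : ∀ a b c d → a * (b * (c * d)) ≡ a * d * (b * c)
            lem = solve-∀

          0<e : 0ℤ < e
          0<e = ≰⇒> λ e≤0 → <⇒≱ heavy′ (begin
            κ * (e * (pow d ζ * copow d (+ 2)))
              ≤⟨ *-monoˡ (<⇒≤ 0<κ) (*-monoʳ (*-nonNeg (<⇒≤ (pow-pos d 0<ζ)) (<⇒≤ (copow-pos d 0<2))) e≤0) ⟩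
            κ * 0ℤ
              ≡⟨ *-zeroʳ κ ⟩
            0ℤ
              ≤⟨ *-nonNeg (<⇒≤ 0<∏ζ) (<⇒≤ 0<∏2) ⟩
            ∏ {n} (λ _ → ζ) * ∏ {n} (λ _ → + 2) ∎)
            where open ≤-Reasoning

-- Existence of the cover number.

module CoverNumbers where
  open import Data.Bool using (Bool; true)
  import Data.Bool.Properties as Bool
  open import Data.Fin as Fin using (Fin; zero; suc)
  open import Data.Fin.Properties using (any?; all?; _≟_)
  open import Data.Fin.Subset using (Subset)
  open import Data.Fin.Subset.Properties using (_∈?_)
  open import Data.Irrelevant using ([_])
  open import Data.List as List using (List; []; _∷_; length; concatMap)
  open import Data.List.Membership.Propositional using (_∈_; find)
  open import Data.List.Membership.Propositional.Properties using (∈-concat⁺′; ∈-map⁺)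
  open import Data.List.Relation.Unary.Any as Any using (here)
  open import Data.List.Relation.Unary.Any.Properties using (lookup-index)
  open import Data.Nat using (ℕ; zero; suc; _+_; _≤_; _<_)
  open import Data.Nat.Properties using (+-identityʳ; +-suc; ≮⇒≥; m<1+n⇒m<n∨m≡n)
  open import Data.Product using (∃; _×_; _,_; proj₁; proj₂)
  open import Data.Refinement using (Refinement; _,_)
  open import Data.Sum using (inj₁; inj₂)
  open import Data.Vec as Vec using (Vec)
  open import Data.Vec.Properties using (lookup∘tabulate)
  open import Function using (_∘_)
  open import Relation.Binary.PropositionalEquality
  open import Relation.Nullary using (¬_; Dec; yes; no; does; contradiction)
  open import Relation.Nullary.Decidable using (map′; _×-dec_; _→-dec_; ¬?; decidable-stable; ¬¬-excluded-middle; dec-true)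
  open import Relation.Nullary.Negation using (contradiction-irr)
  open import Defs
  open Sums using (vecs; ∈-vecs)
  open Weights using (bools; ∈-bools)

  -- Double negation passes through finite conjunctions. For a decidable goal, excluded middle may
  -- therefore be assumed for finitely many statements at once.
  ¬¬-∀Fin : ∀ {n} {P : Fin n → Set} → (∀ i → ¬ ¬ P i) → ¬ ¬ (∀ i → P i)
  ¬¬-∀Fin {zero}  ¬¬P ¬∀ = ¬∀ λ ()
  ¬¬-∀Fin {suc n} ¬¬P ¬∀ = ¬¬P zero λ p₀ → ¬¬-∀Fin (¬¬P ∘ suc) λ p →
    ¬∀ λ { zero → p₀ ; (suc i) → p i }

  Listable : Set → Set
  Listable X = ∃ λ (xs : List X) → ∀ x → x ∈ xs

  module _ {X : Set} (X-listable : Listable X) where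

    size : ℕ
    size = length (proj₁ X-listable)

    element : Fin size → X
    element = List.lookup (proj₁ X-listable)

    index : X → Fin size
    index x = Any.index (proj₂ X-listable x)

    element-index : ∀ x → element (index x) ≡ x
    element-index x = sym (lookup-index (proj₂ X-listable x))

  ∃? : ∀ {X} → Listable X → {P : X → Set} → (∀ x → Dec (P x)) → Dec (∃ P)
  ∃? (xs , all∈) P? = map′
    (λ p → let x , _ , Px = find p in x , Px)
    (λ (x , Px) → Any.map (λ x≡ → subst _ x≡ Px) (all∈ x))
    (Any.any? P? xs)

  least : {P : ℕ → Set} → (∀ n → Dec (P n)) → ∀ n → P n →
          ∃ λ k → P k × (∀ {m} → P m → k ≤ m)
  least {P} P? n Pn = go n 0 (λ ()) (subst P (sym (+-identityʳ n)) Pn)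
    where
    go : ∀ fuel i → (∀ {j} → j < i → ¬ P j) → P (fuel + i) → ∃ λ k → P k × (∀ {m} → P m → k ≤ m)
    go fuel i none P-end with P? i
    ... | yes Pi = i , Pi , λ Pm → ≮⇒≥ λ m<i → none m<i Pm
    go zero       i none P-end | no ¬Pi = contradiction P-end ¬Pi
    go (suc fuel) i none P-end | no ¬Pi = go fuel (suc i) none′ (subst P (sym (+-suc fuel i)) P-end)
      where
      none′ : ∀ {j} → j < suc i → ¬ P j
      none′ j<1+i Pj with m<1+n⇒m<n∨m≡n j<1+i
      ... | inj₁ j<i  = none j<i Pj
      ... | inj₂ refl = ¬Pi Pj

  module _ {X Y : Set} (X-listable : Listable X) (Y-listable : Listable Y) (F : X → Y → Fin 2) where

    private
      x# : Fin (size X-listable) → X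
      x# = element X-listable
      y# : Fin (size Y-listable) → Y
      y# = element Y-listable

    -- Coverable allows arbitrary predicates; tables make coverability decidable, and
    -- every cover is one by tables up to a double negation.
    Table : ℕ → ℕ → Set
    Table m n = Vec (Vec Bool m) n

    _⟨_,_⟩ : ∀ {m n} → Table m n → Fin n → Fin m → Set
    T ⟨ p , i ⟩ = Vec.lookup (Vec.lookup T p) i ≡ true

    Covers : ∀ {m} → Table m (size X-listable) → Table m (size Y-listable) → Set
    Covers S T = ∀ p q →
      ((∃ λ i → S ⟨ p , i ⟩ × T ⟨ q , i ⟩) → F (x# p) (y# q) ≡ zero) ×
      (F (x# p) (y# q) ≡ zero → ∃ λ i → S ⟨ p , i ⟩ × T ⟨ q , i ⟩)

    TableCoverable : ℕ → Set
    TableCoverable m = ∃ λ S → ∃ λ T → Covers {m} S T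

    tableCoverable? : ∀ m → Dec (TableCoverable m)
    tableCoverable? m = ∃? tables λ S → ∃? tables λ T → all? λ p → all? λ q →
      (covered? S T p q →-dec F _ _ ≟ zero) ×-dec (F _ _ ≟ zero →-dec covered? S T p q)
      where
      tables : ∀ {n} → Listable (Table m n)
      tables = vecs (vecs bools m) _ , ∈-vecs (∈-vecs ∈-bools)
      covered? : ∀ S T p q → Dec (∃ λ i → S ⟨ p , i ⟩ × T ⟨ q , i ⟩)
      covered? S T p q = any? λ i → (_ Bool.≟ true) ×-dec (_ Bool.≟ true)

    table⇒coverable : ∀ {m} → TableCoverable m → Coverable F m
    table⇒coverable (S , T , covers) =
      (λ i x → S ⟨ index X-listable x , i ⟩) , (λ i y → T ⟨ index Y-listable y , i ⟩) ,
      (λ {(x , y)} covered → subst₂ (λ x y → F x y ≡ zero) (element-index X-listable x)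
        (element-index Y-listable y) (proj₁ (covers _ _) covered)) ,
      (λ {(x , y)} F≡0 → proj₂ (covers _ _) (subst₂ (λ x y → F x y ≡ zero)
        (sym (element-index X-listable x)) (sym (element-index Y-listable y)) F≡0))

    coverable⇒table : ∀ {m} → Coverable F m → TableCoverable m
    coverable⇒table {m} (A , B , covers , covered) = decidable-stable (tableCoverable? m) λ ¬table →
      ¬¬-∀Fin (λ i → ¬¬-∀Fin λ p → ¬¬-excluded-middle {A = A i (x# p)}) λ A? →
      ¬¬-∀Fin (λ i → ¬¬-∀Fin λ q → ¬¬-excluded-middle {A = B i (y# q)}) λ B? →
      ¬table (table A? , table B? , λ p q →
        (λ (i , Sᵢ , Tᵢ) → covers (i , table⇒ A? p i Sᵢ , table⇒ B? q i Tᵢ)) ,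
        (λ F≡0 → let i , Ax , By = covered F≡0 in i , ⇒table A? p i Ax , ⇒table B? q i By))
      where
      module _ {n} {P : Fin m → Fin n → Set} (P? : ∀ i p → Dec (P i p)) where
        table : Table m n
        table = Vec.tabulate λ p → Vec.tabulate λ i → does (P? i p)
        lookup-table : ∀ p i → Vec.lookup (Vec.lookup table p) i ≡ does (P? i p)
        lookup-table p i = trans (cong (λ row → Vec.lookup row i) (lookup∘tabulate _ p)) (lookup∘tabulate _ i)
        table⇒ : ∀ p i → table ⟨ p , i ⟩ → P i p
        table⇒ p i eq with P? i p | trans (sym (lookup-table p i)) eq
        ... | yes Pip | _ = Pip
        ⇒table : ∀ p i → P i p → table ⟨ p , i ⟩
        ⇒table p i Pip = trans (lookup-table p i) (dec-true (P? i p) Pip)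

    -- One rectangle per row; this bounds the search for the least cover.
    rows-cover : Coverable F (size X-listable)
    rows-cover = (λ p x → x ≡ x# p) , (λ p y → F (x# p) y ≡ zero) ,
      (λ { (p , refl , F≡0) → F≡0 }) ,
      (λ {(x , y)} F≡0 → index X-listable x , sym (element-index X-listable x) ,
        subst (λ x → F x y ≡ zero) (sym (element-index X-listable x)) F≡0)

    coverNumber : ∃ (IsCoverNumber F)
    coverNumber with least tableCoverable? _ (coverable⇒table rows-cover)
    ... | k , coverable , minimal = k , table⇒coverable coverable , λ cov → minimal (coverable⇒table cov)

  module _ (G : Graph) where
    open Graph G using (adj?)

    private
      n : ℕ
      n = order G

    isClique? : ∀ x → Dec (IsClique G x)
    isClique? x = map′ (λ h {u} {v} → h u v) (λ h u v → h)
      (all? λ u → all? λ v → (u ∈? x) →-dec ((v ∈? x) →-dec (¬? (u ≟ v) →-dec adj? u v)))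

    isIndependent? : ∀ y → Dec (IsIndependent G y)
    isIndependent? y = map′ (λ h {u} {v} → h u v) (λ h u v → h)
      (all? λ u → all? λ v → (u ∈? y) →-dec ((v ∈? y) →-dec ¬? (adj? u v)))

    module _ {P : Subset n → Set} (P? : ∀ x → Dec (P x)) where

      refinements : Subset n → List (Refinement (Subset n) P)
      refinements x with P? x
      ... | yes Px = (x , [ Px ]) ∷ []
      ... | no  _  = []

      ∈-refinements : ∀ x .(Px : P x) → (x , [ Px ]) ∈ refinements x
      ∈-refinements x Px with P? x
      ... | yes _  = here refl
      ... | no ¬Px = contradiction-irr Px ¬Px

      refinement-listable : Listable (Refinement (Subset n) P)
      refinement-listable = concatMap refinements (vecs bools n) ,
        λ { (x , [ Px ]) → ∈-concat⁺′ (∈-refinements x Px) (∈-map⁺ refinements (∈-vecs ∈-bools x)) }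

    CIS-coverNumber : ∃ (IsCoverNumber (CIS G))
    CIS-coverNumber = coverNumber (refinement-listable isClique?) (refinement-listable isIndependent?) (CIS G)

-- The graph of an unambiguous DNF composed with a gadget.

module RectangleGraph where
  open import Data.Bool using (Bool; true; false)
  open import Data.Fin as Fin using (Fin; zero; suc; toℕ)
  open import Data.Fin.Properties using (*↔×; all?; toℕ-fromℕ<; toℕ-injective) renaming (_≟_ to _≟ᶠ_)
  open import Data.Fin.Subset using (Subset; _∩_; ∣_∣; ⁅_⁆; Empty) renaming (_∈_ to _∈ₛ_)
  open import Data.Fin.Subset.Properties using (Empty-unique; ∣⊥∣≡0; ∣⁅x⁆∣≡1; p⊆q⇒∣p∣≤∣q∣; x∈⁅y⁆⇒x≡y; x∈p∩q⁺; x∈p∩q⁻)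
  open import Data.Irrelevant using ([_])
  open import Data.List as List using (List; allFin)
  open import Data.List.Membership.Propositional using (_∈_)
  open import Data.List.Membership.Propositional.Properties using (∈-allFin)
  open import Data.Nat as ℕ using (ℕ; zero; suc)
  import Data.Nat.Properties as ℕ
  open import Data.Product using (∃; _×_; _,_; proj₁; proj₂; uncurry)
  open import Data.Product.Function.NonDependent.Propositional using (_×-↔_)
  open import Data.Refinement using (_,_)
  open import Data.Vec using (Vec; []; _∷_; lookup; tabulate; map; zipWith; replicate; uncons)
  open import Data.Vec.Properties using (lookup∘tabulate; lookup-map; lookup-zipWith; lookup⇒[]=; []=⇒lookup; lookup-replicate)
  open import Function using (_↔_; mk↔ₛ′; Inverse)
  open import Function.Properties.Inverse using (↔-sym; ↔-trans)
  open import Relation.Binary using (DecidableEquality)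
  open import Relation.Binary.PropositionalEquality
  open import Relation.Nullary using (¬_; Dec; yes; no; does; contradiction)
  open import Relation.Nullary.Decidable using (_×-dec_; _→-dec_; ¬?; dec-true; decidable-stable; ¬¬-excluded-middle)
  open import Defs
  open Sums using (vecs; ∈-vecs)
  open Lifting using (vec-ext)
  open CoverNumbers using (¬¬-∀Fin)

  Vec↔Fin : ∀ {A : Set} {a} → A ↔ Fin a → ∀ n → Vec A n ↔ Fin (a ℕ.^ n)
  Vec↔Fin A↔ zero    = mk↔ₛ′ (λ _ → zero) (λ _ → []) (λ { zero → refl }) (λ { [] → refl })
  Vec↔Fin A↔ (suc n) = ↔-trans
    (mk↔ₛ′ uncons (uncurry _∷_) (λ _ → refl) (λ { (a ∷ x) → refl }))
    (↔-trans (A↔ ×-↔ Vec↔Fin A↔ n) (↔-sym *↔×))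

  module _ {n : ℕ} {P : Fin n → Set} (P? : ∀ i → Dec (P i)) where

    subset : Subset n
    subset = tabulate λ i → does (P? i)

    ∈-subset⁺ : ∀ {i} → P i → i ∈ₛ subset
    ∈-subset⁺ {i} Pi = lookup⇒[]= i subset (trans (lookup∘tabulate _ i) (dec-true (P? i) Pi))

    ∈-subset⁻ : ∀ {i} → i ∈ₛ subset → P i
    ∈-subset⁻ {i} i∈ with P? i | trans (sym (lookup∘tabulate (λ i → does (P? i)) i)) ([]=⇒lookup i∈)
    ... | yes Pi | _ = Pi

  ∣p∣≡0⇒Empty : ∀ {n} (p : Subset n) → ∣ p ∣ ≡ 0 → Empty p
  ∣p∣≡0⇒Empty p ∣p∣≡0 (i , i∈p) = contradiction (begin
    1          ≡⟨ sym (∣⁅x⁆∣≡1 i) ⟩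
    ∣ ⁅ i ⁆ ∣  ≤⟨ p⊆q⇒∣p∣≤∣q∣ (λ j∈ → subst (_∈ₛ p) (sym (x∈⁅y⁆⇒x≡y i j∈)) i∈p) ⟩
    ∣ p ∣      ≡⟨ ∣p∣≡0 ⟩
    0          ∎) λ ()
    where open ℕ.≤-Reasoning

  module _ (G : Graph) {x y : Subset (order G)} .(c : IsClique G x) .(i : IsIndependent G y) where

    CIS≡0⇒Empty : CIS G (x , [ c ]) (y , [ i ]) ≡ zero → Empty (x ∩ y)
    CIS≡0⇒Empty eq = ∣p∣≡0⇒Empty (x ∩ y)
      (trans (sym (toℕ-fromℕ< (∣clique∩independent∣<2 G c i))) (cong toℕ eq))

    Empty⇒CIS≡0 : Empty (x ∩ y) → CIS G (x , [ c ]) (y , [ i ]) ≡ zero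
    Empty⇒CIS≡0 empty = toℕ-injective (trans (toℕ-fromℕ< (∣clique∩independent∣<2 G c i))
      (trans (cong ∣_∣ (Empty-unique empty)) (∣⊥∣≡0 (order G))))

  -- One index stands for all conjunctions on the same variables whose pattern it accepts. Conflicts
  -- are demanded only between distinct indices, since distinct patterns of one index disagree at a
  -- common variable anyway.
  record UnambiguousDNF (N : ℕ) : Set₁ where
    field
      terms       : ℕ
      width       : ℕ
      Term        : Set
      Term↔Fin    : Term ↔ Fin terms
      var         : Term → Fin width → Fin N
      Accepts     : Term → Vec Bool width → Set
      accepts?    : ∀ c p → Dec (Accepts c p)
      unambiguous : ∀ {c c′ p p′} → Accepts c p → Accepts c′ p′ →
        (∀ k l → var c k ≡ var c′ l → lookup p k ≡ lookup p′ l) → c ≡ c′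

    Satisfies : Vec Bool N → Set
    Satisfies z = ∃ λ c → Accepts c (tabulate λ k → lookup z (var c k))

  module _ {N : ℕ} (D : UnambiguousDNF N) {A : Set} (_≟_ : DecidableEquality A) {a : ℕ}
           (A↔Fin : A ↔ Fin a) (g : A → A → Bool) where
    open UnambiguousDNF D

    Vertex : Set
    Vertex = Term × Vec (A × A) width

    vertices : ℕ
    vertices = terms ℕ.* (a ℕ.* a) ℕ.^ width

    Vertex↔Fin : Vertex ↔ Fin vertices
    Vertex↔Fin = ↔-trans
      (Term↔Fin ×-↔ Vec↔Fin (↔-trans (A↔Fin ×-↔ A↔Fin) (↔-sym *↔×)) width) (↔-sym *↔×)

    vertex : Fin vertices → Vertex
    vertex = Inverse.from Vertex↔Fin

    vertex-injective : ∀ {i j} → vertex i ≡ vertex j → i ≡ j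
    vertex-injective {i} {j} eq = trans (sym (Inverse.strictlyInverseˡ Vertex↔Fin i))
      (trans (cong (Inverse.to Vertex↔Fin) eq) (Inverse.strictlyInverseˡ Vertex↔Fin j))

    Valid : Vertex → Set
    Valid (c , s) = Accepts c (map (uncurry g) s)

    valid? : ∀ u → Dec (Valid u)
    valid? (c , s) = accepts? c _

    SameRow : Vertex → Vertex → Set
    SameRow (c , s) (c′ , s′) =
      ∀ k l → var c k ≡ var c′ l → proj₁ (lookup s k) ≡ proj₁ (lookup s′ l)

    sameRow? : ∀ u v → Dec (SameRow u v)
    sameRow? (c , s) (c′ , s′) = all? λ k → all? λ l →
      (var c k ≟ᶠ var c′ l) →-dec (proj₁ (lookup s k) ≟ proj₁ (lookup s′ l))

    -- A vertex is the rectangle of gadget inputs read by an accepting term. Adjacent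
    -- rectangles share a row; since distinct rectangles are disjoint, those through
    -- a common column share none.
    graph : Graph
    graph = record
      { order  = vertices
      ; Adj    = λ i j → i ≢ j × (Valid (vertex i) × Valid (vertex j)) × SameRow (vertex i) (vertex j)
      ; adj?   = λ i j → ¬? (i ≟ᶠ j) ×-dec
                         ((valid? _ ×-dec valid? _) ×-dec sameRow? (vertex i) (vertex j))
      ; symm   = λ (i≢j , (Vi , Vj) , same) →
                 (λ j≡i → i≢j (sym j≡i)) , (Vj , Vi) , λ k l eq → sym (same l k (sym eq))
      ; irrefl = λ (i≢i , _) → i≢i refl
      }

    Consistent : (A × A → A) → Vec A N → Vertex → Set
    Consistent side x u@(c , s) = Valid u × (∀ k → side (lookup s k) ≡ lookup x (var c k))

    consistent? : ∀ side x u → Dec (Consistent side x u)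
    consistent? side x u = valid? u ×-dec all? λ k → _ ≟ _

    vertexSet : (A × A → A) → Vec A N → Subset vertices
    vertexSet side x = subset λ i → consistent? side x (vertex i)

    isClique : ∀ x → IsClique graph (vertexSet proj₁ x)
    isClique x {i} {j} i∈ j∈ i≢j
      with ∈-subset⁻ (λ i → consistent? proj₁ x (vertex i)) i∈
         | ∈-subset⁻ (λ i → consistent? proj₁ x (vertex i)) j∈
    ... | Vi , xi | Vj , xj =
      i≢j , (Vi , Vj) , λ k l eq → trans (xi k) (trans (cong (lookup x) eq) (sym (xj l)))

    -- Equal rows and a common column give equal gadget outputs at shared variables, so the terms
    -- coincide by `unambiguous`, and then the letters do.
    same-vertex : ∀ y u v → Consistent proj₂ y u → Consistent proj₂ y v → SameRow u v → u ≡ v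
    same-vertex y (c , s) (c′ , s′) (Vu , yu) (Vv , yv) same with
      unambiguous Vu Vv (λ k l eq → trans (lookup-map k (uncurry g) s) (trans
        (cong₂ g (same k l eq) (trans (yu k) (trans (cong (lookup y) eq) (sym (yv l)))))
        (sym (lookup-map l (uncurry g) s′))))
    ... | refl = cong (c ,_) (vec-ext λ k → cong₂ _,_ (same k k refl) (trans (yu k) (sym (yv k))))

    isIndependent : ∀ y → IsIndependent graph (vertexSet proj₂ y)
    isIndependent y {i} {j} i∈ j∈ (i≢j , _ , same) =
      i≢j (vertex-injective (same-vertex y (vertex i) (vertex j)
        (∈-subset⁻ (λ i → consistent? proj₂ y (vertex i)) i∈)
        (∈-subset⁻ (λ i → consistent? proj₂ y (vertex i)) j∈) same))

    clique : Vec A N → Clique graph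
    clique x = vertexSet proj₁ x , [ isClique x ]

    independentSet : Vec A N → IndependentSet graph
    independentSet y = vertexSet proj₂ y , [ isIndependent y ]

    CIS≡0⇒¬Satisfies : ∀ x y → CIS graph (clique x) (independentSet y) ≡ zero →
                       ¬ Satisfies (zipWith g x y)
    CIS≡0⇒¬Satisfies x y eq (c , acc) =
      CIS≡0⇒Empty graph (isClique x) (isIndependent y) eq (Inverse.to Vertex↔Fin u , x∈p∩q⁺
        ( ∈-subset⁺ (λ i → consistent? proj₁ x (vertex i)) (subst (Consistent proj₁ x) (sym u≡)
            (valid , λ k → cong proj₁ (lookup∘tabulate _ k)))
        , ∈-subset⁺ (λ i → consistent? proj₂ y (vertex i)) (subst (Consistent proj₂ y) (sym u≡)
            (valid , λ k → cong proj₂ (lookup∘tabulate _ k)))))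
      where
      s : Vec (A × A) width
      s = tabulate λ k → lookup x (var c k) , lookup y (var c k)
      u : Vertex
      u = c , s
      u≡ : vertex (Inverse.to Vertex↔Fin u) ≡ u
      u≡ = Inverse.strictlyInverseʳ Vertex↔Fin u
      valid : Valid u
      valid = subst (Accepts c) (vec-ext λ k → trans (lookup∘tabulate _ k)
        (trans (lookup-zipWith g (var c k) x y) (sym (trans (lookup-map k (uncurry g) s)
          (cong (uncurry g) (lookup∘tabulate _ k)))))) acc

    ¬Satisfies⇒CIS≡0 : ∀ x y → ¬ Satisfies (zipWith g x y) →
                       CIS graph (clique x) (independentSet y) ≡ zero
    ¬Satisfies⇒CIS≡0 x y ¬sat = Empty⇒CIS≡0 graph (isClique x) (isIndependent y) λ (i , i∈) →
      let i∈x , i∈y = x∈p∩q⁻ (vertexSet proj₁ x) (vertexSet proj₂ y) i∈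
      in satisfied (vertex i) (∈-subset⁻ (λ i → consistent? proj₁ x (vertex i)) i∈x)
                              (∈-subset⁻ (λ i → consistent? proj₂ y (vertex i)) i∈y)
      where
      satisfied : ∀ u → Consistent proj₁ x u → ¬ Consistent proj₂ y u
      satisfied (c , s) (Vu , xu) (_ , yu) = ¬sat (c , subst (Accepts c) (vec-ext λ k →
        trans (lookup-map k (uncurry g) s) (sym (trans (lookup∘tabulate _ k)
          (trans (lookup-zipWith g (var c k) x y) (sym (cong₂ g (xu k) (yu k))))))) Vu)

    module _ (as : List A) (∈as : ∀ a → a ∈ as) (a₀ : A) where
      open import Data.Integer hiding (suc; pred; _≟_)
      import Data.Integer as ℤ
      open import Data.Integer.Properties hiding (_≟_)
      open Sums
      open Weights
      open Lifting

      module _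
        (Σδ : ∀ b → Σ[ a ← as ] Kronecker.δ _≟_ a b ≡ 1ℤ)
        (orthogonal : ∀ b b′ → Σ[ a ← as ] sgn (g a b) * sgn (g a b′) ≡
                               Kronecker.μ _≟_ as Σδ * Kronecker.δ _≟_ b b′)
        (r : ℤ) (0<μ : 0ℤ < Kronecker.μ _≟_ as Σδ)
        (0<ζ : 0ℤ < ζ _≟_ as ∈as a₀ Σδ g orthogonal) (0<r : 0ℤ < r)
        (large : Kronecker.μ _≟_ as Σδ * (+ 2 * Kronecker.μ _≟_ as Σδ * (+ 2 * Kronecker.μ _≟_ as Σδ)) *
                 (r * r) ≤ ζ _≟_ as ∈as a₀ Σδ g orthogonal * ζ _≟_ as ∈as a₀ Σδ g orthogonal)
        (bernoulli : ∏ {N} (λ _ → 1ℤ + r) < ∏ {N} (λ _ → r) + ∏ {N} (λ _ → r))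
        (κ : ℤ) (0<κ : 0ℤ < κ)
        (¬sat-0 : ¬ Satisfies (replicate N false))
        (hard : ∀ d → pow d (+ 2) < κ →
                ∃ λ z → Satisfies z × (∀ i → lookup d i ≡ true → lookup z i ≡ false)) where

        private
          ζ₀ : ℤ
          ζ₀ = ζ _≟_ as ∈as a₀ Σδ g orthogonal

          V : List (Vec A N)
          V = vecs as N

          avoid₀ : Vec A N → Vec A N → ℤ
          avoid₀ = avoid _≟_ as ∈as a₀ Σδ g orthogonal

        module _ {m : ℕ} (P Q : Fin m → Vec A N → Bool)
          (sound : ∀ i {x y} → P i x ≡ true → Q i y ≡ true → ¬ Satisfies (zipWith g x y))
          (complete : ∀ {x y} → ¬ Satisfies (zipWith g x y) → ∃ λ i → P i x ≡ true × Q i y ≡ true) where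

          private
            -- If all gadgets output `false`, the DNF is false by `¬sat-0`, so one of the rectangles
            -- contains the input.
            covered : ∀ x y → avoid₀ x y ≤ Σ[ i ← allFin m ] ⟦ P i x ⟧ * ⟦ Q i y ⟧ * avoid₀ x y
            covered x y with avoid₀ x y ℤ.≟ 0ℤ
            ... | yes eq = subst (λ t → t ≤ Σ[ i ← allFin m ] ⟦ P i x ⟧ * ⟦ Q i y ⟧ * t) (sym eq)
              (Σ-nonNeg (allFin m) λ i → ≤-reflexive (sym (*-zeroʳ (⟦ P i x ⟧ * ⟦ Q i y ⟧))))
            ... | no neq = subst (_≤ Σ[ i ← allFin m ] ⟦ P i x ⟧ * ⟦ Q i y ⟧ * avoid₀ x y)
              (trans (cong₂ (λ a b → ⟦ a ⟧ * ⟦ b ⟧ * avoid₀ x y) (proj₁ (proj₂ i∋)) (proj₂ (proj₂ i∋)))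
                     (*-identityˡ (avoid₀ x y)))
              (∈⇒≤Σ {f = λ i → ⟦ P i x ⟧ * ⟦ Q i y ⟧ * avoid₀ x y}
                (λ i → *-nonNeg (*-nonNeg (⟦⟧-nonNeg (P i x)) (⟦⟧-nonNeg (Q i y)))
                                (avoid-nonNeg _≟_ as ∈as a₀ Σδ g orthogonal x y))
                (∈-allFin (proj₁ i∋)))
              where
              all-false : zipWith g x y ≡ replicate N false
              all-false = vec-ext λ i → trans (lookup-zipWith g i x y) (trans
                (unset⇒false _ λ eq → neq (∏-zero i eq)) (sym (lookup-replicate i false)))
              i∋ : ∃ λ i → P i x ≡ true × Q i y ≡ true
              i∋ = complete (subst (λ z → ¬ Satisfies z) (sym all-false) ¬sat-0)

          -- Union bound: there are ζ^N inputs with all outputs `false`, and each rectangle contains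
          -- at most a 1 / κ fraction of them.
          many-rectangles : κ ≤ + m
          many-rectangles = *-cancelˡ (∏-pos {N} λ _ → 0<ζ) (begin
            ∏ {N} (λ _ → ζ₀) * κ
              ≡⟨ *-comm (∏ {N} λ _ → ζ₀) κ ⟩
            κ * ∏ {N} (λ _ → ζ₀)
              ≡⟨ cong (κ *_) (sym (Σavoid _≟_ as ∈as a₀ Σδ g orthogonal N)) ⟩
            κ * (Σ[ x ← V ] Σ[ y ← V ] avoid₀ x y)
              ≤⟨ *-monoˡ (<⇒≤ 0<κ) (Σ-mono V λ x → Σ-mono V λ y → covered x y) ⟩
            κ * (Σ[ x ← V ] Σ[ y ← V ] Σ[ i ← allFin m ] ⟦ P i x ⟧ * ⟦ Q i y ⟧ * avoid₀ x y)
              ≡⟨ cong (κ *_) (trans (Σ-cong V λ x → Σ-swap V (allFin m) _) (Σ-swap V (allFin m) _)) ⟩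
            κ * (Σ[ i ← allFin m ] mass₀ i)
              ≡⟨ sym (Σ-*ˡ (allFin m) κ mass₀) ⟩
            Σ[ i ← allFin m ] κ * mass₀ i
              ≤⟨ Σ-mono (allFin m) (λ i → rectangle-light _≟_ as ∈as a₀ Σδ g orthogonal r 0<μ 0<ζ 0<r large
                   bernoulli (P i) (Q i) Satisfies (sound i) κ 0<κ hard) ⟩
            Σ[ i ← allFin m ] ∏ {N} (λ _ → ζ₀)
              ≡⟨ trans (Σ-allFin-const m _) (*-comm (+ m) _) ⟩
            ∏ {N} (λ _ → ζ₀) * + m ∎)
            where
            open ≤-Reasoning
            mass₀ : Fin m → ℤ
            mass₀ i = mass _≟_ as ∈as a₀ Σδ g orthogonal (P i) (Q i)

        -- The comparison of κ with m is decidable, so membership in each rectangle may be taken as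
        -- decided on the finitely many inputs that come from vectors of letters.
        coverable⇒≤ : ∀ {m} → Coverable (CIS graph) m → κ ≤ + m
        coverable⇒≤ {m} (R , C , sound , complete) = decidable-stable (κ ≤? + m) λ κ≰m →
          ¬¬-∀Fin (λ i → ¬¬-∀Vec λ x → ¬¬-excluded-middle {A = R i (clique x)}) λ R? →
          ¬¬-∀Fin (λ i → ¬¬-∀Vec λ y → ¬¬-excluded-middle {A = C i (independentSet y)}) λ C? →
          κ≰m (many-rectangles (λ i x → does (R? i x)) (λ i y → does (C? i y))
            (λ i {x} {y} Rx Cy → CIS≡0⇒¬Satisfies x y (sound (i , from-does (R? i x) Rx , from-does (C? i y) Cy)))
            (λ {x} {y} ¬sat → let i , Rx , Cy = complete (¬Satisfies⇒CIS≡0 x y ¬sat)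
                              in i , dec-true (R? i x) Rx , dec-true (C? i y) Cy))
          where
          from-does : ∀ {P : Set} (P? : Dec P) → does P? ≡ true → P
          from-does (yes p) _ = p
          V↔ : Vec A N ↔ Fin (a ℕ.^ N)
          V↔ = Vec↔Fin A↔Fin N
          ¬¬-∀Vec : ∀ {P : Vec A N → Set} → (∀ x → ¬ ¬ P x) → ¬ ¬ (∀ x → P x)
          ¬¬-∀Vec {P} ¬¬P ¬∀ = ¬¬-∀Fin (λ i → ¬¬P (Inverse.from V↔ i)) λ P∘from →
            ¬∀ λ x → subst P (Inverse.strictlyInverseʳ V↔ x) (P∘from (Inverse.to V↔ x))

-- Bernoulli inequalities for natural numbers.

module Bernoulli where
  open import Data.Nat
  open import Data.Nat.Properties
  open import Data.Nat.Tactic.RingSolver using (solve-∀)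
  open import Relation.Binary.PropositionalEquality

  -- (1 + 1/r)^j ≤ 1/(1 - j/r) with denominators cleared.
  bernoulli : ∀ r j k → j + k ≡ r → (1 + r) ^ j * k ≤ r ^ j * r
  bernoulli r zero    k refl = ≤-refl
  bernoulli r (suc j) k eq   = begin
    (1 + r) * (1 + r) ^ j * k   ≡⟨ lem₁ r ((1 + r) ^ j) k ⟩
    (1 + r) ^ j * (k + r * k)   ≤⟨ *-monoʳ-≤ ((1 + r) ^ j) (+-monoˡ-≤ (r * k) (m+n≤o⇒n≤o (suc j) (≤-reflexive eq))) ⟩
    (1 + r) ^ j * (r + r * k)   ≡⟨ lem₂ r ((1 + r) ^ j) k ⟩
    r * ((1 + r) ^ j * suc k)   ≤⟨ *-monoʳ-≤ r (bernoulli r j (suc k) (trans (+-suc j k) eq)) ⟩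
    r * (r ^ j * r)             ≡⟨ sym (*-assoc r (r ^ j) r) ⟩
    r * r ^ j * r               ∎
    where
    open ≤-Reasoning
    lem₁ : ∀ r p k → (1 + r) * p * k ≡ p * (k + r * k)
    lem₁ = solve-∀
    lem₂ : ∀ r p k → p * (r + r * k) ≡ r * (p * (1 + k))
    lem₂ = solve-∀

  -- The case k = j of `bernoulli`, where r / k = 2.
  bernoulli-half : ∀ j → (1 + (j + j)) ^ j ≤ 2 * (j + j) ^ j
  bernoulli-half zero      = s≤s z≤n
  bernoulli-half j@(suc _) = *-cancelʳ-≤ _ _ j (begin
    (1 + (j + j)) ^ j * j      ≤⟨ bernoulli (j + j) j j refl ⟩
    (j + j) ^ j * (j + j)      ≡⟨ lem ((j + j) ^ j) j ⟩
    2 * (j + j) ^ j * j        ∎)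
    where
    open ≤-Reasoning
    lem : ∀ p j → p * (j + j) ≡ 2 * p * j
    lem = solve-∀

  -- Here k = r - n exceeds r / 2, so the bound r / k of `bernoulli` is below 2.
  bernoulli-strict : ∀ r n → n + n < r → (1 + r) ^ n < r ^ n + r ^ n
  bernoulli-strict r n 2n<r = *-cancelʳ-< r _ _ (begin-strict
    (1 + r) ^ n * r            <⟨ *-monoʳ-< ((1 + r) ^ n) {{m^n≢0 (1 + r) n}} r<2k ⟩
    (1 + r) ^ n * (k + k)      ≡⟨ *-distribˡ-+ ((1 + r) ^ n) k k ⟩
    (1 + r) ^ n * k + (1 + r) ^ n * k
                               ≤⟨ +-mono-≤ (bernoulli r n k n+k≡r) (bernoulli r n k n+k≡r) ⟩
    r ^ n * r + r ^ n * r      ≡⟨ sym (*-distribʳ-+ r (r ^ n) (r ^ n)) ⟩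
    (r ^ n + r ^ n) * r        ∎)
    where
    open ≤-Reasoning
    k = r ∸ n
    n+k≡r : n + k ≡ r
    n+k≡r = m+[n∸m]≡n (<⇒≤ (m+n≤o⇒n≤o n (≤-trans (≤-reflexive (+-suc n n)) 2n<r)))
    r<2k : r < k + k
    r<2k = subst (_< k + k) n+k≡r (+-monoˡ-< k (+-cancelˡ-< n n k (subst (n + n <_) (sym n+k≡r) 2n<r)))

-- The inner product gadget.

module InnerProduct where
  open import Data.Bool using (Bool; true; false; _∧_; _xor_)
  import Data.Bool.Properties as Bool
  open import Data.Integer hiding (suc; pred; _≟_; _^_; _⊔_; _⊓_)
  open import Data.Integer.Properties hiding (_≟_)
  open import Data.Integer.Tactic.RingSolver using (solve-∀)
  open import Data.List using (List)
  open import Data.List.Membership.Propositional using (_∈_)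
  open import Data.Nat as ℕ using (ℕ; zero; suc; _^_)
  import Data.Nat.Properties as ℕ
  open import Data.Vec using (Vec; []; _∷_)
  open import Data.Vec.Properties using (≡-dec)
  open import Relation.Binary using (DecidableEquality)
  open import Relation.Binary.PropositionalEquality
  open import Relation.Nullary using (yes; no)
  open Sums
  open Weights
  open Lifting using (sgn; unset; ζ)

  Letter : ℕ → Set
  Letter = Vec Bool

  _≟_ : ∀ {τ} → DecidableEquality (Letter τ)
  _≟_ = ≡-dec Bool._≟_

  letters : ∀ τ → List (Letter τ)
  letters = vecs bools

  ∈-letters : ∀ {τ} (a : Letter τ) → a ∈ letters τ
  ∈-letters = ∈-vecs ∈-bools

  _·_ : ∀ {τ} → Letter τ → Letter τ → Bool
  []      · []      = false
  (a ∷ x) · (b ∷ y) = (a ∧ b) xor (x · y)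

  private
    δ : ∀ {τ} → Letter τ → Letter τ → ℤ
    δ = Kronecker.δ _≟_

    δ₁ : Bool → Bool → ℤ
    δ₁ = Kronecker.δ Bool._≟_

    δ-∷ : ∀ {τ} a b (x y : Letter τ) → δ (a ∷ x) (b ∷ y) ≡ δ₁ a b * δ x y
    δ-∷ true  true  x y with x ≟ y
    ... | yes _ = refl
    ... | no  _ = refl
    δ-∷ false false x y with x ≟ y
    ... | yes _ = refl
    ... | no  _ = refl
    δ-∷ true  false x y = refl
    δ-∷ false true  x y = refl

    sgn-xor : ∀ a b → sgn (a xor b) ≡ sgn a * sgn b
    sgn-xor true  true  = refl
    sgn-xor true  false = refl
    sgn-xor false true  = refl
    sgn-xor false false = refl

  Σδ : ∀ {τ} (b : Letter τ) → Σ[ a ← letters τ ] δ a b ≡ 1ℤ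
  Σδ []              = refl
  Σδ {suc τ} (b ∷ y) = begin
    Σ[ a ← letters (suc τ) ] δ a (b ∷ y)
      ≡⟨ Σ-vecs bools τ _ ⟩
    Σ[ a ← bools ] Σ[ x ← letters τ ] δ (a ∷ x) (b ∷ y)
      ≡⟨ Σ-cong bools (λ a → Σ-cong (letters τ) λ x → δ-∷ a b x y) ⟩
    Σ[ a ← bools ] Σ[ x ← letters τ ] δ₁ a b * δ x y
      ≡⟨ sym (Σ-*Σ bools (letters τ) (λ a → δ₁ a b) (λ x → δ x y)) ⟩
    (Σ[ a ← bools ] δ₁ a b) * (Σ[ x ← letters τ ] δ x y)
      ≡⟨ cong₂ _*_ (Σδ₁ b) (Σδ y) ⟩
    1ℤ ∎
    where
    open ≡-Reasoning
    Σδ₁ : ∀ b → Σ[ a ← bools ] δ₁ a b ≡ 1ℤ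
    Σδ₁ true  = refl
    Σδ₁ false = refl

  μ : ℕ → ℤ
  μ τ = Kronecker.μ _≟_ (letters τ) Σδ

  μ≡ : ∀ τ → μ τ ≡ + (2 ^ τ)
  μ≡ zero    = refl
  μ≡ (suc τ) = begin
    μ (suc τ)                              ≡⟨ Σ-vecs bools τ _ ⟩
    μ τ + (μ τ + 0ℤ)                       ≡⟨ cong (λ m → m + (m + 0ℤ)) (μ≡ τ) ⟩
    + (2 ^ τ ℕ.+ (2 ^ τ ℕ.+ 0))            ∎
    where open ≡-Reasoning

  -- The signs form Sylvester's Hadamard matrix, a tensor power of the 2 × 2 one, so the sum factors
  -- over the bits.
  orthogonal : ∀ {τ} (b b′ : Letter τ) →
               Σ[ a ← letters τ ] sgn (a · b) * sgn (a · b′) ≡ μ τ * δ b b′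
  orthogonal []       []         = refl
  orthogonal {suc τ} (b ∷ y) (b′ ∷ y′) = begin
    Σ[ a ← letters (suc τ) ] sgn (a · (b ∷ y)) * sgn (a · (b′ ∷ y′))
      ≡⟨ Σ-vecs bools τ _ ⟩
    Σ[ a ← bools ] Σ[ x ← letters τ ] sgn ((a ∧ b) xor (x · y)) * sgn ((a ∧ b′) xor (x · y′))
      ≡⟨ Σ-cong bools (λ a → Σ-cong (letters τ) λ x → trans
           (cong₂ _*_ (sgn-xor (a ∧ b) (x · y)) (sgn-xor (a ∧ b′) (x · y′)))
           (lem (sgn (a ∧ b)) (sgn (x · y)) (sgn (a ∧ b′)) (sgn (x · y′)))) ⟩
    Σ[ a ← bools ] Σ[ x ← letters τ ] sgn (a ∧ b) * sgn (a ∧ b′) * (sgn (x · y) * sgn (x · y′))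
      ≡⟨ sym (Σ-*Σ bools (letters τ) (λ a → sgn (a ∧ b) * sgn (a ∧ b′)) (λ x → sgn (x · y) * sgn (x · y′))) ⟩
    (Σ[ a ← bools ] sgn (a ∧ b) * sgn (a ∧ b′)) * (Σ[ x ← letters τ ] sgn (x · y) * sgn (x · y′))
      ≡⟨ cong₂ _*_ (orthogonal₁ b b′) (orthogonal y y′) ⟩
    + 2 * δ₁ b b′ * (μ τ * δ y y′)
      ≡⟨ lem (+ 2) (δ₁ b b′) (μ τ) (δ y y′) ⟩
    + 2 * μ τ * (δ₁ b b′ * δ y y′)
      ≡⟨ cong₂ _*_ (sym (trans (Σ-vecs bools τ (λ _ → 1ℤ)) (double (μ τ)))) (sym (δ-∷ b b′ y y′)) ⟩
    μ (suc τ) * δ (b ∷ y) (b′ ∷ y′) ∎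
    where
    open ≡-Reasoning
    lem : ∀ a b c d → a * b * (c * d) ≡ a * c * (b * d)
    lem = solve-∀
    double : ∀ m → m + (m + 0ℤ) ≡ + 2 * m
    double = solve-∀
    orthogonal₁ : ∀ b b′ → Σ[ a ← bools ] sgn (a ∧ b) * sgn (a ∧ b′) ≡ + 2 * δ₁ b b′
    orthogonal₁ true  true  = refl
    orthogonal₁ true  false = refl
    orthogonal₁ false true  = refl
    orthogonal₁ false false = refl

  zeros : ℕ → ℤ
  zeros τ = ζ _≟_ (letters τ) ∈-letters (Data.Vec.replicate τ false) Σδ _·_ orthogonal

  private
    Σsgn : ℕ → ℤ
    Σsgn τ = Σ[ x ← letters τ ] Σ[ y ← letters τ ] sgn (x · y)

    Σsgn≡ : ∀ τ → Σsgn τ ≡ + (2 ^ τ)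
    Σsgn≡ zero    = refl
    Σsgn≡ (suc τ) = begin
      Σsgn (suc τ)
        ≡⟨ trans (Σ-vecs bools τ _) (Σ-cong bools λ a → Σ-cong (letters τ) λ x →
             Σ-vecs bools τ (λ y → sgn ((a ∷ x) · y))) ⟩
      Σ[ a ← bools ] Σ[ x ← letters τ ] Σ[ b ← bools ] Σ[ y ← letters τ ] sgn ((a ∧ b) xor (x · y))
        ≡⟨ Σ-cong bools (λ a → trans (Σ-swap (letters τ) bools
             (λ x b → Σ[ y ← letters τ ] sgn ((a ∧ b) xor (x · y)))) (Σ-cong bools λ b →
             trans (Σ-cong (letters τ) λ x → trans (Σ-cong (letters τ) λ y → sgn-xor (a ∧ b) (x · y))
                                                 (Σ-*ˡ (letters τ) (sgn (a ∧ b)) (λ y → sgn (x · y))))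
                   (Σ-*ˡ (letters τ) (sgn (a ∧ b)) (λ x → Σ[ y ← letters τ ] sgn (x · y))))) ⟩
      Σ[ a ← bools ] Σ[ b ← bools ] sgn (a ∧ b) * Σsgn τ
        ≡⟨ lem (Σsgn τ) ⟩
      Σsgn τ + Σsgn τ
        ≡⟨ cong (λ s → s + s) (Σsgn≡ τ) ⟩
      + (2 ^ τ ℕ.+ 2 ^ τ)
        ≡⟨ cong (λ m → + (2 ^ τ ℕ.+ m)) (sym (ℕ.+-identityʳ (2 ^ τ))) ⟩
      + (2 ^ suc τ) ∎
      where
      open ≡-Reasoning
      lem : ∀ s → -1ℤ * s + (1ℤ * s + 0ℤ) + ((1ℤ * s + (1ℤ * s + 0ℤ)) + 0ℤ) ≡ s + s
      lem = solve-∀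

  -- Since 1 + sgn = 2 `unset` and the signs add up to 2^τ ≥ 0, at least half of all pairs have
  -- output `false`.
  zeros-large : ∀ τ → μ τ * μ τ ≤ + 2 * zeros τ
  zeros-large τ = begin
    μ τ * μ τ
      ≡⟨ Σ-*Σ (letters τ) (letters τ) (λ _ → 1ℤ) (λ _ → 1ℤ) ⟩
    Ones
      ≡⟨ sym (+-identityʳ Ones) ⟩
    Ones + 0ℤ
      ≤⟨ +-monoʳ-≤ Ones (subst (0ℤ ≤_) (sym (Σsgn≡ τ)) (+≤+ ℕ.z≤n)) ⟩
    Ones + Σsgn τ
      ≡⟨ sym (trans (Σ-cong (letters τ) λ x → Σ-+ (letters τ) (λ _ → 1ℤ) (λ y → sgn (x · y)))
                    (Σ-+ (letters τ) (λ x → Σ[ y ← letters τ ] 1ℤ) (λ x → Σ[ y ← letters τ ] sgn (x · y)))) ⟩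
    Σ[ x ← letters τ ] Σ[ y ← letters τ ] (1ℤ + sgn (x · y))
      ≡⟨ Σ-cong (letters τ) (λ x → Σ-cong (letters τ) λ y → lem (x · y)) ⟩
    Σ[ x ← letters τ ] Σ[ y ← letters τ ] + 2 * unset (x · y)
      ≡⟨ trans (Σ-cong (letters τ) λ x → Σ-*ˡ (letters τ) (+ 2) (λ y → unset (x · y)))
               (Σ-*ˡ (letters τ) (+ 2) (λ x → Σ[ y ← letters τ ] unset (x · y))) ⟩
    + 2 * zeros τ ∎
    where
    open ≤-Reasoning
    Ones : ℤ
    Ones = Σ[ x ← letters τ ] Σ[ y ← letters τ ] 1ℤ * 1ℤ
    lem : ∀ b → 1ℤ + sgn b ≡ + 2 * unset b
    lem true  = refl
    lem false = refl

  μ-pos : ∀ τ → 0ℤ < μ τ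
  μ-pos τ = subst (0ℤ <_) (sym (μ≡ τ)) (+<+ (ℕ.m^n>0 2 τ))

  zeros-pos : ∀ τ → 0ℤ < zeros τ
  zeros-pos τ = *-cancelˡ-<-nonNeg (+ 2) (<-≤-trans (*-pos (μ-pos τ) (μ-pos τ)) (zeros-large τ))

  module _ (ρ : ℕ) where
    private
      τ : ℕ
      τ = 4 ℕ.+ (ρ ℕ.+ ρ)

      r : ℤ
      r = + (2 ^ ρ)

      μ≡16r² : μ τ ≡ + 16 * (r * r)
      μ≡16r² = begin
        μ τ                                  ≡⟨ μ≡ τ ⟩
        + (2 ^ τ)                            ≡⟨ cong +_ (ℕ.^-distribˡ-+-* 2 4 (ρ ℕ.+ ρ)) ⟩
        + (16 ℕ.* 2 ^ (ρ ℕ.+ ρ))             ≡⟨ cong (λ p → + (16 ℕ.* p)) (ℕ.^-distribˡ-+-* 2 ρ ρ) ⟩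
        + (16 ℕ.* (2 ^ ρ ℕ.* 2 ^ ρ))         ≡⟨ pos-* 16 (2 ^ ρ ℕ.* 2 ^ ρ) ⟩
        + 16 * + (2 ^ ρ ℕ.* 2 ^ ρ)           ≡⟨ cong (+ 16 *_) (pos-* (2 ^ ρ) (2 ^ ρ)) ⟩
        + 16 * (r * r)                       ∎
        where open ≡-Reasoning

    -- As ζ ≥ μ² / 2, the requirement 4 μ³ r² ≤ ζ² follows from 16 r² ≤ μ; the length τ = 4 + 2 ρ
    -- makes this an equality for r = 2^ρ.
    spectral-gap : μ τ * (+ 2 * μ τ * (+ 2 * μ τ)) * (r * r) ≤ zeros τ * zeros τ
    spectral-gap = *-cancelˡ {+ 4} (+<+ (ℕ.s≤s ℕ.z≤n)) (begin
      + 4 * (μ τ * (+ 2 * μ τ * (+ 2 * μ τ)) * (r * r))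
        ≡⟨ lem₁ (μ τ) r ⟩
      μ τ * μ τ * (μ τ * (+ 16 * (r * r)))
        ≡⟨ cong (λ m → μ τ * μ τ * (μ τ * m)) (sym μ≡16r²) ⟩
      μ τ * μ τ * (μ τ * μ τ)
        ≤⟨ *-mono 0≤μ² (≤-trans 0≤μ² (zeros-large τ)) (zeros-large τ) (zeros-large τ) ⟩
      + 2 * zeros τ * (+ 2 * zeros τ)
        ≡⟨ lem₂ (zeros τ) ⟩
      + 4 * (zeros τ * zeros τ) ∎)
      where
      open ≤-Reasoning
      0≤μ² : 0ℤ ≤ μ τ * μ τ
      0≤μ² = square-nonNeg (μ τ)
      lem₁ : ∀ m r → + 4 * (m * (+ 2 * m * (+ 2 * m)) * (r * r)) ≡ m * m * (m * (+ 16 * (r * r)))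
      lem₁ = solve-∀
      lem₂ : ∀ z → + 2 * z * (+ 2 * z) ≡ + 4 * (z * z)
      lem₂ = solve-∀

-- The cover bound for the inner product gadget.

module LowerBound where
  open import Data.Bool using (Bool; true; false)
  open import Data.Fin.Properties using (2↔Bool)
  open import Data.Fin.Subset using (∣_∣)
  open import Data.Integer as ℤ using (+_; 1ℤ)
  import Data.Integer.Properties as ℤ
  open import Data.Nat using (ℕ; zero; suc; _+_; _*_; _^_; _≤_; _<_)
  open import Data.Nat.Properties using (m^n>0; ^-monoʳ-≤; ≰⇒>; <⇒≱)
  open import Data.Product using (∃; _×_)
  open import Data.Vec using (Vec; []; _∷_; lookup; replicate)
  open import Function.Properties.Inverse using (↔-sym)
  open import Relation.Binary.PropositionalEquality
  open import Relation.Nullary using (¬_)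
  open import Defs
  open Sums using (∏; ∏-const)
  open Weights using (pow)
  open RectangleGraph
  open Bernoulli
  open InnerProduct

  pow-2 : ∀ {n} (d : Vec Bool n) → pow d (+ 2) ≡ + (2 ^ ∣ d ∣)
  pow-2 []          = refl
  pow-2 (true ∷ d)  = trans (cong (+ 2 ℤ.*_) (pow-2 d)) (sym (ℤ.pos-* 2 (2 ^ ∣ d ∣)))
  pow-2 (false ∷ d) = trans (cong (1ℤ ℤ.*_) (pow-2 d)) (ℤ.*-identityˡ _)

  ∏-pos-const : ∀ n c → ∏ {n} (λ _ → + c) ≡ + (c ^ n)
  ∏-pos-const zero    c = refl
  ∏-pos-const (suc n) c = trans (cong (+ c ℤ.*_) (∏-pos-const n c)) (sym (ℤ.pos-* c (c ^ n)))

  module _ {N : ℕ} (D : UnambiguousDNF N) (ρ : ℕ) (N-small : N + N < 2 ^ ρ) where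
    open UnambiguousDNF D

    private
      τ : ℕ
      τ = 4 + (ρ + ρ)

    cisGraph : Graph
    cisGraph = graph D _≟_ (Vec↔Fin (↔-sym 2↔Bool) τ) _·_

    -- Here κ = 2^K, so the masks with 2^|d| < κ are those of fewer than K coordinates. The choice r
    -- = 2^ρ > 2 N gives the required (1 + 1/r)^N < 2.
    coverable⇒2^K≤ : ∀ K → ¬ Satisfies (replicate N false) →
      (∀ (d : Vec Bool N) → ∣ d ∣ < K →
        ∃ λ z → Satisfies z × (∀ i → lookup d i ≡ true → lookup z i ≡ false)) →
      ∀ {m} → Coverable (CIS cisGraph) m → 2 ^ K ≤ m
    coverable⇒2^K≤ K ¬sat hard cov = ℤ.drop‿+≤+ (coverable⇒≤ D _≟_ (Vec↔Fin (↔-sym 2↔Bool) τ) _·_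
      (letters τ) ∈-letters (replicate τ false) Σδ orthogonal (+ (2 ^ ρ)) (μ-pos τ) (zeros-pos τ)
      (ℤ.+<+ (m^n>0 2 ρ)) (spectral-gap ρ) bern (+ (2 ^ K)) (ℤ.+<+ (m^n>0 2 K)) ¬sat
      (λ d small → hard d (≰⇒> λ K≤ → <⇒≱ (ℤ.drop‿+<+ (subst (ℤ._< + (2 ^ K)) (pow-2 d) small))
                                         (^-monoʳ-≤ 2 K≤)))
      cov)
      where
      bern : ∏ {N} (λ _ → 1ℤ ℤ.+ + (2 ^ ρ)) ℤ.< ∏ {N} (λ _ → + (2 ^ ρ)) ℤ.+ ∏ {N} (λ _ → + (2 ^ ρ))
      bern = subst₂ ℤ._<_ (sym (∏-pos-const N (1 + 2 ^ ρ)))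
        (sym (cong₂ ℤ._+_ (∏-pos-const N (2 ^ ρ)) (∏-pos-const N (2 ^ ρ))))
        (ℤ.+<+ (bernoulli-strict (2 ^ ρ) N N-small))

-- Sums of natural numbers over finite index sets.

module FinSums where
  open import Data.Bool using (Bool; true; false; _∧_; not; if_then_else_)
  open import Data.Fin using (Fin; zero; suc; _↑ˡ_; _↑ʳ_; combine; _≟_)
  open import Data.Fin.Subset using (∣_∣)
  open import Data.Nat using (ℕ; zero; suc; _+_; _*_; _≤_; _<_; z≤n)
  open import Data.Nat.Properties hiding (_≟_)
  open import Data.Nat.Tactic.RingSolver using (solve-∀)
  open import Data.Product using (∃; _,_)
  open import Data.Vec using (Vec; []; _∷_; lookup)
  open import Relation.Binary.PropositionalEquality
  open import Relation.Nullary using (yes; no; does)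

  ∑ : ∀ {n} → (Fin n → ℕ) → ℕ
  ∑ {zero}  f = 0
  ∑ {suc n} f = f zero + ∑ λ i → f (suc i)

  bit : Bool → ℕ
  bit b = if b then 1 else 0

  ∑-cong : ∀ {n} {f g : Fin n → ℕ} → (∀ i → f i ≡ g i) → ∑ f ≡ ∑ g
  ∑-cong {zero}  eq = refl
  ∑-cong {suc n} eq = cong₂ _+_ (eq zero) (∑-cong λ i → eq (suc i))

  ∑-mono : ∀ {n} {f g : Fin n → ℕ} → (∀ i → f i ≤ g i) → ∑ f ≤ ∑ g
  ∑-mono {zero}  le = z≤n
  ∑-mono {suc n} le = +-mono-≤ (le zero) (∑-mono λ i → le (suc i))

  ∑-+ : ∀ {n} (f g : Fin n → ℕ) → ∑ (λ i → f i + g i) ≡ ∑ f + ∑ g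
  ∑-+ {zero}  f g = refl
  ∑-+ {suc n} f g rewrite ∑-+ (λ i → f (suc i)) (λ i → g (suc i)) = lem (f zero) (g zero) _ _
    where
    lem : ∀ a b c d → a + b + (c + d) ≡ a + c + (b + d)
    lem = solve-∀

  ∑-const : ∀ n c → ∑ {n} (λ _ → c) ≡ n * c
  ∑-const zero    c = refl
  ∑-const (suc n) c = cong (c +_) (∑-const n c)

  ∑-↑ : ∀ m n (f : Fin (m + n) → ℕ) → ∑ f ≡ ∑ (λ i → f (i ↑ˡ n)) + ∑ (λ i → f (m ↑ʳ i))
  ∑-↑ zero    n f = refl
  ∑-↑ (suc m) n f =
    trans (cong (f zero +_) (∑-↑ m n λ i → f (suc i))) (sym (+-assoc (f zero) _ _))

  ∑-combine : ∀ m n (f : Fin (m * n) → ℕ) → ∑ f ≡ ∑ {m} (λ i → ∑ {n} λ j → f (combine i j))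
  ∑-combine zero    n f = refl
  ∑-combine (suc m) n f =
    trans (∑-↑ n (m * n) f) (cong (∑ (λ j → f (j ↑ˡ (m * n))) +_) (∑-combine m n λ i → f (n ↑ʳ i)))

  ∣d∣≡∑ : ∀ {n} (d : Vec Bool n) → ∣ d ∣ ≡ ∑ λ i → bit (lookup d i)
  ∣d∣≡∑ []          = refl
  ∣d∣≡∑ (true ∷ d)  = cong suc (∣d∣≡∑ d)
  ∣d∣≡∑ (false ∷ d) = ∣d∣≡∑ d

  ∑<⇒∃< : ∀ {n} c (f : Fin n → ℕ) → ∑ f < n * c → ∃ λ i → f i < c
  ∑<⇒∃< {suc n} c f lt with f zero <? c
  ... | yes f₀<c = zero , f₀<c
  ... | no  f₀≮c with ∑<⇒∃< {n} c (λ i → f (suc i)) (+-cancelˡ-< c _ _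
    (≤-<-trans (+-monoˡ-≤ (∑ λ i → f (suc i)) (≮⇒≥ f₀≮c)) lt))
  ... | i , fᵢ<c = suc i , fᵢ<c

  ∑-remove : ∀ {n} (b : Fin n → Bool) i →
             ∑ (λ x → bit (b x)) ≡ bit (b i) + ∑ (λ x → bit (b x ∧ not (does (x ≟ i))))
  ∑-remove {suc n} b zero    = cong (bit (b zero) +_) (trans
    (∑-cong λ x → sym (cong bit (lem (b (suc x)))))
    (sym (cong (λ c → bit c + ∑ (λ x → bit (b (suc x) ∧ true))) (∧-false (b zero)))))
    where
    lem : ∀ c → c ∧ true ≡ c
    lem true  = refl
    lem false = refl
    ∧-false : ∀ c → c ∧ false ≡ false
    ∧-false true  = refl
    ∧-false false = refl
  ∑-remove {suc n} b (suc i) = begin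
    bit (b zero) + ∑ (λ x → bit (b (suc x)))
      ≡⟨ cong (bit (b zero) +_) (∑-remove (λ x → b (suc x)) i) ⟩
    bit (b zero) + (bit (b (suc i)) + R)
      ≡⟨ swap (bit (b zero)) (bit (b (suc i))) R ⟩
    bit (b (suc i)) + (bit (b zero) + R)
      ≡⟨ cong (λ c → bit (b (suc i)) + (bit c + R)) (sym (∧-true (b zero))) ⟩
    bit (b (suc i)) + (bit (b zero ∧ true) + R) ∎
    where
    open ≡-Reasoning
    R = ∑ (λ x → bit (b (suc x) ∧ not (does (x ≟ i))))
    swap : ∀ a b c → a + (b + c) ≡ b + (a + c)
    swap = solve-∀
    ∧-true : ∀ c → c ∧ true ≡ c
    ∧-true true  = refl
    ∧-true false = refl

-- Words with small pairwise agreement, and regions that nearly contain many of them.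

module Code where
  open import Data.Bool using (Bool; true; false; _∧_; not; if_then_else_)
  open import Data.Fin using (Fin; zero; suc; _≟_)
  open import Data.Integer as ℤ using (ℤ; +_; 0ℤ; 1ℤ)
  import Data.Integer.Properties as ℤ
  open import Data.Integer.Tactic.RingSolver using (solve-∀)
  open import Data.List using (List; _∷_; length; allFin)
  open import Data.List.Membership.Propositional using (_∈_)
  open import Data.List.Membership.Propositional.Properties using (∈-allFin)
  open import Data.List.Relation.Unary.All as All using (All)
  open import Data.List.Relation.Unary.AllPairs using (_∷_)
  open import Data.List.Relation.Unary.Any using (there)
  open import Data.List.Relation.Unary.Unique.Propositional using (Unique)
  open import Data.Nat using (ℕ; zero; suc; _+_; _*_; _^_; _≤_; s≤s; z≤n)
  open import Data.Nat.Properties hiding (_≟_)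
  open import Data.Product using (∃; _,_)
  open import Relation.Binary.PropositionalEquality
  open import Relation.Nullary using (yes; no; does; contradiction)
  open Sums
  open FinSums

  Word : ℕ → ℕ → Set
  Word L s = Fin L → Fin s

  agree : ∀ {L s} → Word L s → Word L s → ℕ
  agree v w = ∑ λ l → bit (does (v l ≟ w l))

  agree-sym : ∀ {L s} (v w : Word L s) → agree v w ≡ agree w v
  agree-sym v w = ∑-cong λ l → cong bit (lem (v l) (w l))
    where
    lem : ∀ {n} (a b : Fin n) → does (a ≟ b) ≡ does (b ≟ a)
    lem a b with a ≟ b | b ≟ a
    ... | yes _ | yes _ = refl
    ... | no  _ | no  _ = refl
    ... | yes p | no ¬q = contradiction (sym p) ¬q
    ... | no ¬p | yes q = contradiction (sym q) ¬p

  pos-^ : ∀ b n → (+ b) ℤ.^ n ≡ + (b ^ n)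
  pos-^ b zero    = refl
  pos-^ b (suc n) = trans (cong (+ b ℤ.*_) (pos-^ b n)) (sym (ℤ.pos-* b (b ^ n)))

  -- A factor 2 per agreement makes 2^agree a product over positions, an exponential moment that can
  -- be kept small one letter at a time.
  doubling : Bool → ℤ
  doubling b = if b then + 2 else 1ℤ

  ∏-doubling : ∀ {n} (b : Fin n → Bool) → ∏ (λ i → doubling (b i)) ≡ + (2 ^ ∑ λ i → bit (b i))
  ∏-doubling {zero}  b = refl
  ∏-doubling {suc n} b with b zero
  ... | true  = trans (cong (+ 2 ℤ.*_) (∏-doubling λ i → b (suc i))) (sym (ℤ.pos-* 2 (2 ^ ∑ λ i → bit (b (suc i)))))
  ... | false = trans (cong (1ℤ ℤ.*_) (∏-doubling λ i → b (suc i))) (ℤ.*-identityˡ _)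

  Σ-tabulate : ∀ {A : Set} {n} (g : Fin n → A) f →
               Σ (Data.List.tabulate g) f ≡ Σ[ i ← allFin n ] f (g i)
  Σ-tabulate {n = zero}  g f = refl
  Σ-tabulate {n = suc n} g f = cong (λ t → f (g zero) ℤ.+ t)
    (trans (Σ-tabulate (λ i → g (suc i)) f) (sym (Σ-tabulate suc (λ i → f (g i)))))

  Σ-doubling : ∀ s (a : Fin s) → Σ[ x ← allFin s ] doubling (does (a ≟ x)) ≡ 1ℤ ℤ.+ + s
  Σ-doubling (suc s) zero = trans (cong (λ t → + 2 ℤ.+ t) (trans (Σ-tabulate {n = s} suc _) (Σ-allFin-const s 1ℤ)))
    (lem (+ s))
    where
    lem : ∀ s → + 2 ℤ.+ s ℤ.* 1ℤ ≡ 1ℤ ℤ.+ (1ℤ ℤ.+ s)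
    lem = solve-∀
  Σ-doubling (suc s) (suc a) = cong (λ t → 1ℤ ℤ.+ t) (trans (Σ-tabulate {n = s} suc _) (Σ-doubling s a))

  -- Conditional expectations: a random letter agrees with a given one with
  -- probability 1/s, so it multiplies the expected weight by 1 + 1/s.
  greedy-word : ∀ L {s} {I : Set} (xs : List I) (w : I → Word L (suc s)) (c : I → ℤ) →
    ∃ λ (v : Word L (suc s)) →
      (Σ[ i ← xs ] c i ℤ.* ∏ (λ l → doubling (does (w i l ≟ v l)))) ℤ.* (+ suc s) ℤ.^ L ℤ.≤
      Σ xs c ℤ.* (1ℤ ℤ.+ + suc s) ℤ.^ L
  greedy-word zero xs w c = (λ ()) ,
    ℤ.≤-reflexive (cong (ℤ._* 1ℤ) (Σ-cong xs λ i → ℤ.*-identityʳ (c i)))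
  greedy-word (suc L) {s} {I} xs w c =
    let a , step = ∃-≤average (allFin (suc s)) (λ a → + suc s ℤ.* Σ xs (c′ a)) ((1ℤ ℤ.+ + suc s) ℤ.* Σ xs c)
                     average (∈-allFin zero)
        v , rest = greedy-word L xs (λ i l → w i (suc l)) (c′ a)
    in (λ { zero → a ; (suc l) → v l }) , (begin
      (Σ[ i ← xs ] c i ℤ.* (dbl i a ℤ.* tail v i)) ℤ.* (+ suc s ℤ.* (+ suc s) ℤ.^ L)
        ≡⟨ cong (ℤ._* (+ suc s ℤ.* (+ suc s) ℤ.^ L)) (Σ-cong xs λ i → sym (ℤ.*-assoc (c i) (dbl i a) (tail v i))) ⟩
      (Σ[ i ← xs ] c′ a i ℤ.* tail v i) ℤ.* (+ suc s ℤ.* (+ suc s) ℤ.^ L)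
        ≡⟨ swap (Σ[ i ← xs ] c′ a i ℤ.* tail v i) (+ suc s) ((+ suc s) ℤ.^ L) ⟩
      + suc s ℤ.* ((Σ[ i ← xs ] c′ a i ℤ.* tail v i) ℤ.* (+ suc s) ℤ.^ L)
        ≤⟨ *-monoˡ {+ suc s} (ℤ.+≤+ z≤n) rest ⟩
      + suc s ℤ.* (Σ xs (c′ a) ℤ.* (1ℤ ℤ.+ + suc s) ℤ.^ L)
        ≡⟨ sym (ℤ.*-assoc (+ suc s) (Σ xs (c′ a)) _) ⟩
      + suc s ℤ.* Σ xs (c′ a) ℤ.* (1ℤ ℤ.+ + suc s) ℤ.^ L
        ≤⟨ *-monoʳ (subst (0ℤ ℤ.≤_) (sym (pos-^ (2 + s) L)) (ℤ.+≤+ z≤n)) step ⟩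
      (1ℤ ℤ.+ + suc s) ℤ.* Σ xs c ℤ.* (1ℤ ℤ.+ + suc s) ℤ.^ L
        ≡⟨ swap′ (1ℤ ℤ.+ + suc s) (Σ xs c) _ ⟩
      Σ xs c ℤ.* ((1ℤ ℤ.+ + suc s) ℤ.* (1ℤ ℤ.+ + suc s) ℤ.^ L) ∎)
    where
    open ℤ.≤-Reasoning
    dbl : I → Fin (suc s) → ℤ
    dbl i a = doubling (does (w i zero ≟ a))
    c′ : Fin (suc s) → I → ℤ
    c′ a i = c i ℤ.* dbl i a
    tail : Word L (suc s) → I → ℤ
    tail v i = ∏ λ l → doubling (does (w i (suc l) ≟ v l))
    swap : ∀ a b c → a ℤ.* (b ℤ.* c) ≡ b ℤ.* (a ℤ.* c)
    swap = solve-∀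
    swap′ : ∀ a b c → a ℤ.* b ℤ.* c ≡ b ℤ.* (a ℤ.* c)
    swap′ = solve-∀
    swap″ : ∀ a b c → a ℤ.* (b ℤ.* c) ≡ a ℤ.* (c ℤ.* b)
    swap″ = solve-∀
    average : Σ[ a ← allFin (suc s) ] + suc s ℤ.* Σ xs (c′ a) ℤ.≤
              Σ[ a ← allFin (suc s) ] (1ℤ ℤ.+ + suc s) ℤ.* Σ xs c
    average = ℤ.≤-reflexive (trans (Σ-*ˡ (allFin (suc s)) (+ suc s) (λ a → Σ xs (c′ a))) (trans
      (cong (+ suc s ℤ.*_) (trans (Σ-swap (allFin (suc s)) xs c′) (trans
        (Σ-cong xs λ i → trans (Σ-*ˡ (allFin (suc s)) (c i) (dbl i)) (cong (c i ℤ.*_) (Σ-doubling (suc s) (w i zero))))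
        (Σ-*ʳ xs (1ℤ ℤ.+ + suc s) c))))
      (trans (swap″ (+ suc s) (Σ xs c) (1ℤ ℤ.+ + suc s))
             (sym (Σ-allFin-const (suc s) ((1ℤ ℤ.+ + suc s) ℤ.* Σ xs c))))))

  module _ (L s λ₀ : ℕ) (short : (2 + s) ^ L ≤ 2 ^ λ₀ * suc s ^ L) where

    -- The numbers 2^agree over the m given words add up to at most m (1 + 1/(s + 1))^L ≤ 2^λ₀ ·
    -- 2^λ₀, so every single exponent is at most 2 λ₀.
    fresh-word : ∀ {m} (w : Fin m → Word L (suc s)) → m ≤ 2 ^ λ₀ →
                 ∃ λ v → ∀ i → agree (w i) v ≤ λ₀ + λ₀
    fresh-word {m} w m≤ with greedy-word L (allFin m) w (λ _ → 1ℤ)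
    ... | v , le = v , λ i → ≮⇒≥ λ 2λ<agree → <⇒≱ (^-monoʳ-< 2 (s≤s (s≤s z≤n)) 2λ<agree)
      (*-cancelʳ-≤ _ _ (suc s ^ L) {{m^n≢0 (suc s) L}} (ℤ.drop‿+≤+ (bound i)))
      where
      open ℤ.≤-Reasoning
      agreement : Fin m → ℤ
      agreement i = 1ℤ ℤ.* ∏ (λ l → doubling (does (w i l ≟ v l)))
      agreement≡ : ∀ i → agreement i ≡ + (2 ^ agree (w i) v)
      agreement≡ i = trans (ℤ.*-identityˡ _) (∏-doubling λ l → does (w i l ≟ v l))
      bound : ∀ i → + (2 ^ agree (w i) v * suc s ^ L) ℤ.≤ + (2 ^ (λ₀ + λ₀) * suc s ^ L)
      bound i = begin
        + (2 ^ agree (w i) v * suc s ^ L)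
          ≡⟨ trans (ℤ.pos-* (2 ^ agree (w i) v) (suc s ^ L)) (cong₂ ℤ._*_ (sym (agreement≡ i)) (sym (pos-^ (suc s) L))) ⟩
        agreement i ℤ.* (+ suc s) ℤ.^ L
          ≤⟨ *-monoʳ (subst (0ℤ ℤ.≤_) (sym (pos-^ (suc s) L)) (ℤ.+≤+ z≤n))
               (∈⇒≤Σ {f = agreement} (λ i → subst (0ℤ ℤ.≤_) (sym (agreement≡ i)) (ℤ.+≤+ z≤n)) (∈-allFin i)) ⟩
        Σ (allFin m) agreement ℤ.* (+ suc s) ℤ.^ L
          ≤⟨ le ⟩
        (Σ[ i ← allFin m ] 1ℤ) ℤ.* (1ℤ ℤ.+ + suc s) ℤ.^ L
          ≡⟨ cong₂ ℤ._*_ (trans (Σ-allFin-const m 1ℤ) (ℤ.*-identityʳ (+ m))) (pos-^ (2 + s) L) ⟩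
        + m ℤ.* + ((2 + s) ^ L)
          ≡⟨ sym (ℤ.pos-* m _) ⟩
        + (m * (2 + s) ^ L)
          ≤⟨ ℤ.+≤+ (*-mono-≤ m≤ short) ⟩
        + (2 ^ λ₀ * (2 ^ λ₀ * suc s ^ L))
          ≡⟨ cong +_ (trans (sym (*-assoc (2 ^ λ₀) (2 ^ λ₀) (suc s ^ L)))
               (cong (_* suc s ^ L) (sym (^-distribˡ-+-* 2 λ₀ λ₀)))) ⟩
        + (2 ^ (λ₀ + λ₀) * suc s ^ L) ∎

    -- Greedy choice in the manner of Gilbert and Varshamov; the bound on m keeps `fresh-word`
    -- applicable at every stage.
    code : ∀ m → m ≤ 2 ^ λ₀ →
           ∃ λ (w : Fin m → Word L (suc s)) → ∀ {i j} → i ≢ j → agree (w i) (w j) ≤ λ₀ + λ₀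
    code zero    _   = (λ ()) , λ { {()} }
    code (suc m) m<  with code m (≤-trans (n≤1+n m) m<)
    ... | w , far with fresh-word w (≤-trans (n≤1+n m) m<)
    ... | v , fresh = w′ , far′
      where
      w′ : Fin (suc m) → Word L (suc s)
      w′ zero    = v
      w′ (suc i) = w i
      far′ : ∀ {i j} → i ≢ j → agree (w′ i) (w′ j) ≤ λ₀ + λ₀
      far′ {zero}  {zero}  i≢j = contradiction refl i≢j
      far′ {zero}  {suc j} i≢j = subst (_≤ λ₀ + λ₀) (agree-sym (w j) v) (fresh j)
      far′ {suc i} {zero}  i≢j = fresh i
      far′ {suc i} {suc j} i≢j = far λ i≡j → i≢j (cong suc i≡j)

  Region : ℕ → ℕ → Set
  Region L s = Fin L → Fin s → Bool

  area : ∀ {L s} → Region L s → ℕ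
  area Z = ∑ λ l → ∑ λ x → bit (Z l x)

  hits : ∀ {L s} → Region L s → Word L s → ℕ
  hits Z q = ∑ λ l → bit (Z l (q l))

  erase : ∀ {L s} → Region L s → Word L s → Region L s
  erase Z q l x = Z l x ∧ not (does (x ≟ q l))

  area-erase : ∀ {L s} (Z : Region L s) q → area Z ≡ hits Z q + area (erase Z q)
  area-erase Z q = trans (∑-cong λ l → ∑-remove (Z l) (q l))
    (∑-+ (λ l → bit (Z l (q l))) (λ l → ∑ λ x → bit (erase Z q l x)))

  hits-erase : ∀ {L s} (Z : Region L s) p q → hits Z p ≤ hits (erase Z q) p + agree p q
  hits-erase Z p q = subst (hits Z p ≤_)
    (∑-+ (λ l → bit (erase Z q l (p l))) (λ l → bit (does (p l ≟ q l))))
    (∑-mono λ l → lem (Z l (p l)) (does (p l ≟ q l)))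
    where
    lem : ∀ a b → bit a ≤ bit (a ∧ not b) + bit b
    lem true  true  = s≤s z≤n
    lem true  false = s≤s z≤n
    lem false b     = z≤n

  module _ {L s M} (w : Fin M → Word L s) (D : ℕ) (far : ∀ {p q} → p ≢ q → agree (w p) (w q) ≤ D) where

    -- Erasing one word removes at least t points of the region and lowers the hits of every other
    -- word by at most D, the bound on agreements. The slack D * n pays for n rounds.
    peel : ∀ n t Z (qs : List (Fin M)) → Unique qs → n ≤ length qs →
           (∀ {q} → q ∈ qs → t + D * n ≤ hits Z (w q)) → n * t ≤ area Z
    peel zero    t Z qs       _              _         _    = z≤n
    peel (suc n) t Z (q ∷ qs) (q∉qs ∷ uniq) (s≤s n≤) many = begin
      t + n * t                          ≤⟨ +-mono-≤ (≤-trans (m≤m+n t _) (many (Data.List.Relation.Unary.Any.here refl)))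
                                                      (peel n t (erase Z (w q)) qs uniq n≤ many′) ⟩
      hits Z (w q) + area (erase Z (w q)) ≡⟨ sym (area-erase Z (w q)) ⟩
      area Z                             ∎
      where
      open ≤-Reasoning
      many′ : ∀ {p} → p ∈ qs → t + D * n ≤ hits (erase Z (w q)) (w p)
      many′ {p} p∈ = +-cancelʳ-≤ D _ _ (begin
        t + D * n + D                           ≡⟨ trans (+-assoc t (D * n) D) (cong (λ u → t + u)
                                                     (trans (+-comm (D * n) D) (sym (*-suc D n)))) ⟩
        t + D * suc n                           ≤⟨ many (there p∈) ⟩
        hits Z (w p)                            ≤⟨ hits-erase Z (w p) (w q) ⟩
        hits (erase Z (w q)) (w p) + agree (w p) (w q)
          ≤⟨ +-monoʳ-≤ (hits (erase Z (w q)) (w p)) (far λ p≡q → All.lookup q∉qs p∈ (sym p≡q)) ⟩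
        hits (erase Z (w q)) (w p) + D          ∎)

-- A tournament in which any h players all beat a common one.

module Tournament where
  open import Data.Bool using (Bool; true; false; not; _xor_)
  open import Data.Fin using (Fin; _≟_; _<?_)
  open import Data.Fin.Properties using (any?; injective⇒≤; toℕ-injective)
  open import Data.List as List using (List; []; _∷_; _++_; length; concatMap)
  open import Data.List.Membership.Propositional using (_∈_; _∉_)
  open import Data.List.Membership.Propositional.Properties using (∈-++⁺ˡ; ∈-++⁺ʳ; ∈-map⁺; ∈-map⁻; ∈-concat⁺′)
  open import Data.List.Properties using (length-++; length-map)
  import Data.List.Membership.DecPropositional as DecMembership
  open import Data.List.Relation.Unary.Any as Any using (here; there)
  open import Data.List.Relation.Unary.Any.Properties using (lookup-index)
  open import Data.Nat using (ℕ; zero; suc; _+_; _*_; _≤_; _<_; s≤s)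
  import Data.Nat.Properties as ℕ
  open import Data.Product using (∃; _×_; _,_; proj₁; proj₂)
  open import Data.Sum using (_⊎_; inj₁; inj₂)
  open import Data.Vec as Vec using (Vec; []; _∷_)
  open import Relation.Binary.PropositionalEquality
  open import Relation.Nullary using (¬_; Dec; yes; no; does; contradiction)
  open import Relation.Nullary.Decidable using (¬?; decidable-stable; dec-true; dec-false)

  ∃-∉ : ∀ {n} (xs : List (Fin n)) → length xs < n → ∃ λ a → a ∉ xs
  ∃-∉ {n} xs short with any? (λ a → ¬? (a ∈? xs))
    where open DecMembership _≟_ using (_∈?_)
  ... | yes found = found
  ... | no  none  = contradiction (injective⇒≤ {f = position} injective) (ℕ.<⇒≱ short)
    where
    open DecMembership _≟_ using (_∈?_)
    ∈xs : ∀ a → a ∈ xs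
    ∈xs a = decidable-stable (a ∈? xs) λ a∉ → none (a , a∉)
    position : Fin n → Fin (length xs)
    position a = Any.index (∈xs a)
    injective : ∀ {a b} → position a ≡ position b → a ≡ b
    injective {a} {b} eq = trans (lookup-index (∈xs a))
      (trans (cong (List.lookup xs) eq) (sym (lookup-index (∈xs b))))

  pad : ∀ {A : Set} h → A → List A → Vec A h
  pad zero    a xs       = []
  pad (suc h) a []       = a ∷ pad h a []
  pad (suc h) a (x ∷ xs) = x ∷ pad h a xs

  ∈-pad⁺ : ∀ {A : Set} {h} {a x : A} {xs} → length xs ≤ h → x ∈ xs → x ∈ Vec.toList (pad h a xs)
  ∈-pad⁺ (s≤s le) (here refl) = here refl
  ∈-pad⁺ (s≤s le) (there x∈)  = there (∈-pad⁺ le x∈)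

  ∈-pad⁻ : ∀ {A : Set} h {a x : A} xs → x ∈ Vec.toList (pad h a xs) → x ≡ a ⊎ x ∈ xs
  ∈-pad⁻ (suc h) []       (here refl) = inj₁ refl
  ∈-pad⁻ (suc h) []       (there x∈)  = ∈-pad⁻ h [] x∈
  ∈-pad⁻ (suc h) (y ∷ xs) (here refl) = inj₂ (here refl)
  ∈-pad⁻ (suc h) (y ∷ xs) (there x∈) with ∈-pad⁻ h xs x∈
  ... | inj₁ x≡a  = inj₁ x≡a
  ... | inj₂ x∈xs = inj₂ (there x∈xs)

  length-toList : ∀ {A : Set} {n} (v : Vec A n) → length (Vec.toList v) ≡ n
  length-toList []      = refl
  length-toList (x ∷ v) = cong suc (length-toList v)

  -- The list `flips` has room for h apexes, so a name can carry its own results against h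
  -- opponents. This makes the tournament explicit, at the price of about h log B bits per name.
  record Name (B h s : ℕ) : Set where
    constructor name
    field
      apex    : Fin B
      flips   : Vec (Fin B) h
      block   : Fin s

  open Name public

  module _ {B h s : ℕ} (rank : Name B h s → ℕ) (rank-injective : ∀ {p q} → rank p ≡ rank q → p ≡ q) where

    open DecMembership {A = Fin B} _≟_ using (_∈?_)

    flipped : Fin B → Name B h s → Bool
    flipped b p = does (b ∈? Vec.toList (flips p))

    precedes : Name B h s → Name B h s → Bool
    precedes p q with apex p ≟ apex q
    ... | yes _ = does (rank p ℕ.<? rank q)
    ... | no  _ = does (apex p <? apex q)

    -- The orientation of {p , q} is that of a transitive tournament, reversed
    -- once for each of the two names that lists the apex of the other.
    loses : Name B h s → Name B h s → Bool
    loses p q = flipped (apex q) p xor (flipped (apex p) q xor precedes p q)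

    opposite : ∀ {P Q : Set} (P? : Dec P) (Q? : Dec Q) → (P → ¬ Q) → (¬ P → Q) →
               does Q? ≡ not (does P?)
    opposite (yes p) Q? P⇒¬Q ¬P⇒Q = dec-false Q? (P⇒¬Q p)
    opposite (no ¬p) Q? P⇒¬Q ¬P⇒Q = dec-true Q? (¬P⇒Q ¬p)

    precedes-antisym : ∀ p q → p ≢ q → precedes q p ≡ not (precedes p q)
    precedes-antisym p q p≢q with apex p ≟ apex q | apex q ≟ apex p
    ... | yes _ | yes _ = opposite (rank p ℕ.<? rank q) (rank q ℕ.<? rank p) ℕ.<⇒≯
      λ p≮q → ℕ.≤∧≢⇒< (ℕ.≮⇒≥ p≮q) λ eq → p≢q (rank-injective (sym eq))
    ... | yes p≡ | no q≢  = contradiction (sym p≡) q≢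
    ... | no p≢  | yes q≡ = contradiction (sym q≡) p≢
    ... | no a≢b | no _   = opposite (apex p <? apex q) (apex q <? apex p) ℕ.<⇒≯
      λ a≮b → ℕ.≤∧≢⇒< (ℕ.≮⇒≥ a≮b) λ eq → a≢b (toℕ-injective (sym eq))

    loses-antisym : ∀ p q → p ≢ q → loses q p ≡ not (loses p q)
    loses-antisym p q p≢q rewrite precedes-antisym p q p≢q =
      lem (flipped (apex q) p) (flipped (apex p) q) (precedes p q)
      where
      lem : ∀ a b c → b xor (a xor not c) ≡ not (a xor (b xor c))
      lem true  true  true  = refl
      lem true  true  false = refl
      lem true  false true  = refl
      lem true  false false = refl
      lem false true  true  = refl
      lem false true  false = refl
      lem false false true  = refl
      lem false false false = refl

    -- Choose an apex that is neither the apex of any name in `qs` nor listed by one; at most h + h²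
    -- values are excluded. Then only the list of the new name influences these games, and it has to
    -- contain exactly those opposing apexes against which the transitive order would let the new
    -- name win, namely the ones below its own.
    dominated : h + h * h < B → ∀ j (qs : List (Name B h s)) → length qs ≤ h →
      ∃ λ p → block p ≡ j × (∀ {q} → q ∈ qs → p ≢ q × loses p q ≡ true)
    dominated room j qs few = p , refl , λ {q} q∈ → (λ { refl → a≢apex q∈ refl }) , lost q∈
      where
      forbidden : List (Fin B)
      forbidden = List.map apex qs ++ concatMap (λ q → Vec.toList (flips q)) qs

      length-flips : ∀ qs → length (concatMap (λ q → Vec.toList (flips q)) qs) ≡ length qs * h
      length-flips []       = refl
      length-flips (q ∷ qs) = trans (length-++ (Vec.toList (flips q)))
        (cong₂ _+_ (length-toList (flips q)) (length-flips qs))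

      short : length forbidden < B
      short = ℕ.≤-<-trans (ℕ.≤-trans (ℕ.≤-reflexive (trans (length-++ (List.map apex qs))
        (cong₂ _+_ (length-map apex qs) (length-flips qs)))) (ℕ.+-mono-≤ few (ℕ.*-monoˡ-≤ h few))) room

      a : Fin B
      a = proj₁ (∃-∉ forbidden short)

      a∉ : a ∉ forbidden
      a∉ = proj₂ (∃-∉ forbidden short)

      a≢apex : ∀ {q} → q ∈ qs → a ≢ apex q
      a≢apex q∈ refl = a∉ (∈-++⁺ˡ (∈-map⁺ apex q∈))

      choose : ∀ {b} → Dec (a Data.Fin.< b) → Fin B
      choose     (yes _) = a
      choose {b} (no  _) = b

      -- The new apex `a` itself is the filler of the list: no opponent has it as apex, so listing
      -- it reverses none of these games.
      flip : Name B h s → Fin B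
      flip q = choose (a <? apex q)

      p : Name B h s
      p = name a (pad h a (List.map flip qs)) j

      unflipped : ∀ {q} → q ∈ qs → flipped a q ≡ false
      unflipped {q} q∈ = dec-false (a ∈? Vec.toList (flips q)) λ a∈ →
        a∉ (∈-++⁺ʳ (List.map apex qs) (∈-concat⁺′ a∈ (∈-map⁺ (λ q → Vec.toList (flips q)) q∈)))

      choose≡ : ∀ {b b′} (d : Dec (a Data.Fin.< b′)) → a ≢ b → b ≡ choose d → b ≡ b′ × ¬ a Data.Fin.< b′
      choose≡ (yes _)  a≢b eq = contradiction (sym eq) a≢b
      choose≡ (no a≮)  a≢b eq = eq , a≮

      choose-no : ∀ {b} (d : Dec (a Data.Fin.< b)) → ¬ a Data.Fin.< b → choose d ≡ b
      choose-no (yes a<b) a≮b = contradiction a<b a≮b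
      choose-no (no  _)   _   = refl

      flipped-p : ∀ {q} → q ∈ qs → (d : Dec (a Data.Fin.< apex q)) → flipped (apex q) p ≡ not (does d)
      flipped-p {q} q∈ (yes a<b) = dec-false (apex q ∈? Vec.toList (flips p)) λ b∈ →
        absurd (∈-pad⁻ h (List.map flip qs) b∈)
        where
        absurd : ¬ (apex q ≡ a ⊎ apex q ∈ List.map flip qs)
        absurd (inj₁ b≡a) = a≢apex q∈ (sym b≡a)
        absurd (inj₂ b∈) with ∈-map⁻ flip b∈
        ... | q′ , _ , b≡ with choose≡ (a <? apex q′) (a≢apex q∈) b≡
        ... | b≡b′ , a≮b′ = a≮b′ (subst (a Data.Fin.<_) b≡b′ a<b)
      flipped-p {q} q∈ (no a≮b) = dec-true (apex q ∈? Vec.toList (flips p)) (∈-pad⁺ {h = h} {a = a}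
        (ℕ.≤-trans (ℕ.≤-reflexive (length-map flip qs)) few)
        (subst (_∈ List.map flip qs) (choose-no (a <? apex q) a≮b) (∈-map⁺ flip q∈)))

      precedes-p : ∀ {q} → a ≢ apex q → precedes p q ≡ does (a <? apex q)
      precedes-p {q} a≢ with a ≟ apex q
      ... | yes a≡ = contradiction a≡ a≢
      ... | no  _  = refl

      lost : ∀ {q} → q ∈ qs → loses p q ≡ true
      lost {q} q∈ = trans (cong₂ _xor_ (flipped-p q∈ (a <? apex q)) (cong₂ _xor_ (unflipped q∈) (precedes-p {q} (a≢apex q∈))))
        (not-xor (does (a <? apex q)))
        where
        not-xor : ∀ b → not b xor b ≡ true
        not-xor true  = refl
        not-xor false = refl

-- The unambiguous DNF of a tournament and a code.

module TournamentDNF where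
  open import Data.Bool using (Bool; true; false; not; _∨_)
  import Data.Bool.Properties as Bool
  open import Data.Fin using (Fin; zero; suc; toℕ; _↑ˡ_; _↑ʳ_; splitAt; remQuot; combine; _≟_)
  open import Data.Fin.Properties using (*↔×; all?; toℕ-injective; splitAt-↑ˡ; splitAt-↑ʳ; remQuot-combine; combine-remQuot)
  open import Data.Fin.Subset using (∣_∣)
  open import Data.List as List using (List; []; _∷_; length; filter; allFin)
  open import Data.List.Membership.Propositional using (_∈_)
  open import Data.List.Membership.Propositional.Properties using (∈-filter⁺; ∈-filter⁻; ∈-allFin; ∈-map⁺)
  open import Data.List.Properties using (length-map)
  open import Data.List.Relation.Unary.Any using (here)
  open import Data.List.Relation.Unary.Unique.Propositional.Properties using (filter⁺; allFin⁺)
  open import Data.Nat using (ℕ; zero; suc; _+_; _*_; _^_; _≤_; _<_; s≤s; z≤n; _≤?_)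
  open import Data.Nat.Properties hiding (_≟_; _≤?_)
  open import Data.Product using (∃; _×_; _,_; proj₁; proj₂)
  open import Data.Product.Function.NonDependent.Propositional using (_×-↔_)
  open import Data.Sum using ([_,_]′)
  open import Data.Vec using (Vec; lookup; tabulate; replicate)
  open import Data.Vec.Properties using (lookup∘tabulate; lookup-replicate)
  open import Function using (_↔_; mk↔ₛ′; Inverse)
  open import Function.Properties.Inverse using (↔-refl; ↔-sym; ↔-trans)
  open import Relation.Binary.PropositionalEquality
  open import Relation.Nullary using (¬_; Dec; yes; no; does; contradiction)
  open import Relation.Nullary.Decidable using (_×-dec_; _→-dec_; ¬?)
  open RectangleGraph
  open FinSums
  open Code
  open Tournament hiding (block)

  Name↔Fin : ∀ {B h s} → Name B h s ↔ Fin (B * (B ^ h * s))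
  Name↔Fin {h = h} = ↔-trans
    (mk↔ₛ′ (λ p → apex p , flips p , Tournament.block p) (λ (a , f , j) → name a f j) (λ _ → refl) (λ _ → refl))
    (↔-trans (↔-refl ×-↔ (↔-trans (Vec↔Fin ↔-refl h ×-↔ ↔-refl) (↔-sym *↔×))) (↔-sym *↔×))

  record DominatedTournament (M h s : ℕ) : Set where
    field
      block     : Fin M → Fin s
      losesTo   : Fin M → Fin M → Bool
      antisym   : ∀ p q → p ≢ q → losesTo q p ≡ not (losesTo p q)
      dominator : ∀ j (qs : List (Fin M)) → length qs ≤ h →
                  ∃ λ p → block p ≡ j × (∀ {q} → q ∈ qs → p ≢ q × losesTo p q ≡ true)

  tournament : ∀ B h s → h + h * h < B → DominatedTournament (B * (B ^ h * s)) h s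
  tournament B h s room = record
    { block     = λ i → Tournament.block (decode i)
    ; losesTo   = λ i j → loses rank rank-injective (decode i) (decode j)
    ; antisym   = λ i j i≢j → loses-antisym rank rank-injective (decode i) (decode j)
                                λ eq → i≢j (decode-injective eq)
    ; dominator = λ j qs few →
        let p , block≡ , lost = dominated rank rank-injective room j (List.map decode qs)
                                  (≤-trans (≤-reflexive (length-map decode qs)) few)
            decode≡ = Inverse.strictlyInverseʳ iso p
        in Inverse.to iso p , trans (cong Tournament.block decode≡) block≡ , λ {q} q∈ →
           (λ p≡q → proj₁ (lost (∈-map⁺ decode q∈)) (trans (sym decode≡) (cong decode p≡q))) ,
           trans (cong (λ n → loses rank rank-injective n (decode q)) decode≡) (proj₂ (lost (∈-map⁺ decode q∈)))
    }
    where
    iso : Name B h s ↔ Fin (B * (B ^ h * s))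
    iso = Name↔Fin

    decode : Fin (B * (B ^ h * s)) → Name B h s
    decode = Inverse.from iso

    decode-injective : ∀ {i j} → decode i ≡ decode j → i ≡ j
    decode-injective {i} {j} eq = trans (sym (Inverse.strictlyInverseˡ iso i))
      (trans (cong (Inverse.to iso) eq) (Inverse.strictlyInverseˡ iso j))

    rank : Name B h s → ℕ
    rank p = toℕ (Inverse.to iso p)

    rank-injective : ∀ {p q} → rank p ≡ rank q → p ≡ q
    rank-injective {p} {q} eq = trans (sym (Inverse.strictlyInverseʳ iso p))
      (trans (cong decode (toℕ-injective eq)) (Inverse.strictlyInverseʳ iso q))

  module _ {M h s L : ℕ} (T : DominatedTournament M h s) (w : Fin M → Word L s) where
    open DominatedTournament T

    private
      N : ℕ
      N = s * (L * s)

    place : Fin s → Fin L → Fin s → Fin N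
    place j l x = combine j (combine l x)

    inBlock : Fin (L * s) → Fin (L * s + s * L)
    inBlock i = i ↑ˡ (s * L)

    inWord : Fin (s * L) → Fin (L * s + s * L)
    inWord i = (L * s) ↑ʳ i

    variableAt : Fin M → Fin (L * s + s * L) → Fin N
    variableAt p k = [ combine (block p)
                     , (λ i → let j , l = remQuot L i in place j l (w p l)) ]′ (splitAt (L * s) k)

    variableAt-inBlock : ∀ p i → variableAt p (inBlock i) ≡ combine (block p) i
    variableAt-inBlock p i rewrite splitAt-↑ˡ (L * s) i (s * L) = refl

    variableAt-inWord : ∀ p j l → variableAt p (inWord (combine j l)) ≡ place j l (w p l)
    variableAt-inWord p j l = trans
      (cong [ combine (block p) , (λ i → let j , l = remQuot L i in place j l (w p l)) ]′
            (splitAt-↑ʳ (L * s) (s * L) (combine j l)))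
      (cong (λ (j , l) → place j l (w p l)) (remQuot-combine {s} j l))

    -- Term p reads all of its own block and its word in every block. The word must be
    -- zero, and p may accept a block that is zero on the word of q only if p loses to
    -- q; so the winner's block has a 1 where the loser's word needs a 0.
    Accepts : Fin M → Vec Bool (L * s + s * L) → Set
    Accepts p v =
      (∀ i → lookup v (inWord i) ≡ false) ×
      (∀ q → q ≢ p → (∀ l → lookup v (inBlock (combine l (w q l))) ≡ false) → losesTo p q ≡ true)

    unambiguous : ∀ {p q v v′} → Accepts p v → Accepts q v′ →
      (∀ k l → variableAt p k ≡ variableAt q l → lookup v k ≡ lookup v′ l) → p ≡ q
    unambiguous {p} {q} {v} {v′} (zero-p , lost-p) (zero-q , lost-q) same with p ≟ q
    ... | yes p≡q = p≡q
    ... | no  p≢q = contradiction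
      (trans (sym (lost-q p p≢q λ l → trans (sym (same _ _ (meet q p l))) (zero-p _)))
             (trans (antisym p q p≢q)
                    (cong not (lost-p q (λ q≡p → p≢q (sym q≡p)) λ l →
                      trans (same _ _ (sym (meet p q l))) (zero-q _)))))
      λ ()
      where
      meet : ∀ q p l → variableAt p (inWord (combine (block q) l)) ≡
                       variableAt q (inBlock (combine l (w p l)))
      meet q p l = trans (variableAt-inWord p (block q) l)
                         (sym (variableAt-inBlock q (combine l (w p l))))

    dnf : UnambiguousDNF N
    dnf = record
      { terms       = M
      ; width       = L * s + s * L
      ; Term        = Fin M
      ; Term↔Fin    = ↔-refl
      ; var         = variableAt
      ; Accepts     = Accepts
      ; accepts?    = λ p v → all? (λ i → lookup v (inWord i) Bool.≟ false) ×-dec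
          all? λ q → ¬? (q ≟ p) →-dec
            (all? (λ l → lookup v (inBlock (combine l (w q l))) Bool.≟ false) →-dec losesTo p q Bool.≟ true)
      ; unambiguous = λ {p} {q} {v} {v′} → unambiguous {p} {q} {v} {v′}
      }

    open UnambiguousDNF dnf using (Satisfies)

    -- A term accepting the zero pattern would lose to every other one, but some
    -- other one loses to it.
    ¬zero-satisfies : 1 ≤ h → ¬ Satisfies (replicate N false)
    ¬zero-satisfies 1≤h (p , _ , lost) =
      let q , _ , beaten = dominator (block p) (p ∷ []) 1≤h
          q≢p , q-loses  = beaten (here refl)
          p-loses = lost q q≢p λ l → trans (lookup∘tabulate _ (inBlock (combine l (w q l))))
                                           (lookup-replicate {n = N} (variableAt p (inBlock (combine l (w q l)))) false)
      in contradiction (trans (sym p-loses) (trans (antisym q p q≢p) (cong not q-loses))) λ ()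

    module _ (D t : ℕ) (far : ∀ {p q} → p ≢ q → agree (w p) (w q) ≤ D) (L≡ : t + D * (2 + h) ≡ L) where

      -- By `peel`, h + 1 heavy words would occupy (h + 1) t points. Of the slack D (2 + h) in `L≡`,
      -- one D is the tolerance in the definition of heavy and the others pay for the h + 1 rounds.
      few-heavy : ∀ Z → area Z < suc h * t → length (filter (λ q → L ≤? hits Z (w q) + D) (allFin M)) ≤ h
      few-heavy Z small = ≮⇒≥ λ h<len → <⇒≱ small
        (peel w D far (suc h) t Z (filter heavy? (allFin M)) (filter⁺ heavy? (allFin⁺ M)) h<len
          λ {q} q∈ → +-cancelʳ-≤ D _ _ (≤-trans (≤-reflexive (lem (D * suc h))) (proj₂ (∈-filter⁻ heavy? {xs = allFin M} q∈))))
        where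
        heavy? : ∀ q → Dec (L ≤ hits Z (w q) + D)
        heavy? q = L ≤? hits Z (w q) + D
        lem : ∀ e → t + D * suc h + D ≡ L
        lem _ = trans (+-assoc t (D * suc h) D)
          (trans (cong (t +_) (trans (+-comm (D * suc h) D) (sym (*-suc D (suc h))))) L≡)

      -- Some block j has fewer than (h + 1) t revealed zeros Z. Let p be a name of block j that
      -- loses to all heavy names, and let `z` be 0 in block j exactly on Z and on the word of p,
      -- and 0 in all other blocks. Any other word that is 0 throughout block j is covered by Z and
      -- the word of p; it meets the latter at most D times, so it is heavy and p loses to its name.
      hard : ∀ (d : Vec Bool N) → ∣ d ∣ < s * (suc h * t) →
             ∃ λ z → Satisfies z × (∀ i → lookup d i ≡ true → lookup z i ≡ false)
      hard d small = z , (p , on-word , on-block) , avoids-d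
        where
        region : Fin s → Region L s
        region j l x = lookup d (place j l x)

        total : ∣ d ∣ ≡ ∑ λ j → area (region j)
        total = trans (∣d∣≡∑ d) (trans (∑-combine s (L * s) λ i → bit (lookup d i))
          (∑-cong {s} λ j → ∑-combine L s λ r → bit (lookup d (combine j r))))

        light : ∃ λ j → area (region j) < suc h * t
        light = ∑<⇒∃< (suc h * t) (λ j → area (region j)) (subst (_< s * (suc h * t)) total small)

        j : Fin s
        j = proj₁ light

        Z : Region L s
        Z = region j

        heavy : List (Fin M)
        heavy = filter (λ q → L ≤? hits Z (w q) + D) (allFin M)

        dominating : ∃ λ p → block p ≡ j × (∀ {q} → q ∈ heavy → p ≢ q × losesTo p q ≡ true)
        dominating = dominator j heavy (few-heavy Z (proj₂ light))

        p : Fin M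
        p = proj₁ dominating

        value : Fin s → Fin L → Fin s → Bool
        value j′ l x with j′ ≟ j
        ... | yes _ = not (Z l x ∨ does (x ≟ w p l))
        ... | no  _ = false

        value-j : ∀ l x → value j l x ≡ not (Z l x ∨ does (x ≟ w p l))
        value-j l x with j ≟ j
        ... | yes _  = refl
        ... | no j≢j = contradiction refl j≢j

        z : Vec Bool N
        z = tabulate λ i → let j′ , r = remQuot {s} (L * s) i
                               l , x  = remQuot {L} s r
                           in value j′ l x

        lookup-z : ∀ j′ l x → lookup z (place j′ l x) ≡ value j′ l x
        lookup-z j′ l x = trans (lookup∘tabulate _ (place j′ l x)) (trans
          (cong (λ (j′ , r) → let l , x = remQuot {L} s r in value j′ l x) (remQuot-combine {s} j′ (combine l x)))
          (cong (λ (l , x) → value j′ l x) (remQuot-combine {L} l x)))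

        word-zero : ∀ j′ l → value j′ l (w p l) ≡ false
        word-zero j′ l with j′ ≟ j
        ... | no  _ = refl
        ... | yes _ with w p l ≟ w p l
        ...   | yes _  = cong not (∨-true (Z l (w p l)))
          where
          ∨-true : ∀ b → b ∨ true ≡ true
          ∨-true true  = refl
          ∨-true false = refl
        ...   | no w≢w = contradiction refl w≢w

        pattern′ : Vec Bool (L * s + s * L)
        pattern′ = tabulate λ k → lookup z (variableAt p k)

        on-word : ∀ i → lookup pattern′ (inWord i) ≡ false
        on-word i = trans (lookup∘tabulate _ (inWord i)) (subst
          (λ i → lookup z (variableAt p (inWord i)) ≡ false) (combine-remQuot {s} L i)
          (let j′ , l = remQuot {s} L i in
            trans (cong (lookup z) (variableAt-inWord p j′ l)) (trans (lookup-z j′ l (w p l)) (word-zero j′ l))))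

        at-block : ∀ l x → lookup pattern′ (inBlock (combine l x)) ≡ not (Z l x ∨ does (x ≟ w p l))
        at-block l x = trans (lookup∘tabulate _ (inBlock (combine l x))) (trans
          (cong (lookup z) (trans (variableAt-inBlock p (combine l x))
            (cong (λ j → combine j (combine l x)) (proj₁ (proj₂ dominating)))))
          (trans (lookup-z j l x) (value-j l x)))

        on-block : ∀ q → q ≢ p → (∀ l → lookup pattern′ (inBlock (combine l (w q l))) ≡ false) →
                   losesTo p q ≡ true
        on-block q q≢p zeros = proj₂ (proj₂ (proj₂ dominating)
          (∈-filter⁺ (λ q → L ≤? hits Z (w q) + D) (∈-allFin q) (begin
            L                                       ≡⟨ sym (trans (∑-const L 1) (*-identityʳ L)) ⟩
            ∑ {L} (λ _ → 1)                         ≤⟨ ∑-mono (λ l → cover (Z l (w q l)) _ (trans (sym (at-block l (w q l))) (zeros l))) ⟩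
            ∑ (λ l → bit (Z l (w q l)) + bit (does (w q l ≟ w p l)))
                                                    ≡⟨ ∑-+ (λ l → bit (Z l (w q l))) _ ⟩
            hits Z (w q) + agree (w q) (w p)        ≤⟨ +-monoʳ-≤ (hits Z (w q)) (far q≢p) ⟩
            hits Z (w q) + D                        ∎)))
          where
          open ≤-Reasoning
          cover : ∀ a b → not (a ∨ b) ≡ false → 1 ≤ bit a + bit b
          cover true  b     _ = s≤s z≤n
          cover false true  _ = s≤s z≤n

        avoids-d : ∀ i → lookup d i ≡ true → lookup z i ≡ false
        avoids-d i dᵢ = trans (lookup∘tabulate _ i) (avoid _ _ _ (trans (cong (lookup d) place≡i) dᵢ))
          where
          j′ = proj₁ (remQuot {s} (L * s) i)
          r  = proj₂ (remQuot {s} (L * s) i)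
          place≡i : place j′ (proj₁ (remQuot {L} s r)) (proj₂ (remQuot {L} s r)) ≡ i
          place≡i = trans (cong (combine j′) (combine-remQuot {L} s r)) (combine-remQuot {s} (L * s) i)
          avoid : ∀ j′ l x → lookup d (place j′ l x) ≡ true → value j′ l x ≡ false
          avoid j′ l x d≡ with j′ ≟ j
          ... | no  _    = refl
          ... | yes refl rewrite d≡ = refl

-- Inequalities between powers of logarithms from integer bounds.

module LogInequality where
  open import Data.Integer using (+_; +≤+)
  import Data.Integer.Properties as ℤ
  open import Data.Nat as ℕ using (ℕ; zero; suc; NonZero)
  import Data.Nat.Properties as ℕ
  open import Data.Product using (∃; _×_; _,_)
  open import Data.Rational hiding (NonZero)
  open import Data.Rational.Properties
  import Data.Rational.Unnormalised as ℚᵘ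
  import Data.Rational.Unnormalised.Properties as ℚᵘ
  open import Relation.Binary.PropositionalEquality
  open import Algebra.Definitions.RawSemiring +-*-rawSemiring using () renaming (_^_ to _^ℚ_)
  open import Defs

  fromℕ : ℕ → ℚ
  fromℕ n = + n / 1

  fromℚᵘ-mono-≤ : ∀ p q → p ℚᵘ.≤ q → fromℚᵘ p ≤ fromℚᵘ q
  fromℚᵘ-mono-≤ p q p≤q = toℚᵘ-cancel-≤ (ℚᵘ.≤-respˡ-≃ (ℚᵘ.≃-sym (toℚᵘ-fromℚᵘ p))
    (ℚᵘ.≤-respʳ-≃ (ℚᵘ.≃-sym (toℚᵘ-fromℚᵘ q)) p≤q))

  /≤fromℕ : ∀ a b u .{{_ : NonZero b}} → a ℕ.≤ u ℕ.* b → + a / b ≤ fromℕ u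
  /≤fromℕ a (suc b) u a≤ub = fromℚᵘ-mono-≤ (ℚᵘ.mkℚᵘ (+ a) b) (ℚᵘ.mkℚᵘ (+ u) 0)
    (ℚᵘ.*≤* (subst₂ Data.Integer._≤_ (sym (ℤ.*-identityʳ (+ a))) (ℤ.pos-* u (suc b)) (+≤+ a≤ub)))

  fromℕ≤/ : ∀ d e u .{{_ : NonZero e}} → u ℕ.* e ℕ.≤ d → fromℕ u ≤ + d / e
  fromℕ≤/ d (suc e) u ue≤d = fromℚᵘ-mono-≤ (ℚᵘ.mkℚᵘ (+ u) 0) (ℚᵘ.mkℚᵘ (+ d) e)
    (ℚᵘ.*≤* (subst₂ Data.Integer._≤_ (ℤ.pos-* u (suc e)) (sym (ℤ.*-identityʳ (+ d))) (+≤+ ue≤d)))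

  fromℕ-mono-≤ : ∀ {m n} → m ℕ.≤ n → fromℕ m ≤ fromℕ n
  fromℕ-mono-≤ {m} {n} m≤n = /≤fromℕ m 1 n (subst (m ℕ.≤_) (sym (ℕ.*-identityʳ n)) m≤n)

  fromℕ-* : ∀ m n → fromℕ (m ℕ.* n) ≡ fromℕ m * fromℕ n
  fromℕ-* m n = toℚᵘ-injective (ℚᵘ.≃-trans (to (m ℕ.* n)) (ℚᵘ.≃-trans
    (ℚᵘ.*≡* (cong₂ Data.Integer._*_ (ℤ.pos-* m n) refl))
    (ℚᵘ.≃-sym (ℚᵘ.≃-trans (toℚᵘ-homo-* (fromℕ m) (fromℕ n)) (ℚᵘ.*-cong (to m) (to n))))))
    where
    to : ∀ n → toℚᵘ (fromℕ n) ℚᵘ.≃ ℚᵘ.mkℚᵘ (+ n) 0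
    to n = toℚᵘ-fromℚᵘ (ℚᵘ.mkℚᵘ (+ n) 0)

  fromℕ-^ : ∀ m n → fromℕ (m ℕ.^ n) ≡ fromℕ m ^ℚ n
  fromℕ-^ m zero    = refl
  fromℕ-^ m (suc n) = trans (fromℕ-* m (m ℕ.^ n)) (cong (fromℕ m *_) (fromℕ-^ m n))

  0≤fromℕ : ∀ n → 0ℚ ≤ fromℕ n
  0≤fromℕ n = fromℕ-mono-≤ {0} {n} ℕ.z≤n

  0≤/ : ∀ a b .{{_ : NonZero b}} → 0ℚ ≤ + a / b
  0≤/ a b = fromℕ≤/ a b 0 ℕ.z≤n

  *-mono : ∀ {p q r s} → 0ℚ ≤ r → 0ℚ ≤ q → p ≤ q → r ≤ s → p * r ≤ q * s
  *-mono {p} {q} {r} {s} 0≤r 0≤q p≤q r≤s = ≤-trans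
    (*-monoʳ-≤-nonNeg r {{nonNegative 0≤r}} p≤q) (*-monoˡ-≤-nonNeg q {{nonNegative 0≤q}} r≤s)

  ^-nonNeg : ∀ {p} n → 0ℚ ≤ p → 0ℚ ≤ p ^ℚ n
  ^-nonNeg     zero    0≤p = fromℕ-mono-≤ {0} {1} ℕ.z≤n
  ^-nonNeg {p} (suc n) 0≤p = subst (_≤ p * p ^ℚ n) (*-zeroʳ p)
    (*-monoˡ-≤-nonNeg p {{nonNegative 0≤p}} (^-nonNeg n 0≤p))

  ^-mono-≤ : ∀ {p q} n → 0ℚ ≤ p → p ≤ q → p ^ℚ n ≤ q ^ℚ n
  ^-mono-≤ zero    0≤p p≤q = ≤-refl
  ^-mono-≤ (suc n) 0≤p p≤q = *-mono (^-nonNeg n 0≤p) (≤-trans 0≤p p≤q) p≤q (^-mono-≤ n 0≤p p≤q)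

  ^-*-distrib : ∀ p q n → (p * q) ^ℚ n ≡ p ^ℚ n * q ^ℚ n
  ^-*-distrib p q zero    = refl
  ^-*-distrib p q (suc n) = trans (cong (p * q *_) (^-*-distrib p q n)) (begin
    p * q * (p ^ℚ n * q ^ℚ n)   ≡⟨ *-assoc p q _ ⟩
    p * (q * (p ^ℚ n * q ^ℚ n)) ≡⟨ cong (p *_) (trans (sym (*-assoc q _ _))
                                     (trans (cong (_* q ^ℚ n) (*-comm q (p ^ℚ n))) (*-assoc (p ^ℚ n) q _))) ⟩
    p * (p ^ℚ n * (q * q ^ℚ n)) ≡⟨ sym (*-assoc p _ _) ⟩
    p * p ^ℚ n * (q * q ^ℚ n)   ∎)
    where open ≡-Reasoning

  1-^ : ∀ n → 1ℚ ^ℚ n ≡ 1ℚ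
  1-^ zero    = refl
  1-^ (suc n) = trans (*-identityˡ _) (1-^ n)

  2^-cancel-≤ : ∀ {m n} → 2 ℕ.^ m ℕ.≤ 2 ℕ.^ n → m ℕ.≤ n
  2^-cancel-≤ {m} {n} le = ℕ.≮⇒≥ λ n<m → ℕ.<⇒≱ (ℕ.^-monoʳ-< 2 (ℕ.s≤s (ℕ.s≤s ℕ.z≤n)) n<m) le

  -- Every admissible a / b is at most U and every admissible d / e at least K, so for c = 1 / C the
  -- claim reduces to U^p ≤ (C K)^q.
  log-bound : ∀ c C p q U K {n k} → c * fromℕ C ≡ 1ℚ → 0ℚ ≤ c →
    n ℕ.≤ 2 ℕ.^ U → 2 ℕ.^ K ℕ.≤ k → U ℕ.^ p ℕ.≤ C ℕ.^ q ℕ.* K ℕ.^ q →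
    c ·log₂ n ^[ p / q ]≤log₂ k
  log-bound c C p q U K {n} {k} cC≡1 0≤c n≤ ≤k U≤ a b d e 2^a≤ ≤2^d = begin
    c ^ℚ q * (+ a / b) ^ℚ p
      ≤⟨ *-monoˡ-≤-nonNeg (c ^ℚ q) {{nonNegative (^-nonNeg q 0≤c)}} (begin
           (+ a / b) ^ℚ p              ≤⟨ ^-mono-≤ p (0≤/ a b) (/≤fromℕ a b U a≤Ub) ⟩
           fromℕ U ^ℚ p                ≡⟨ sym (fromℕ-^ U p) ⟩
           fromℕ (U ℕ.^ p)             ≤⟨ fromℕ-mono-≤ U≤ ⟩
           fromℕ (C ℕ.^ q ℕ.* K ℕ.^ q) ≡⟨ fromℕ-* (C ℕ.^ q) (K ℕ.^ q) ⟩
           fromℕ (C ℕ.^ q) * fromℕ (K ℕ.^ q)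
                                       ≡⟨ cong₂ _*_ (fromℕ-^ C q) (fromℕ-^ K q) ⟩
           fromℕ C ^ℚ q * fromℕ K ^ℚ q ∎) ⟩
    c ^ℚ q * (fromℕ C ^ℚ q * fromℕ K ^ℚ q)
      ≡⟨ sym (*-assoc (c ^ℚ q) _ _) ⟩
    c ^ℚ q * fromℕ C ^ℚ q * fromℕ K ^ℚ q
      ≡⟨ cong (_* fromℕ K ^ℚ q) (trans (sym (^-*-distrib c (fromℕ C) q)) (trans (cong (_^ℚ q) cC≡1) (1-^ q))) ⟩
    1ℚ * fromℕ K ^ℚ q
      ≡⟨ *-identityˡ _ ⟩
    fromℕ K ^ℚ q
      ≤⟨ ^-mono-≤ q (0≤fromℕ K) (fromℕ≤/ d e K Ke≤d) ⟩
    (+ d / e) ^ℚ q ∎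
    where
    open ≤-Reasoning
    a≤Ub : a ℕ.≤ U ℕ.* b
    a≤Ub = 2^-cancel-≤ (ℕ.≤-trans 2^a≤ (subst (n ℕ.^ b ℕ.≤_) (ℕ.^-*-assoc 2 U b) (ℕ.^-monoˡ-≤ b n≤)))
    Ke≤d : K ℕ.* e ℕ.≤ d
    Ke≤d = 2^-cancel-≤ (ℕ.≤-trans (subst (ℕ._≤ k ℕ.^ e) (ℕ.^-*-assoc 2 K e) (ℕ.^-monoˡ-≤ e ≤k)) ≤2^d)

  inverse : ∀ n .{{_ : NonZero n}} → ∃ λ c → c > 0ℚ × c * fromℕ n ≡ 1ℚ
  inverse (suc n) = + 1 / suc n , positive⁻¹ (+ 1 / suc n) {{normalize-pos 1 (suc n)}} ,
    toℚᵘ-injective (ℚᵘ.≃-trans (toℚᵘ-homo-* (+ 1 / suc n) (fromℕ (suc n))) (ℚᵘ.≃-trans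
      (ℚᵘ.*-cong (toℚᵘ-fromℚᵘ (ℚᵘ.mkℚᵘ (+ 1) n)) (toℚᵘ-fromℚᵘ (ℚᵘ.mkℚᵘ (+ suc n) 0)))
      (ℚᵘ.*≡* (cong +_ (lem n)))))
    where
    open import Data.Nat.Tactic.RingSolver using (solve-∀)
    lem : ∀ n → (1 ℕ.* suc n) ℕ.* 1 ≡ 1 ℕ.* (suc n ℕ.* 1)
    lem = solve-∀

  inverse-2^ : ∀ e → ∃ λ c → c > 0ℚ × c * fromℕ (2 ℕ.^ e) ≡ 1ℚ
  inverse-2^ e = inverse (2 ℕ.^ e) {{ℕ.m^n≢0 2 e}}

-- Choice of parameters.

module Parameters where
  open import Data.Fin using (Fin)
  open import Data.Nat
  open import Data.Nat.Properties
  open import Data.Nat.Tactic.RingSolver using (solve-∀)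
  open import Data.Product using (∃; proj₁; proj₂)
  open import Data.Rational as ℚ using (0ℚ; 1ℚ)
  open import Relation.Binary.PropositionalEquality
  open import Defs
  open RectangleGraph using (UnambiguousDNF)
  open Bernoulli
  open Code using (Word; agree; code)
  open TournamentDNF
  open LowerBound
  open LogInequality using (fromℕ; log-bound)

  n<2^n : ∀ n → n < 2 ^ n
  n<2^n zero    = s≤s z≤n
  n<2^n (suc n) = begin-strict
    suc n               ≤⟨ n<2^n n ⟩
    2 ^ n               <⟨ ^-monoʳ-< 2 (s≤s (s≤s z≤n)) (n<1+n n) ⟩
    2 ^ suc n           ∎
    where open ≤-Reasoning

  ≤2^-* : ∀ {m n} a b {c} → m ≤ 2 ^ a → n ≤ 2 ^ b → a + b ≡ c → m * n ≤ 2 ^ c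
  ≤2^-* {m} {n} a b m≤ n≤ refl = subst (m * n ≤_) (sym (^-distribˡ-+-* 2 a b)) (*-mono-≤ m≤ n≤)

  ≤2^-+ : ∀ {m n} a {c} → m ≤ 2 ^ a → n ≤ 2 ^ a → suc a ≡ c → m + n ≤ 2 ^ c
  ≤2^-+ {m} {n} a m≤ n≤ refl =
    subst (m + n ≤_) (cong (2 ^ a +_) (sym (+-identityʳ (2 ^ a)))) (+-mono-≤ m≤ n≤)

  ≤2^-weaken : ∀ {m} a b {c} → m ≤ 2 ^ a → a + b ≡ c → m ≤ 2 ^ c
  ≤2^-weaken a b m≤ refl = ≤-trans m≤ (^-monoʳ-≤ 2 (m≤m+n a b))

  -- With powers of 2 around U and K, the comparison becomes one of exponents that are linear in y.
  power-bound : ∀ p q c {U K} u v → U ≤ 2 ^ u → 2 ^ v ≤ K → u * p ≤ (c + v) * q →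
                U ^ p ≤ (2 ^ c) ^ q * K ^ q
  power-bound p q c {U} {K} u v U≤ ≤K le = begin
    U ^ p                     ≤⟨ ^-monoˡ-≤ p U≤ ⟩
    (2 ^ u) ^ p               ≡⟨ ^-*-assoc 2 u p ⟩
    2 ^ (u * p)               ≤⟨ ^-monoʳ-≤ 2 le ⟩
    2 ^ ((c + v) * q)         ≡⟨ cong (2 ^_) (*-distribʳ-+ q c v) ⟩
    2 ^ (c * q + v * q)       ≡⟨ ^-distribˡ-+-* 2 (c * q) (v * q) ⟩
    2 ^ (c * q) * 2 ^ (v * q) ≡⟨ cong₂ _*_ (sym (^-*-assoc 2 c q)) (sym (^-*-assoc 2 v q)) ⟩
    (2 ^ c) ^ q * (2 ^ v) ^ q ≤⟨ *-monoʳ-≤ ((2 ^ c) ^ q) (^-monoˡ-≤ q ≤K) ⟩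
    (2 ^ c) ^ q * K ^ q       ∎
    where open ≤-Reasoning

  -- With h = 2^ℓ, the width of the DNF is of order ℓ h³ and the hardness K is
  -- of order ℓ h⁴.
  module _ (y : ℕ) where

    ℓ h β B half s λ₀ L D t M N ρ τ width K U : ℕ
    -- Because y < 2^y, the factor 8 makes the logarithm ℓ at most 8 h^(1/8). The two logarithmic
    -- factors of U then cost h^(1/4), which leaves the exponent 4 / (3 + 1/4) = 16/13.
    ℓ     = y * 8
    h     = 2 ^ ℓ
    -- B = 4 h² exceeds the h + h² apexes that `dominated` excludes.
    β     = ℓ + ℓ + 2
    B     = 2 ^ β
    -- The factor 4 makes L = half λ₀ equal to 2 D (2 + h), so that t is half of L. With s = 2 half,
    -- (1 + 1/s)^half ≤ 2, hence (1 + 1/s)^L ≤ 2^λ₀, as the code requires.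
    half  = 4 * (2 + h)
    s     = half + half
    -- An upper bound for log₂ M: one apex, h flips, and a block with s ≤ 2^(ℓ + 5).
    λ₀    = β + (β * h + (ℓ + 5))
    L     = half * λ₀
    D     = λ₀ + λ₀
    t     = D * (2 + h)
    M     = B * (B ^ h * s)
    N     = s * (L * s)
    -- One more than the exponent in 2 N ≤ 2^(33 y + 22), since the inequality for 2^ρ has to be
    -- strict.
    ρ     = y * 33 + 23
    τ     = 4 + (ρ + ρ)
    width = L * s + s * L
    K     = s * (suc h * t)
    -- A bound for the binary logarithm of the order: a vertex is a name together with one pair of
    -- letters, 2 τ bits, per position of the term.
    U     = λ₀ + (τ + τ) * width

    private
      0<h : 1 ≤ h
      0<h = m^n>0 2 ℓ

      1≤2^ : ∀ a → 1 ≤ 2 ^ a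
      1≤2^ a = m^n>0 2 a

      y≤ : y ≤ 2 ^ y
      y≤ = <⇒≤ (n<2^n y)

      ℓ≤ : ℓ ≤ 2 ^ (y + 3)
      ℓ≤ = ≤2^-* y 3 y≤ ≤-refl refl

      2+h≤ : 2 + h ≤ 2 ^ (ℓ + 2)
      2+h≤ = ≤2^-+ (ℓ + 1) (≤2^-* ℓ 1 (1≤2^ ℓ) ≤-refl refl) (≤2^-weaken ℓ 1 ≤-refl refl) (sym (+-suc ℓ 1))

      half≤ : half ≤ 2 ^ (ℓ + 4)
      half≤ = ≤2^-* 2 (ℓ + 2) ≤-refl 2+h≤ (lem ℓ)
        where
        lem : ∀ ℓ → 2 + (ℓ + 2) ≡ ℓ + 4
        lem = solve-∀

      s≤ : s ≤ 2 ^ (ℓ + 5)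
      s≤ = ≤2^-+ (ℓ + 4) half≤ half≤ (sym (+-suc ℓ 4))

      β≤ : β ≤ 2 ^ (y + 5)
      β≤ = ≤2^-+ (y + 4) (≤2^-+ (y + 3) ℓ≤ ℓ≤ (sym (+-suc y 3)))
        (≤2^-* y 4 (1≤2^ y) (s≤s (s≤s z≤n)) refl) (sym (+-suc y 4))

      λ₀≤ : λ₀ ≤ 2 ^ (y * 9 + 7)
      λ₀≤ = ≤2^-+ (y * 9 + 6) (≤2^-weaken (y + 5) (y * 8 + 1) β≤ (lem₁ y))
        (≤2^-+ (y * 9 + 5) (≤2^-* (y + 5) (y * 8) β≤ ≤-refl (lem₂ y))
          (≤2^-+ (y * 9 + 4) (≤2^-weaken (y + 3) (y * 8 + 1) ℓ≤ (lem₃ y))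
            (≤2^-* (y * 9) 4 (1≤2^ (y * 9)) (s≤s (s≤s (s≤s (s≤s (s≤s z≤n))))) refl) (sym (+-suc (y * 9) 4)))
          (sym (+-suc (y * 9) 5)))
        (sym (+-suc (y * 9) 6))
        where
        lem₁ : ∀ y → y + 5 + (y * 8 + 1) ≡ y * 9 + 6
        lem₁ = solve-∀
        lem₂ : ∀ y → y + 5 + y * 8 ≡ y * 9 + 5
        lem₂ = solve-∀
        lem₃ : ∀ y → y + 3 + (y * 8 + 1) ≡ y * 9 + 4
        lem₃ = solve-∀

      L≤ : L ≤ 2 ^ (y * 17 + 11)
      L≤ = ≤2^-* (ℓ + 4) (y * 9 + 7) half≤ λ₀≤ (lem y)
        where
        lem : ∀ y → y * 8 + 4 + (y * 9 + 7) ≡ y * 17 + 11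
        lem = solve-∀

      Ls≤ : L * s ≤ 2 ^ (y * 25 + 16)
      Ls≤ = ≤2^-* (y * 17 + 11) (ℓ + 5) L≤ s≤ (lem y)
        where
        lem : ∀ y → y * 17 + 11 + (y * 8 + 5) ≡ y * 25 + 16
        lem = solve-∀

      N≤ : N ≤ 2 ^ (y * 33 + 21)
      N≤ = ≤2^-* (ℓ + 5) (y * 25 + 16) s≤ Ls≤ (lem y)
        where
        lem : ∀ y → y * 8 + 5 + (y * 25 + 16) ≡ y * 33 + 21
        lem = solve-∀

      N-small : N + N < 2 ^ ρ
      N-small = ≤-<-trans (≤2^-+ (y * 33 + 21) N≤ N≤ (sym (+-suc (y * 33) 21)))
        (^-monoʳ-< 2 (s≤s (s≤s z≤n)) (+-monoʳ-< (y * 33) (n<1+n 22)))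

      width≤ : width ≤ 2 ^ (y * 25 + 17)
      width≤ = ≤2^-+ (y * 25 + 16) Ls≤ (subst (_≤ 2 ^ (y * 25 + 16)) (*-comm L s) Ls≤) (sym (+-suc (y * 25) 16))

      ρ≤ : ρ ≤ 2 ^ (y + 7)
      ρ≤ = ≤2^-+ (y + 6) (≤2^-* y 6 y≤ (m≤m+n 33 31) refl)
        (≤2^-* y 6 (1≤2^ y) (m≤m+n 23 41) refl) (sym (+-suc y 6))

      2τ≤ : τ + τ ≤ 2 ^ (y + 10)
      2τ≤ = ≤2^-+ (y + 9) τ≤ τ≤ (sym (+-suc y 9))
        where
        τ≤ : τ ≤ 2 ^ (y + 9)
        τ≤ = ≤2^-+ (y + 8) (≤2^-* y 8 (1≤2^ y) (m≤m+n 4 252) refl)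
          (≤2^-+ (y + 7) ρ≤ ρ≤ (sym (+-suc y 7))) (sym (+-suc y 8))

    -- The width contributes h³ = 2^(24 y) and the logarithmic factor in λ₀, the gadget length τ a
    -- second one; each such factor is at most a constant times 2^y.
    U≤ : U ≤ 2 ^ (y * 26 + 28)
    U≤ = ≤2^-+ (y * 26 + 27) (≤2^-weaken (y * 9 + 7) (y * 17 + 20) λ₀≤ (lem₁ y))
      (≤2^-* (y + 10) (y * 25 + 17) 2τ≤ width≤ (lem₂ y)) (sym (+-suc (y * 26) 27))
      where
      lem₁ : ∀ y → y * 9 + 7 + (y * 17 + 20) ≡ y * 26 + 27
      lem₁ = solve-∀
      lem₂ : ∀ y → y + 10 + (y * 25 + 17) ≡ y * 26 + 27
      lem₂ = solve-∀

    private
      h≤half : h ≤ half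
      h≤half = ≤-trans (m≤n+m h 2) (m≤m+n (2 + h) (3 * (2 + h)))

      1≤β : 1 ≤ β
      1≤β = ≤-trans (s≤s z≤n) (m≤n+m 2 (ℓ + ℓ))

      h≤D : h ≤ D
      h≤D = begin
        h                  ≡⟨ sym (*-identityˡ h) ⟩
        1 * h              ≤⟨ *-monoˡ-≤ h 1≤β ⟩
        β * h              ≤⟨ m≤m+n (β * h) (ℓ + 5) ⟩
        β * h + (ℓ + 5)    ≤⟨ m≤n+m (β * h + (ℓ + 5)) β ⟩
        λ₀                 ≤⟨ m≤m+n λ₀ λ₀ ⟩
        D                  ∎
        where open ≤-Reasoning

    -- Each of the factors s, h + 1, D and 2 + h is at least h; the logarithm contained in D is
    -- given away.
    ≤K : 2 ^ (y * 32) ≤ K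
    ≤K = begin
      2 ^ (y * 32)           ≡⟨ cong (2 ^_) (lem y) ⟩
      2 ^ (ℓ + (ℓ + (ℓ + ℓ))) ≡⟨ trans (^-distribˡ-+-* 2 ℓ _) (cong (h *_) (trans (^-distribˡ-+-* 2 ℓ _)
                                 (cong (h *_) (^-distribˡ-+-* 2 ℓ ℓ)))) ⟩
      h * (h * (h * h))      ≤⟨ *-mono-≤ (≤-trans h≤half (m≤m+n half half))
                                  (*-mono-≤ (n≤1+n h) (*-mono-≤ h≤D (m≤n+m h 2))) ⟩
      K                      ∎
      where
      open ≤-Reasoning
      lem : ∀ y → y * 32 ≡ y * 8 + (y * 8 + (y * 8 + y * 8))
      lem = solve-∀

    private
      room : h + h * h < B
      room = begin-strict
        h + h * h              ≤⟨ +-monoˡ-≤ (h * h) (subst (_≤ h * h) (*-identityˡ h) (*-monoˡ-≤ h 0<h)) ⟩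
        h * h + h * h          ≡⟨ sym (cong₂ _+_ h² h²) ⟩
        2 ^ (ℓ + ℓ) + 2 ^ (ℓ + ℓ) ≤⟨ ≤2^-+ (ℓ + ℓ) ≤-refl ≤-refl refl ⟩
        2 ^ suc (ℓ + ℓ)        <⟨ ^-monoʳ-< 2 (s≤s (s≤s z≤n)) (subst (suc (ℓ + ℓ) <_) (+-comm 2 (ℓ + ℓ)) (n<1+n _)) ⟩
        B                      ∎
        where
        open ≤-Reasoning
        h² : 2 ^ (ℓ + ℓ) ≡ h * h
        h² = ^-distribˡ-+-* 2 ℓ ℓ

      M≤ : M ≤ 2 ^ λ₀
      M≤ = ≤2^-* β (β * h + (ℓ + 5)) ≤-refl
        (≤2^-* (β * h) (ℓ + 5) (≤-reflexive (^-*-assoc 2 β h)) s≤ refl) refl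

      short : (1 + s) ^ L ≤ 2 ^ λ₀ * s ^ L
      short = begin
        (1 + s) ^ (half * λ₀)      ≡⟨ sym (^-*-assoc (1 + s) half λ₀) ⟩
        ((1 + s) ^ half) ^ λ₀      ≤⟨ ^-monoˡ-≤ λ₀ (bernoulli-half half) ⟩
        (2 * s ^ half) ^ λ₀        ≡⟨ distrib 2 (s ^ half) λ₀ ⟩
        2 ^ λ₀ * (s ^ half) ^ λ₀   ≡⟨ cong (2 ^ λ₀ *_) (^-*-assoc s half λ₀) ⟩
        2 ^ λ₀ * s ^ (half * λ₀)   ∎
        where
        open ≤-Reasoning
        distrib : ∀ m n o → (m * n) ^ o ≡ m ^ o * n ^ o
        distrib m n zero    = refl
        distrib m n (suc o) = trans (cong (m * n *_) (distrib m n o)) (lem m n (m ^ o) (n ^ o))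
          where
          lem : ∀ a b c d → a * b * (c * d) ≡ a * c * (b * d)
          lem = solve-∀

      words : ∃ λ (w : Fin M → Word L s) → ∀ {i j} → i ≢ j → agree (w i) (w j) ≤ D
      words = code L (pred s) λ₀ short M M≤

      T : DominatedTournament M h s
      T = tournament B h s room

      F : UnambiguousDNF N
      F = dnf T (proj₁ words)

      L≡ : t + D * (2 + h) ≡ L
      L≡ = lem λ₀ h
        where
        lem : ∀ a h → (a + a) * (2 + h) + (a + a) * (2 + h) ≡ 4 * (2 + h) * a
        lem = solve-∀

    G : Graph
    G = cisGraph F ρ N-small

    2^K≤cover : ∀ {m} → Coverable (CIS G) m → 2 ^ K ≤ m
    2^K≤cover = coverable⇒2^K≤ F ρ N-small K (¬zero-satisfies T (proj₁ words) 0<h)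
      (hard T (proj₁ words) D t (proj₂ words) L≡)

    order≤2^U : order G ≤ 2 ^ U
    order≤2^U = ≤2^-* λ₀ ((τ + τ) * width) M≤
      (≤-reflexive (trans (cong (_^ width) (sym (^-distribˡ-+-* 2 τ τ))) (^-*-assoc 2 (τ + τ) width))) refl

    y≤order : y ≤ order G
    y≤order = begin
      y                             ≤⟨ m≤m*n y 8 ⟩
      ℓ                             ≤⟨ ≤-trans (m≤m+n ℓ (ℓ + 2)) (≤-reflexive (sym (+-assoc ℓ ℓ 2))) ⟩
      β                             ≤⟨ <⇒≤ (n<2^n β) ⟩
      B                             ≤⟨ m≤m*n B (B ^ h * s) {{m*n≢0 (B ^ h) s {{m^n≢0 B h {{m^n≢0 2 β}}}}}} ⟩
      M                             ≤⟨ m≤m*n M ((2 ^ τ * 2 ^ τ) ^ width)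
                                         {{m^n≢0 (2 ^ τ * 2 ^ τ) width {{m*n≢0 (2 ^ τ) (2 ^ τ) {{m^n≢0 2 τ}} {{m^n≢0 2 τ}}}}}} ⟩
      order G                       ∎
      where open ≤-Reasoning

    log-lower-bound : ∀ e p q {c} → (y * 26 + 28) * p ≤ (e + y * 32) * q →
      c ℚ.* fromℕ (2 ^ e) ≡ 1ℚ → 0ℚ ℚ.≤ c → ∀ {k} → Coverable (CIS G) k →
      c ·log₂ order G ^[ p / q ]≤log₂ k
    log-lower-bound e p q {c} le c≡ 0≤c cov = log-bound c (2 ^ e) p q U K c≡ 0≤c order≤2^U
      (2^K≤cover cov) (power-bound p q e (y * 26 + 28) (y * 32) U≤ ≤K le)

open import Defs
open import Data.Nat using (ℕ; _≤_)
open import Data.Product using (∃; Σ-syntax; _×_)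
open import Data.Rational using (ℚ; 0ℚ; _>_)

open import Data.Nat using (_+_; _*_)
open import Data.Nat.Properties using (≤-trans; m≤m+n)
open import Data.Nat.Tactic.RingSolver using (solve-∀)
open import Data.Product using (_,_)
open import Data.Rational.Properties using (<⇒≤)
open import Relation.Binary.PropositionalEquality using (_≡_; subst)
open CoverNumbers using (CIS-coverNumber)
open LogInequality using (inverse-2^)
open Parameters using (G; y≤order; log-lower-bound)

-- The slope 32/26 = 16/13 exceeds 61/50, since 26 · 61 = 1586 and 32 · 50 = 1600. The number 35 is
-- the least that absorbs the constant terms, 28 · 61 = 1708 ≤ 1750, and makes 2^-35 the constant
-- hidden by Ω.
exponents : ∀ y → (y * 26 + 28) * 61 ≤ (35 + y * 32) * 50
exponents y = subst ((y * 26 + 28) * 61 ≤_) (lem y) (m≤m+n ((y * 26 + 28) * 61) (y * 14 + 42))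
  where
  lem : ∀ y → (y * 26 + 28) * 61 + (y * 14 + 42) ≡ (35 + y * 32) * 50
  lem = solve-∀

corollary7 : Σ[ G ∈ (ℕ → Graph) ]
    (∀ N → ∃ λ i₀ → ∀ i → i₀ ≤ i → N ≤ order (G i)) ×
    (Σ[ c ∈ ℚ ] c > 0ℚ ×
    (∀ i → ∃ λ k → IsCoverNumber (CIS (G i)) k ×
    c ·log₂ order (G i) ^[ 61 / 50 ]≤log₂ k))
corollary7 =
  let c , c>0 , c*2^35≡1 = inverse-2^ 35
  in G , (λ N → N , λ i N≤i → ≤-trans N≤i (y≤order i)) , c , c>0 , λ i →
    let k , coverable , minimal = CIS-coverNumber (G i)
    in k , (coverable , minimal) ,
       log-lower-bound i 35 61 50 (exponents i) c*2^35≡1 (<⇒≤ c>0) coverable
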